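{- Let $L/K$ be a finite extension, $L_S/K$ its maximal separable subextension, and $A=\mathrm{Aut}(L/K)$ with fixed field $L^A$. Then (1) There is a unique subextension $N'/K$ of $L/K$ such that $L/N'$ is normal with $[L:N']=d_K(L)$. (2) If $N''/K$ is a subextension of $L/K$ such that $L/N''$ is normal, then $N''\supset N'$. (3) $N'=(L^A)_S$, the maximal separable subextension of $L^A/K$; moreover $d_K(L)=r_K(L)\cdot[L:L_S]=l_K(L)$ and $d_K(L)\cdot s_K(L)=[L:K]$. Thus the multicluster size is the descending normal index. (4) $L/K$ is normal if and only if $d_K(L)=[L:K]$.
   Context: $K$ is any field (not necessarily perfect) with a fixed algebraic closure $\bar K$; all extensions are finite and contained in $\bar K$. The descending normal index $d_K(L)$ is the maximum of $[L:N]$ over intermediate fields $K\subset N\subset L$ such that $L/N$ is normal. The cluster size is $r_K(L)=|\mathrm{Aut}(L/K)|$; the multicluster size is $l_K(L)=[L:L_S]\cdot r_K(L)$; $s_K(L)$ is the number of distinct subfields of $\bar K$ isomorphic to $L$ over $K$. -}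

module Defs where

open import Level using (Level; _⊔_; suc)
open import Algebra.Bundles using (CommutativeRing; RawRing)
open import Algebra.Morphism.Structures using (module RingMorphisms)
open import Axiom.ExcludedMiddle using (ExcludedMiddle)
open import Data.List.Base as List using (List; []; _∷_)
open import Data.List.Relation.Unary.All using (All)
import Data.List.Relation.Unary.Unique.Setoid as UniqueSetoid
open import Data.Nat.Base as ℕ using (ℕ; zero)
open import Data.Fin.Base using (Fin)
open import Data.Product using (Σ; ∃; _×_; _,_; proj₁; proj₂)
open import Function.Base using (_on_)
open import Function.Bundles using (Bijection)
open import Relation.Binary.Bundles using (Setoid)
import Relation.Binary.Construct.On as On
open import Relation.Binary.PropositionalEquality using (_≡_)
  renaming (setoid to ≡-setoid)
import Relation.Binary.Reasoning.Setoid as SetoidReasoning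
open import Relation.Nullary using (¬_; Dec; yes; no)
import Relation.Unary as U
open import Relation.Unary using (Pred; _∈_)
import Algebra.Definitions.RawSemiring as RawSemiringDefinitions

private
  variable
    a c ℓ : Level

-- The library's HeytingField carries an apartness relation; this is the usual
-- classical notion, in which inequality is the negation of _≈_.
record Field c ℓ : Set (suc (c ⊔ ℓ)) where
  field
    commutativeRing : CommutativeRing c ℓ
  open CommutativeRing commutativeRing public
  field
    1≉0     : ¬ (1# ≈ 0#)
    inverse : ∀ x → ¬ (x ≈ 0#) → ∃ λ y → (x * y) ≈ 1#

-- Lists of coefficients, constant term first.  Trailing zeros are allowed, so
-- equality compares coefficients and not lists.
module Polynomial (R : RawRing c ℓ) where
  open RawRing R

  Poly : Set c
  Poly = List Carrier

  coeff : Poly → ℕ → Carrier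
  coeff []      _           = 0#
  coeff (a ∷ _) zero        = a
  coeff (_ ∷ p) (ℕ.suc n)   = coeff p n

  infix  4 _≈ₚ_
  infixl 6 _+ₚ_
  infixl 7 _*ₚ_

  _≈ₚ_ : Poly → Poly → Set ℓ
  p ≈ₚ q = ∀ n → coeff p n ≈ coeff q n

  _+ₚ_ : Poly → Poly → Poly
  []      +ₚ q       = q
  (a ∷ p) +ₚ []      = a ∷ p
  (a ∷ p) +ₚ (b ∷ q) = (a + b) ∷ (p +ₚ q)

  _*ₚ_ : Poly → Poly → Poly
  []      *ₚ q = []
  (a ∷ p) *ₚ q = List.map (a *_) q +ₚ (0# ∷ (p *ₚ q))

  polyRing : RawRing c ℓ
  polyRing = record
    { Carrier = Poly
    ; _≈_     = _≈ₚ_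
    ; _+_     = _+ₚ_
    ; _*_     = _*ₚ_
    ; -_      = List.map (-_)
    ; 0#      = []
    ; 1#      = 1# ∷ []
    }

  eval : Poly → Carrier → Carrier
  eval p x = List.foldr (λ a v → a + (x * v)) 0# p

  Monic : Poly → Set ℓ
  Monic p = ∃ λ n → (coeff p n ≈ 1#) × (∀ m → n ℕ.< m → coeff p m ≈ 0#)

  NonConstant : Poly → Set ℓ
  NonConstant p = ∃ λ n → ¬ (coeff p (ℕ.suc n) ≈ 0#)

  Irreducible : Poly → Set (c ⊔ ℓ)
  Irreducible = RawSemiringDefinitions.Irreducible (RawRing.rawSemiring polyRing)

  linearProduct : List Carrier → Poly
  linearProduct = List.foldr (λ a p → ((- a) ∷ 1# ∷ []) *ₚ p) (1# ∷ [])

module Subfields (Ω : Field c ℓ) where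
  open Field Ω public
  open Polynomial rawRing public
    using (_≈ₚ_; _*ₚ_; eval; NonConstant; linearProduct)
    renaming (Poly to Ω[X])
  open RawSemiringDefinitions (RawRing.rawSemiring rawRing) using (sum)

  record Subfield : Set (suc (c ⊔ ℓ)) where
    field
      elements  : Pred Carrier (c ⊔ ℓ)
      ≈-closed  : ∀ {x y} → x ≈ y → x ∈ elements → y ∈ elements
      0-closed  : 0# ∈ elements
      1-closed  : 1# ∈ elements
      +-closed  : ∀ {x y} → x ∈ elements → y ∈ elements → (x + y) ∈ elements
      *-closed  : ∀ {x y} → x ∈ elements → y ∈ elements → (x * y) ∈ elements
      -‿closed  : ∀ {x} → x ∈ elements → (- x) ∈ elements
      ⁻¹-closed : ∀ {x y} → x ∈ elements → (x * y) ≈ 1# → y ∈ elements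

    Elt : Set (c ⊔ ℓ)
    Elt = Σ Carrier elements

    eltRing : RawRing (c ⊔ ℓ) ℓ
    eltRing = record
      { Carrier = Elt
      ; _≈_     = _≈_ on proj₁
      ; _+_     = λ (x , p) (y , q) → x + y , +-closed p q
      ; _*_     = λ (x , p) (y , q) → x * y , *-closed p q
      ; -_      = λ (x , p) → - x , -‿closed p
      ; 0#      = 0# , 0-closed
      ; 1#      = 1# , 1-closed
      }

  open Subfield public

  infix 4 _⊆_ _≐_

  _⊆_ : Subfield → Subfield → Set (c ⊔ ℓ)
  N ⊆ L = elements N U.⊆ elements L

  _≐_ : Subfield → Subfield → Set (c ⊔ ℓ)
  N ≐ L = elements N U.≐ elements L

  infix 9 _[X]

  _[X] : Subfield → Set (c ⊔ ℓ)
  N [X] = Polynomial.Poly (eltRing N)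

  module PolyOver (N : Subfield) = Polynomial (eltRing N)

  toΩ : (N : Subfield) → N [X] → Ω[X]
  toΩ N = List.map proj₁

  Root : (N : Subfield) → N [X] → Carrier → Set ℓ
  Root N p x = eval (toΩ N p) x ≈ 0#

  AlgebraicOver : Subfield → Carrier → Set (c ⊔ ℓ)
  AlgebraicOver N x = ∃ λ (p : N [X]) → ¬ (PolyOver._≈ₚ_ N p []) × Root N p x

  IsMinimalPolynomial : (N : Subfield) → Carrier → N [X] → Set (c ⊔ ℓ)
  IsMinimalPolynomial N x p = PolyOver.Monic N p × PolyOver.Irreducible N p × Root N p x

  HasDistinctRoots : Ω[X] → Set (c ⊔ ℓ)
  HasDistinctRoots p =
    ∃ λ k → ∃ λ as → UniqueSetoid.Unique setoid as ×
                     p ≈ₚ (k ∷ []) *ₚ linearProduct as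

  -- The roots are taken in Ω, so this is separability when Ω is algebraically
  -- closed.
  SeparableOver : Subfield → Carrier → Set (c ⊔ ℓ)
  SeparableOver N x =
    ∃ λ (p : N [X]) → IsMinimalPolynomial N x p × HasDistinctRoots (toΩ N p)

  Separable : (L N : Subfield) → Set (c ⊔ ℓ)
  Separable L N = ∀ {x} → x ∈ elements L → SeparableOver N x

  SplitsIn : Subfield → Ω[X] → Set (c ⊔ ℓ)
  SplitsIn L p =
    ∃ λ k → ∃ λ as → k ∈ elements L × All (elements L) as ×
                     p ≈ₚ (k ∷ []) *ₚ linearProduct as

  -- In the relations between L and N below, as in Separable, L is the larger
  -- field: Normal L N says that L/N is normal.
  Normal : (L N : Subfield) → Set (c ⊔ ℓ)
  Normal L N =
    (∀ {x} → x ∈ elements L → AlgebraicOver N x) ×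
    (∀ (p : N [X]) → PolyOver.Irreducible N p →
       ∀ x → x ∈ elements L → Root N p x → SplitsIn L (toΩ N p))

  combination : ∀ N {n} → (Fin n → Elt N) → (Fin n → Carrier) → Carrier
  combination N k b = sum (λ i → proj₁ (k i) * b i)

  record Basis (L N : Subfield) (n : ℕ) : Set (c ⊔ ℓ) where
    field
      vectors     : Fin n → Carrier
      inL         : ∀ i → vectors i ∈ elements L
      spanning    : ∀ {x} → x ∈ elements L →
                    ∃ λ (k : Fin n → Elt N) → x ≈ combination N k vectors
      independent : ∀ (k : Fin n → Elt N) → combination N k vectors ≈ 0# →
                    ∀ i → proj₁ (k i) ≈ 0#

  Finite : (L N : Subfield) → Set (c ⊔ ℓ)
  Finite L N = ∃ (Basis L N)

  module Over (K : Subfield) where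

    IsSubextension : (N L : Subfield) → Set (c ⊔ ℓ)
    IsSubextension N L = K ⊆ N × N ⊆ L

    IsMaximalSeparableSubextension : (S L : Subfield) → Set (suc (c ⊔ ℓ))
    IsMaximalSeparableSubextension S L =
      IsSubextension S L × Separable S K ×
      (∀ E → IsSubextension E L → Separable E K → E ⊆ S)

    record KIso (E F : Subfield) : Set (c ⊔ ℓ) where
      open RingMorphisms (eltRing E) (eltRing F)
      field
        to                : Elt E → Elt F
        isRingIsomorphism : IsRingIsomorphism to
        fixesK            : ∀ x → proj₁ x ∈ elements K → proj₁ (to x) ≈ proj₁ x
      open IsRingIsomorphism isRingIsomorphism public

    open KIso using (to)

    Aut : Subfield → Setoid (c ⊔ ℓ) (c ⊔ ℓ)
    Aut L = record
      { Carrier       = KIso L L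
      ; _≈_           = λ σ τ → ∀ x → proj₁ (to σ x) ≈ proj₁ (to τ x)
      ; isEquivalence = record
        { refl  = λ _ → refl
        ; sym   = λ e x → sym (e x)
        ; trans = λ e f x → trans (e x) (f x)
        }
      }

    fixedField : Subfield → Subfield
    fixedField L = record
      { elements  = Fixed
      ; ≈-closed  = λ { x≈y (p , e) → ≈-closed L x≈y p , λ σ →
          trans (KIso.⟦⟧-cong σ (sym x≈y)) (trans (e σ) x≈y) }
      ; 0-closed  = 0-closed L , λ σ → KIso.0#-homo σ
      ; 1-closed  = 1-closed L , λ σ → KIso.1#-homo σ
      ; +-closed  = λ { (p , e) (q , f) → +-closed L p q , λ σ →
          trans (KIso.+-homo σ (_ , p) (_ , q)) (+-cong (e σ) (f σ)) }
      ; *-closed  = λ { (p , e) (q , f) → *-closed L p q , λ σ →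
          trans (KIso.*-homo σ (_ , p) (_ , q)) (*-cong (e σ) (f σ)) }
      ; -‿closed  = λ { (p , e) → -‿closed L p , λ σ →
          trans (KIso.-‿homo σ (_ , p)) (-‿cong (e σ)) }
      ; ⁻¹-closed = λ { {x} {y} (p , e) xy≈1 →
          let q = ⁻¹-closed L p xy≈1 in
          q , λ σ → inverse-unique xy≈1
            (trans (*-congʳ (sym (e σ)))
              (trans (sym (KIso.*-homo σ (x , p) (y , q)))
                (trans (KIso.⟦⟧-cong σ {x = x * y , *-closed L p q}
                                       {y = 1# , 1-closed L} xy≈1)
                       (KIso.1#-homo σ)))) }
      }
      where
      Fixed : Pred Carrier (c ⊔ ℓ)
      Fixed x = Σ (x ∈ elements L) λ p →
                  ∀ (σ : KIso L L) → proj₁ (to σ (x , p)) ≈ x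

      inverse-unique : ∀ {x y z} → (x * y) ≈ 1# → (x * z) ≈ 1# → z ≈ y
      inverse-unique {x} {y} {z} xy≈1 xz≈1 = begin
        z             ≈⟨ *-identityˡ z ⟨
        1# * z        ≈⟨ *-congʳ xy≈1 ⟨
        (x * y) * z   ≈⟨ *-congʳ (*-comm x y) ⟩
        (y * x) * z   ≈⟨ *-assoc y x z ⟩
        y * (x * z)   ≈⟨ *-congˡ xz≈1 ⟩
        y * 1#        ≈⟨ *-identityʳ y ⟩
        y             ∎
        where open SetoidReasoning setoid

    Conjugates : Subfield → Setoid (suc (c ⊔ ℓ)) (c ⊔ ℓ)
    Conjugates L = record
      { Carrier       = Σ Subfield λ E → K ⊆ E × KIso L E
      ; _≈_           = _≐_ on proj₁
      ; isEquivalence = On.isEquivalence proj₁ record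
        { refl  = (λ p → p) , (λ p → p)
        ; sym   = λ (f , g) → g , f
        ; trans = λ (f , g) (h , k) → (λ p → h (f p)) , (λ p → g (k p))
        }
      }

    -- Excluded middle turns the numerical invariants, each characterised by a
    -- property that at most one natural number has, into functions.
    module Invariants (em : ∀ {a} → ExcludedMiddle a) where

      private
        value : {P : ℕ → Set a} → Dec (∃ P) → ℕ
        value (yes (n , _)) = n
        value (no _)        = 0

      -- The number with property P, or 0 if there is none.
      the : (ℕ → Set a) → ℕ
      the P = value (em {P = ∃ P})

      ∣_∣ : ∀ {s t} → Setoid s t → ℕ
      ∣ S ∣ = the (λ n → Bijection (≡-setoid (Fin n)) S)

      [_∶_] : (L N : Subfield) → ℕ
      [ L ∶ N ] = the (Basis L N)

      IsDescendingNormalIndex : Subfield → ℕ → Set (suc (c ⊔ ℓ))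
      IsDescendingNormalIndex L d =
        (∃ λ N → IsSubextension N L × Normal L N × [ L ∶ N ] ≡ d) ×
        (∀ N → IsSubextension N L → Normal L N → [ L ∶ N ] ℕ.≤ d)

      descendingNormalIndex : Subfield → ℕ
      descendingNormalIndex L = the (IsDescendingNormalIndex L)

      clusterSize : Subfield → ℕ
      clusterSize L = ∣ Aut L ∣

      -- L_S is meant to be the maximal separable subextension of L/K.
      multiclusterSize : (L L_S : Subfield) → ℕ
      multiclusterSize L L_S = [ L ∶ L_S ] ℕ.* clusterSize L

      conjugateCount : Subfield → ℕ
      conjugateCount L = ∣ Conjugates L ∣

module _ (K : Field c ℓ) (Ω : Field c ℓ) where
  private
    module K = Field K
  open Subfields Ω
  open RingMorphisms K.rawRing rawRing using (IsRingHomomorphism)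

  image : (ι : K.Carrier → Carrier) → IsRingHomomorphism ι → Subfield
  image ι hom = record
    { elements  = InImage
    ; ≈-closed  = λ { x≈y (k , e) → k , trans e x≈y }
    ; 0-closed  = K.0# , 0#-homo
    ; 1-closed  = K.1# , 1#-homo
    ; +-closed  = λ { (k , e) (m , f) →
        k K.+ m , trans (+-homo k m) (+-cong e f) }
    ; *-closed  = λ { (k , e) (m , f) →
        k K.* m , trans (*-homo k m) (*-cong e f) }
    ; -‿closed  = λ { (k , e) → K.- k , trans (-‿homo k) (-‿cong e) }
    ; ⁻¹-closed = λ { {x} {y} (k , e) xy≈1 →
        let k≉0 : ¬ (k K.≈ K.0#)
            k≉0 k≈0 = 1≉0 (begin
              1#        ≈⟨ xy≈1 ⟨
              x * y     ≈⟨ *-congʳ e ⟨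
              ι k * y   ≈⟨ *-congʳ (trans (⟦⟧-cong k≈0) 0#-homo) ⟩
              0# * y    ≈⟨ zeroˡ y ⟩
              0#        ∎)
            m , km≈1 = K.inverse k k≉0
        in m , (begin
          ι m               ≈⟨ *-identityʳ (ι m) ⟨
          ι m * 1#          ≈⟨ *-congˡ xy≈1 ⟨
          ι m * (x * y)     ≈⟨ *-congˡ (*-congʳ e) ⟨
          ι m * (ι k * y)   ≈⟨ *-assoc (ι m) (ι k) y ⟨
          (ι m * ι k) * y   ≈⟨ *-congʳ (*-comm (ι m) (ι k)) ⟩
          (ι k * ι m) * y   ≈⟨ *-congʳ (*-homo k m) ⟨
          ι (k K.* m) * y   ≈⟨ *-congʳ (trans (⟦⟧-cong km≈1) 1#-homo) ⟩
          1# * y            ≈⟨ *-identityˡ y ⟩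
          y                 ∎) }
    }
    where
    open IsRingHomomorphism hom
    open SetoidReasoning setoid
    InImage : Pred Carrier (c ⊔ ℓ)
    InImage x = ∃ λ k → ι k ≈ x

record AlgebraicClosure (K : Field c ℓ) : Set (suc (c ⊔ ℓ)) where
  field
    Ω : Field c ℓ
  private
    module K = Field K
  open Subfields Ω
  open RingMorphisms K.rawRing rawRing using (IsRingHomomorphism)
  field
    ι                   : K.Carrier → Carrier
    isRingHomomorphism  : IsRingHomomorphism ι
    algebraicallyClosed : ∀ (p : Ω[X]) → NonConstant p → ∃ λ x → eval p x ≈ 0#
    algebraic           : ∀ x → AlgebraicOver (image K Ω ι isRingHomomorphism) x

  base : Subfield
  base = image K Ω ι isRingHomomorphism

-- Put N′ = L_S ∩ L^A, and let Φ be the Frobenius map (the identity in characteristic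
-- 0). Every x in L has some Φⁿ x in L_S: when the degree of Φⁿ x over K is minimal,
-- Φⁿ x generates a separable extension. Hence an embedding of L over N′ fixes L^A,
-- so it permutes the roots of the orbit polynomials ∏ (X - α x), α in A, and maps L
-- into L: L/N′ is normal. Conversely, if L/N is normal and y is in N′, then all roots
-- of the minimal polynomial of y over N are images of y under automorphisms of L, so
-- y is the only root, a simple one, and y lies in N. Thus N′ is the least such N.
-- Embeddings of L are determined by their restrictions to L_S, and the embeddings of
-- L_S extending that of a subfield F containing K number [L_S : F]. For F = N′ they
-- are the automorphisms of L, so [L_S : N′] = r; for F = K each of the s conjugates
-- of L is the image of r of them, so [L_S : K] = r s. The tower law gives the rest.
module Submission where

open import Defs
open import Algebra.Bundles using (CommutativeRing; RawRing)
import Algebra.Definitions.RawMagma as RawMagmaDefinitions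
import Algebra.Definitions.RawMonoid
import Algebra.Definitions.RawSemiring as RawSemiringDefinitions
import Algebra.Morphism.Construct.Identity as Identity
open import Algebra.Morphism.Structures using (module RingMorphisms)
import Algebra.Properties.CommutativeMonoid.Sum
import Algebra.Properties.CommutativeSemiring.Binomial
import Algebra.Properties.CommutativeSemiring.Exp
import Algebra.Properties.Ring
import Algebra.Properties.Semiring.Exp
import Algebra.Properties.Semiring.Mult
import Algebra.Properties.Semiring.Mult.TCOptimised
import Algebra.Properties.Semiring.Sum
import Algebra.Solver.Ring
import Algebra.Solver.Ring.AlmostCommutativeRing as ACR
open import Axiom.DoubleNegationElimination using (em⇒dne)
open import Axiom.ExcludedMiddle using (ExcludedMiddle)
open import Data.Empty using (⊥-elim)
open import Data.Fin.Base as Fin using (Fin; zero; suc; punchIn; _↑ˡ_; _↑ʳ_; remQuot; combine; toℕ; fromℕ; inject₁; punchOut)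
open import Data.Fin.Permutation using (Permutation; permutation)
import Data.Fin.Properties as Fin
open import Data.Integer.Base as ℤ using (ℤ; -[1+_]; _⊖_) renaming (+_ to pos)
import Data.Integer.Properties as ℤ
open import Data.List.Base as List using (List; []; _∷_; _++_; length; replicate)
open import Data.List.Membership.Setoid.Properties using (∈-lookup)
import Data.List.Properties as List
open import Data.List.Relation.Unary.All as All using (All; []; _∷_)
open import Data.List.Relation.Unary.All.Properties using (¬Any⇒All¬; All¬⇒¬Any; tabulate⁻)
import Data.List.Relation.Unary.All.Properties as AllP
open import Data.List.Relation.Unary.AllPairs using ([]; _∷_)
open import Data.List.Relation.Unary.Any as Any using (Any; here; there)
open import Data.List.Relation.Unary.Any.Properties using (lookup-index; map⁺; tabulate⁺)
import Data.List.Relation.Unary.Unique.Setoid as UniqueSetoid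
open import Data.Maybe.Base using (map)
open import Data.Nat.Base as ℕ using (ℕ; zero; suc; s≤s; z≤n)
import Data.Nat.Combinatorics as ℕ
import Data.Nat.DivMod as ℕ
import Data.Nat.Divisibility as ℕ
open import Data.Nat.Induction using (<-rec)
import Data.Nat.Properties as ℕ
open import Data.Nat.Tactic.RingSolver using (solve-∀)
open import Data.Product using (∃; _×_; _,_; proj₁; proj₂; uncurry)
import Data.Sign.Base as Sign
open import Data.Sum.Base using (_⊎_; inj₁; inj₂; [_,_]; [_,_]′)
open import Data.Unit.Base using (⊤)
open import Data.Vec.Functional using (insertAt) renaming (_∷_ to _∷ᵛ_)
import Data.Vec.Functional.Properties as Vec
open import Function.Base using (_∘_; id)
open import Function.Bundles using (Bijection; _⇔_; mk⇔)
open import Level using (Level; _⊔_; Lift) renaming (suc to lsuc)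
open import Relation.Binary.Bundles using (Setoid)
open import Relation.Binary.Consequences using (dec⇒weaklyDec)
open import Relation.Binary.PropositionalEquality as ≡ using (_≡_; _≢_) renaming (setoid to ≡-setoid)
import Relation.Binary.Reasoning.Setoid
open import Relation.Nullary using (¬_; yes; no)
open import Relation.Unary using (_∈_)


-- The delicate point is why minimal degree yields separability. Minimality of the degree of y = Φⁿ
-- x gives only K(y) = K(Φ y), whereas the maximality of L_S can be applied to K(y) only once every
-- element of K(y) is known to be separable. The criterion z ∈ K(Φ z) bridges the gap. It passes
-- from y to all of K(y) by comparing degrees, and it makes the minimal polynomial of z separable,
-- because one with zero derivative is a polynomial in Φ and would give Φ z a smaller degree than z.
-- Fields are otherwise compared through embeddings into Ω. Normality of L/N is exchanged for
-- stability of L under its embeddings over N, a condition that passes at once from N to larger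
-- fields. Embeddings are counted one adjoined element at a time. The finiteness of the sets of
-- automorphisms and of conjugates is itself part of the proof: each of them gives an embedding of L
-- over K, and excluded middle selects representatives among these finitely many embeddings.

-- Integer coefficients let the solver cancel x + - x over a ring whose equality
-- does not compute.
module IntegerSolver {c ℓ} (R : CommutativeRing c ℓ) where
  open CommutativeRing R
  open Algebra.Properties.Semiring.Mult.TCOptimised semiring
    using (1+×; ×-homo-+; ×1-homo-*) renaming (_×_ to _·_)
  open Algebra.Properties.Ring ring
    using (-‿distribˡ-*; -‿distribʳ-*; -‿involutive; -‿+-comm; -0#≈0#)
  open Relation.Binary.Reasoning.Setoid setoid

  private
    ⟦_⟧ : ℤ → Carrier
    ⟦ pos n    ⟧ = n · 1#
    ⟦ -[1+ n ] ⟧ = - (suc n · 1#)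

    ⟦⟧-⊖ : ∀ m n → ⟦ m ⊖ n ⟧ ≈ m · 1# + - (n · 1#)
    ⟦⟧-⊖ m zero = sym (trans (+-congˡ -0#≈0#) (+-identityʳ _))
    ⟦⟧-⊖ zero (suc n) = sym (+-identityˡ _)
    ⟦⟧-⊖ (suc m) (suc n) = begin
      ⟦ suc m ⊖ suc n ⟧                       ≡⟨ ≡.cong ⟦_⟧ (ℤ.[1+m]⊖[1+n]≡m⊖n m n) ⟩
      ⟦ m ⊖ n ⟧                               ≈⟨ ⟦⟧-⊖ m n ⟩
      m · 1# + - (n · 1#)                     ≈⟨ +-congˡ (+-identityˡ _) ⟨
      m · 1# + (0# + - (n · 1#))              ≈⟨ +-congˡ (+-congʳ (-‿inverseʳ 1#)) ⟨
      m · 1# + ((1# + - 1#) + - (n · 1#))     ≈⟨ +-congˡ (+-assoc _ _ _) ⟩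
      m · 1# + (1# + (- 1# + - (n · 1#)))     ≈⟨ +-assoc _ _ _ ⟨
      (m · 1# + 1#) + (- 1# + - (n · 1#))     ≈⟨ +-cong (+-comm _ _) (-‿+-comm _ _) ⟩
      (1# + m · 1#) + - (1# + n · 1#)         ≈⟨ +-cong (1+× m 1#) (-‿cong (1+× n 1#)) ⟨
      suc m · 1# + - (suc n · 1#)             ∎

    ⟦⟧-+ : ∀ i j → ⟦ i ℤ.+ j ⟧ ≈ ⟦ i ⟧ + ⟦ j ⟧
    ⟦⟧-+ (pos m)  (pos n)  = ×-homo-+ 1# m n
    ⟦⟧-+ (pos m)  -[1+ n ] = ⟦⟧-⊖ m (suc n)
    ⟦⟧-+ -[1+ m ] (pos n)  = trans (⟦⟧-⊖ n (suc m)) (+-comm _ _)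
    ⟦⟧-+ -[1+ m ] -[1+ n ] = begin
      - (suc (suc (m ℕ.+ n)) · 1#)     ≈⟨ -‿cong (1+× (suc (m ℕ.+ n)) 1#) ⟩
      - (1# + suc (m ℕ.+ n) · 1#)      ≈⟨ -‿cong (+-congˡ (×-homo-+ 1# (suc m) n)) ⟩
      - (1# + (suc m · 1# + n · 1#))   ≈⟨ -‿cong (trans (sym (+-assoc _ _ _)) (trans (+-congʳ (+-comm _ _)) (+-assoc _ _ _))) ⟩
      - (suc m · 1# + (1# + n · 1#))   ≈⟨ -‿cong (+-congˡ (1+× n 1#)) ⟨
      - (suc m · 1# + suc n · 1#)      ≈⟨ -‿+-comm _ _ ⟨
      - (suc m · 1#) + - (suc n · 1#)  ∎

    ⟦⟧-◃⁻ : ∀ n → ⟦ Sign.- ℤ.◃ n ⟧ ≈ - (n · 1#)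
    ⟦⟧-◃⁻ zero    = sym -0#≈0#
    ⟦⟧-◃⁻ (suc n) = refl

    ⟦⟧-◃⁺ : ∀ n → ⟦ Sign.+ ℤ.◃ n ⟧ ≈ n · 1#
    ⟦⟧-◃⁺ zero    = refl
    ⟦⟧-◃⁺ (suc n) = refl

    ⟦⟧-* : ∀ i j → ⟦ i ℤ.* j ⟧ ≈ ⟦ i ⟧ * ⟦ j ⟧
    ⟦⟧-* (pos m)  (pos n)  = trans (⟦⟧-◃⁺ (m ℕ.* n)) (×1-homo-* m n)
    ⟦⟧-* (pos m)  -[1+ n ] = trans (⟦⟧-◃⁻ (m ℕ.* suc n))
      (trans (-‿cong (×1-homo-* m (suc n))) (-‿distribʳ-* _ _))
    ⟦⟧-* -[1+ m ] (pos n)  = trans (⟦⟧-◃⁻ (suc m ℕ.* n))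
      (trans (-‿cong (×1-homo-* (suc m) n)) (-‿distribˡ-* _ _))
    ⟦⟧-* -[1+ m ] -[1+ n ] = begin
      ⟦ Sign.+ ℤ.◃ (suc m ℕ.* suc n) ⟧     ≈⟨ ⟦⟧-◃⁺ (suc m ℕ.* suc n) ⟩
      (suc m ℕ.* suc n) · 1#               ≈⟨ ×1-homo-* (suc m) (suc n) ⟩
      a * b                                ≈⟨ -‿involutive _ ⟨
      - - (a * b)                          ≈⟨ -‿cong (-‿distribˡ-* _ _) ⟩
      - (- a * b)                          ≈⟨ -‿distribʳ-* _ _ ⟩
      - a * - b                            ∎
      where
      a = suc m · 1#
      b = suc n · 1#

    ⟦⟧-neg : ∀ i → ⟦ ℤ.- i ⟧ ≈ - ⟦ i ⟧
    ⟦⟧-neg (pos zero)    = sym -0#≈0#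
    ⟦⟧-neg (pos (suc n)) = refl
    ⟦⟧-neg -[1+ n ]      = sym (-‿involutive _)

    almost : ACR.AlmostCommutativeRing c ℓ
    almost = ACR.fromCommutativeRing R

    morphism : ℤ.+-*-rawRing ACR.-Raw-AlmostCommutative⟶ almost
    morphism = record
      { ⟦_⟧    = ⟦_⟧
      ; +-homo = ⟦⟧-+
      ; *-homo = ⟦⟧-*
      ; -‿homo = ⟦⟧-neg
      ; 0-homo = refl
      ; 1-homo = refl
      }

    ⟦⟧-cong? = λ i j → map (λ i≡j → reflexive (≡.cong ⟦_⟧ i≡j)) (dec⇒weaklyDec ℤ._≟_ i j)

  open Algebra.Solver.Ring ℤ.+-*-rawRing almost morphism ⟦⟧-cong? public
    using (solve; _:=_; _:+_; _:*_; _:-_; :-_; con)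

private
  variable
    a : Level

module _ (em : ∀ {a} → ExcludedMiddle a) where

  dne : {A : Set a} → ¬ ¬ A → A
  dne = em⇒dne em

  least : (P : ℕ → Set a) → ∃ P → ∃ λ m → P m × (∀ k → k ℕ.< m → ¬ P k)
  least P (n , pn) = <-rec (λ n → P n → ∃ λ m → P m × (∀ k → k ℕ.< m → ¬ P k)) step n pn
    where
    step : ∀ n → (∀ {k} → k ℕ.< n → P k → ∃ λ m → P m × (∀ k → k ℕ.< m → ¬ P k)) →
           P n → ∃ λ m → P m × (∀ k → k ℕ.< m → ¬ P k)
    step n rec pn with em {P = ∃ λ k → k ℕ.< n × P k}
    ... | yes (k , k<n , pk) = rec k<n pk
    ... | no none            = n , pn , λ k k<n pk → none (k , k<n , pk)

-- Dimension theory over subfields: exchange, bases, and the tower law.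

module LinearAlgebra (em : ∀ {a} → ExcludedMiddle a) {c ℓ} (Ω : Field c ℓ) where
  open Subfields Ω hiding (zero)
  open Algebra.Properties.Semiring.Sum semiring public
    using (sum; sum-cong-≋; sum-remove; sum-replicate-zero; ∑-distrib-+; ∑-comm; *-distribˡ-sum; *-distribʳ-sum)
  open IntegerSolver commutativeRing public
  open Relation.Binary.Reasoning.Setoid setoid

  inverseIn : ∀ N {x} → x ∈ elements N → x ≉ 0# → ∃ λ y → y ∈ elements N × (x * y) ≈ 1#
  inverseIn N {x} x∈N x≉0 = let y , xy≈1 = inverse x x≉0 in y , ⁻¹-closed N x∈N xy≈1 , xy≈1

  integral : ∀ {x y} → x * y ≈ 0# → x ≉ 0# → y ≈ 0#
  integral {x} {y} xy≈0 x≉0 = let z , xz≈1 = inverse x x≉0 in begin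
    y             ≈⟨ *-identityˡ y ⟨
    1# * y        ≈⟨ *-congʳ xz≈1 ⟨
    (x * z) * y   ≈⟨ solve 3 (λ x y z → (x :* z) :* y := z :* (x :* y)) refl x y z ⟩
    z * (x * y)   ≈⟨ *-congˡ xy≈0 ⟩
    z * 0#        ≈⟨ zeroʳ z ⟩
    0#            ∎

  private
    variable
      m n : ℕ

  Span : Subfield → (Fin n → Carrier) → Carrier → Set (c ⊔ ℓ)
  Span {n} N v x = ∃ λ (k : Fin n → Elt N) → x ≈ combination N k v

  Independent : Subfield → (Fin n → Carrier) → Set (c ⊔ ℓ)
  Independent {n} N v = ∀ (k : Fin n → Elt N) → combination N k v ≈ 0# → ∀ i → proj₁ (k i) ≈ 0#

  Dependent : Subfield → (Fin n → Carrier) → Set (c ⊔ ℓ)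
  Dependent {n} N v = ∃ λ (k : Fin n → Elt N) → (∃ λ i → proj₁ (k i) ≉ 0#) × combination N k v ≈ 0#

  module Spans (N : Subfield) where

    0ᴺ : Elt N
    0ᴺ = 0# , 0-closed N

    span-≈ : {v : Fin n → Carrier} → ∀ {x y} → x ≈ y → Span N v x → Span N v y
    span-≈ x≈y (k , e) = k , trans (sym x≈y) e

    span-0 : {v : Fin n → Carrier} → Span N v 0#
    span-0 {n} {v} = (λ _ → 0ᴺ) , sym (trans (sum-cong-≋ (λ i → zeroˡ (v i))) (sum-replicate-zero n))

    span-+ : {v : Fin n → Carrier} → ∀ {x y} → Span N v x → Span N v y → Span N v (x + y)
    span-+ {n} {v = v} {x} {y} (k , e) (l , f) =
      (λ i → _ , +-closed N (proj₂ (k i)) (proj₂ (l i))) , (begin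
        x + y                                                     ≈⟨ +-cong e f ⟩
        combination N k v + combination N l v                     ≈⟨ ∑-distrib-+ {n} _ _ ⟨
        sum (λ i → proj₁ (k i) * v i + proj₁ (l i) * v i)         ≈⟨ sum-cong-≋ {n} (λ i → distribʳ _ _ _) ⟨
        sum (λ i → (proj₁ (k i) + proj₁ (l i)) * v i)             ∎)

    span-* : {v : Fin n → Carrier} → ∀ {x y} → x ∈ elements N → Span N v y → Span N v (x * y)
    span-* {n} {v = v} {x} {y} x∈N (k , e) =
      (λ i → _ , *-closed N x∈N (proj₂ (k i))) , (begin
        x * y                                  ≈⟨ *-congˡ e ⟩
        x * combination N k v                  ≈⟨ *-distribˡ-sum {n} x _ ⟩
        sum (λ i → x * (proj₁ (k i) * v i))    ≈⟨ sum-cong-≋ {n} (λ i → *-assoc _ _ _) ⟨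
        sum (λ i → (x * proj₁ (k i)) * v i)    ∎)

    span-- : {v : Fin n → Carrier} → ∀ {x} → Span N v x → Span N v (- x)
    span-- {x = x} s = span-≈ (solve 1 (λ x → :- con (pos 1) :* x := :- x) refl x)
      (span-* (-‿closed N (1-closed N)) s)

    span-tail : {v : Fin (suc n) → Carrier} → ∀ {x} → Span N (v ∘ suc) x → Span N v x
    span-tail {v = v} (k , e) = (0ᴺ ∷ᵛ k) , trans e (sym (trans (+-congʳ (zeroˡ _)) (+-identityˡ _)))

    span-generator : (v : Fin n → Carrier) → ∀ i → Span N v (v i)
    span-generator v zero = ((1# , 1-closed N) ∷ᵛ (λ _ → 0ᴺ)) ,
      sym (trans (+-cong (*-identityˡ _) (sym (proj₂ (span-0 {v = λ i → v (suc i)})))) (+-identityʳ _))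
    span-generator v (suc i) = span-tail {v = v} (span-generator (v ∘ suc) i)

    dependent⇒¬independent : {v : Fin n → Carrier} → Dependent N v → ¬ Independent N v
    dependent⇒¬independent (k , (i , ki≉0) , e) ind = ki≉0 (ind k e i)

    combination∈ : (k : Fin n → Elt N) {t : Fin n → Carrier} → (∀ i → t i ∈ elements N) →
                   combination N k t ∈ elements N
    combination∈ {zero}  k t∈N = 0-closed N
    combination∈ {suc n} k t∈N =
      +-closed N (*-closed N (proj₂ (k zero)) (t∈N zero)) (combination∈ (k ∘ suc) (t∈N ∘ suc))

    combination-shift : (k : Fin n → Elt N) (u t : Fin n → Carrier) → ∀ x →
      combination N k (λ i → u i + - (t i * x)) ≈ combination N k u + - (combination N k t * x)
    combination-shift {zero} k u t x = solve 1 (λ x → con (pos 0) := con (pos 0) :+ :- (con (pos 0) :* x)) refl x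
    combination-shift {suc n} k u t x = trans
      (+-congˡ (combination-shift (k ∘ suc) (u ∘ suc) (t ∘ suc) x))
      (solve 6 (λ k u t x a b → k :* (u :+ :- (t :* x)) :+ (a :+ :- (b :* x)) :=
                               (k :* u :+ a) :+ :- ((k :* t :+ b) :* x)) refl
        (proj₁ (k zero)) (u zero) (t zero) x _ _)

    -- One step of Gaussian elimination read backwards: `u j` receives the coefficient that collects
    -- all the subtracted multiples, and the nonzero coefficient of the given relation survives at a
    -- punched-in index.
    dependent-eliminate : (u : Fin (suc n) → Carrier) (j : Fin (suc n)) (t : Fin n → Carrier) →
      (∀ l → t l ∈ elements N) → Dependent N (λ l → u (punchIn j l) + - (t l * u j)) → Dependent N u
    dependent-eliminate {n} u j t t∈N (k , (i , ki≉0) , e) =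
      k′ , (punchIn j i , λ z → ki≉0 (trans (reflexive (≡.cong proj₁ (≡.sym (Vec.insertAt-punchIn k j kj i)))) z)) , (begin
        combination N k′ u
          ≈⟨ sum-remove {i = j} (λ l → proj₁ (k′ l) * u l) ⟩
        proj₁ (k′ j) * u j + sum (λ l → proj₁ (k′ (punchIn j l)) * u (punchIn j l))
          ≈⟨ +-cong (*-congʳ (reflexive (≡.cong proj₁ (Vec.insertAt-lookup k j kj))))
                    (sum-cong-≋ (λ l → *-congʳ (reflexive (≡.cong proj₁ (Vec.insertAt-punchIn k j kj l))))) ⟩
        - combination N k t * u j + combination N k (u ∘ punchIn j)
          ≈⟨ solve 3 (λ a b c → :- a :* b :+ c := c :+ :- (a :* b)) refl _ _ _ ⟩
        combination N k (u ∘ punchIn j) + - (combination N k t * u j)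
          ≈⟨ combination-shift k (u ∘ punchIn j) t (u j) ⟨
        combination N k (λ l → u (punchIn j l) + - (t l * u j))
          ≈⟨ e ⟩
        0# ∎)
      where
      kj : Elt N
      kj = _ , -‿closed N (combination∈ k t∈N)
      k′ : Fin (suc n) → Elt N
      k′ = insertAt k j kj

    -- A nonzero entry divides all the others. When all entries vanish, any index with multipliers 0
    -- will do, so elimination needs no separate case.
    pivot : (κ : Fin (suc m) → Carrier) → (∀ i → κ i ∈ elements N) →
            ∃ λ j → ∀ l → ∃ λ t → t ∈ elements N × κ l ≈ t * κ j
    pivot κ κ∈N with em {P = ∃ λ j → κ j ≉ 0#}
    ... | yes (j , κj≉0) = j , λ l → let y , y∈N , e = inverseIn N (κ∈N j) κj≉0 in
          κ l * y , *-closed N (κ∈N l) y∈N , (begin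
            κ l                ≈⟨ *-identityʳ _ ⟨
            κ l * 1#           ≈⟨ *-congˡ e ⟨
            κ l * (κ j * y)    ≈⟨ solve 3 (λ a b c → a :* (b :* c) := (a :* c) :* b) refl _ _ _ ⟩
            (κ l * y) * κ j    ∎)
    ... | no none = zero , λ l → 0# , 0-closed N ,
          trans (dne em (λ κl≉0 → none (l , κl≉0))) (sym (zeroˡ _))

    -- Exchange by elimination: subtracting multiples of the pivot vector removes `v zero` from the
    -- other vectors and leaves the same problem with one vector fewer on both sides.
    dependence : (v : Fin n → Carrier) (u : Fin (suc n) → Carrier) → (∀ j → Span N v (u j)) → Dependent N u
    dependence {zero} v u s = (λ _ → 1# , 1-closed N) , (zero , 1≉0) ,
      trans (+-identityʳ _) (trans (*-identityˡ _) (proj₂ (s zero)))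
    dependence {suc n} v u s = dependent-eliminate u j t (λ l → proj₁ (proj₂ (piv (punchIn j l))))
      (dependence (v ∘ suc) _ reduced)
      where
      κ : Fin (suc (suc n)) → Carrier
      κ i = proj₁ (proj₁ (s i) zero)
      j = proj₁ (pivot κ (λ i → proj₂ (proj₁ (s i) zero)))
      piv = proj₂ (pivot κ (λ i → proj₂ (proj₁ (s i) zero)))
      t : Fin (suc n) → Carrier
      t l = proj₁ (piv (punchIn j l))
      w : Fin (suc (suc n)) → Carrier
      w i = combination N (proj₁ (s i) ∘ suc) (v ∘ suc)
      reduced : ∀ l → Span N (v ∘ suc) (u (punchIn j l) + - (t l * u j))
      reduced l = span-≈ (sym (begin
          u p + - (t l * u j)
            ≈⟨ +-cong (proj₂ (s p)) (-‿cong (*-congˡ (proj₂ (s j)))) ⟩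
          (κ p * v zero + w p) + - (t l * (κ j * v zero + w j))
            ≈⟨ +-congʳ (+-congʳ (*-congʳ (proj₂ (proj₂ (piv p))))) ⟩
          (t l * κ j * v zero + w p) + - (t l * (κ j * v zero + w j))
            ≈⟨ solve 5 (λ t k v a b → (t :* k :* v :+ a) :+ :- (t :* (k :* v :+ b)) := a :+ :- (t :* b)) refl
                 (t l) (κ j) (v zero) (w p) (w j) ⟩
          w p + - (t l * w j) ∎))
        (span-+ (proj₁ (s p) ∘ suc , refl) (span-- (span-* (proj₁ (proj₂ (piv p))) (proj₁ (s j) ∘ suc , refl))))
        where p = punchIn j l

    independent-tail : {u : Fin (suc m) → Carrier} → Independent N u → Independent N (u ∘ suc)
    independent-tail ind k e i =
      ind (0ᴺ ∷ᵛ k) (trans (+-cong (zeroˡ _) e) (+-identityˡ _)) (suc i)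

    -- The tail obeys the bound by induction; equality there would put one vector too many into the
    -- span of `v`, against `dependence`.
    independent-≤ : {v : Fin n → Carrier} {u : Fin m → Carrier} →
                    Independent N u → (∀ j → Span N v (u j)) → m ℕ.≤ n
    independent-≤ {m = zero} ind s = z≤n
    independent-≤ {m = suc m} {u = u} ind s with ℕ.m≤n⇒m<n∨m≡n (independent-≤ {u = λ i → u (suc i)} (independent-tail {u = u} ind) (s ∘ suc))
    ... | inj₁ m<n    = m<n
    ... | inj₂ ≡.refl = ⊥-elim (dependent⇒¬independent {v = u} (dependence _ u s) ind)

    independent-cons : {v : Fin n → Carrier} → ∀ {x} → Independent N v → ¬ Span N v x → Independent N (x ∷ᵛ v)
    independent-cons {v = v} {x} ind x∉ k e = λ where
        zero    → k0≈0
        (suc i) → ind (k ∘ suc) (trans (sym (trans (+-congʳ (trans (*-congʳ k0≈0) (zeroˡ _))) (+-identityˡ _))) e) i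
      where
      w = combination N (k ∘ suc) v
      k0≈0 : proj₁ (k zero) ≈ 0#
      k0≈0 = dne em λ k0≉0 → let y , y∈N , f = inverseIn N (proj₂ (k zero)) k0≉0 in
        x∉ (span-≈ (begin
          y * - w                                   ≈⟨ +-identityʳ _ ⟨
          y * - w + 0#                              ≈⟨ +-congˡ (trans (*-congˡ e) (zeroʳ y)) ⟨
          y * - w + y * (proj₁ (k zero) * x + w)    ≈⟨ solve 4 (λ y w k x → y :* :- w :+ y :* (k :* x :+ w) := (k :* y) :* x) refl y w _ x ⟩
          (proj₁ (k zero) * y) * x                  ≈⟨ *-congʳ f ⟩
          1# * x                                    ≈⟨ *-identityˡ x ⟩
          x                                         ∎)
          (span-* y∈N (span-- (k ∘ suc , refl))))

  open Spans

  basis-≤ : ∀ {N V} {v : Fin m → Carrier} → Basis V N n →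
            (∀ {x} → x ∈ elements V → Span N v x) → n ℕ.≤ m
  basis-≤ {N = N} B s = independent-≤ N (Basis.independent B) (λ j → s (Basis.inL B j))

  basis-unique : ∀ {N V} → Basis V N m → Basis V N n → m ≡ n
  basis-unique B C = ℕ.≤-antisym (basis-≤ B (Basis.spanning C)) (basis-≤ C (Basis.spanning B))

  -- An independent family that does not span is lengthened by a vector outside its span. The number
  -- `r` of steps left before the bound `b` makes this terminate.
  basis-exists : ∀ {N V} b → (∀ {m} {u : Fin m → Carrier} → (∀ i → u i ∈ elements V) → Independent N u → m ℕ.≤ b) →
                 ∃ (Basis V N)
  basis-exists {N} {V} b bounded = extend b zero (ℕ.+-identityʳ b) (λ ()) (λ ()) (λ _ _ ())
    where
    extend : ∀ r m → r ℕ.+ m ≡ b → (u : Fin m → Carrier) → (∀ i → u i ∈ elements V) → Independent N u → ∃ (Basis V N)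
    extend r m eq u u∈V ind with em {P = ∃ λ x → x ∈ elements V × ¬ Span N u x}
    ... | no none = m , record
      { vectors = u ; inL = u∈V ; independent = ind
      ; spanning = λ x∈V → dne em λ ¬s → none (_ , x∈V , ¬s) }
    extend zero m ≡.refl u u∈V ind | yes (x , x∈V , x∉) =
      ⊥-elim (ℕ.<-irrefl ≡.refl (bounded {u = x ∷ᵛ u} (λ { zero → x∈V ; (suc i) → u∈V i }) (independent-cons N ind x∉)))
    extend (suc r) m eq u u∈V ind | yes (x , x∈V , x∉) =
      extend r (suc m) (≡.trans (ℕ.+-suc r m) eq) (x ∷ᵛ u) (λ { zero → x∈V ; (suc i) → u∈V i }) (independent-cons N ind x∉)

  lift : ∀ {N M} → N ⊆ M → Elt N → Elt M
  lift N⊆M (x , x∈N) = x , N⊆M x∈N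

  finite-over : ∀ {K N L} → K ⊆ N → Finite L K → Finite L N
  finite-over {K} {N} {L} K⊆N (n , B) = basis-exists n λ u∈L ind →
    independent-≤ N ind λ j → let k , e = Basis.spanning B (u∈L j) in lift {K} {N} K⊆N ∘ k , e

  finite-sub : ∀ {K N L} → N ⊆ L → Finite L K → Finite N K
  finite-sub {K} {N} {L} N⊆L (n , B) = basis-exists n λ u∈N ind →
    independent-≤ K ind λ j → Basis.spanning B (N⊆L (u∈N j))

  sum-++ : ∀ m n (f : Fin (m ℕ.+ n) → Carrier) → sum f ≈ sum (f ∘ (_↑ˡ n)) + sum (f ∘ (m ↑ʳ_))
  sum-++ zero    n f = sym (+-identityˡ _)
  sum-++ (suc m) n f = trans (+-congˡ (sum-++ m n (f ∘ suc))) (sym (+-assoc _ _ _))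

  sum-combine : ∀ m n (f : Fin (m ℕ.* n) → Carrier) → sum f ≈ sum (λ i → sum (λ j → f (combine {m} {n} i j)))
  sum-combine zero    n f = refl
  sum-combine (suc m) n f = trans (sum-++ n (m ℕ.* n) f) (+-congˡ (sum-combine m n (λ x → f (n ↑ʳ x))))

  -- The regrouping behind the tower law; it serves both the spanning and the independence of the
  -- products.
  combination-combine : ∀ N {m n} (k : Fin (m ℕ.* n) → Elt N) (v : Fin m → Carrier) (w : Fin n → Carrier) →
    combination N k (λ x → uncurry (λ i j → v i * w j) (remQuot {m} n x)) ≈
    sum (λ j → combination N (λ i → k (combine {m} {n} i j)) v * w j)
  combination-combine N {m} {n} k v w = begin
    combination N k (λ x → uncurry (λ i j → v i * w j) (remQuot {m} n x))
      ≈⟨ sum-combine m n _ ⟩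
    sum (λ i → sum (λ j → proj₁ (k (combine {m} {n} i j)) * uncurry (λ i j → v i * w j) (remQuot {m} n (combine {m} {n} i j))))
      ≈⟨ sum-cong-≋ {m} (λ i → sum-cong-≋ {n} (λ j → trans
           (*-congˡ (reflexive (≡.cong (uncurry (λ i j → v i * w j)) (Fin.remQuot-combine {m} {n} i j))))
           (sym (*-assoc _ _ _)))) ⟩
    sum (λ i → sum (λ j → (proj₁ (k (combine {m} {n} i j)) * v i) * w j))
      ≈⟨ ∑-comm {m} {n} _ ⟩
    sum (λ j → sum (λ i → (proj₁ (k (combine {m} {n} i j)) * v i) * w j))
      ≈⟨ sum-cong-≋ {n} (λ j → *-distribʳ-sum {m} (w j) _) ⟨
    sum (λ j → combination N (λ i → k (combine {m} {n} i j)) v * w j) ∎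

  tower : ∀ {N M L} → M ⊆ L → N ⊆ M → Basis M N m → Basis L M n → Basis L N (m ℕ.* n)
  tower {m} {n} {N} {M} {L} M⊆L N⊆M B C = record
    { vectors     = λ x → uncurry (λ i j → v i * w j) (remQuot {m} n x)
    ; inL         = λ x → *-closed L (M⊆L (Basis.inL B (proj₁ (remQuot {m} n x)))) (Basis.inL C (proj₂ (remQuot {m} n x)))
    ; spanning    = λ {x} x∈L → let k , e = Basis.spanning C x∈L
                                    l = λ j → Basis.spanning B (proj₂ (k j)) in
        (λ x → uncurry (λ i j → proj₁ (l j) i) (remQuot {m} n x)) , (begin
          x
            ≈⟨ e ⟩
          sum (λ j → proj₁ (k j) * w j)
            ≈⟨ sum-cong-≋ {n} (λ j → *-congʳ (trans (proj₂ (l j)) (sum-cong-≋ {m} (λ i → *-congʳ (reflexive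
                 (≡.cong (λ p → proj₁ (uncurry (λ i j → proj₁ (l j) i) p)) (≡.sym (Fin.remQuot-combine {m} {n} i j)))))))) ⟩
          sum (λ j → combination N (λ i → uncurry (λ i j → proj₁ (l j) i) (remQuot {m} n (combine {m} {n} i j))) v * w j)
            ≈⟨ combination-combine N {m} {n} (λ x → uncurry (λ i j → proj₁ (l j) i) (remQuot {m} n x)) v w ⟨
          combination N (λ x → uncurry (λ i j → proj₁ (l j) i) (remQuot {m} n x))
            (λ x → uncurry (λ i j → v i * w j) (remQuot {m} n x)) ∎)
    ; independent = λ k e x →
        let i , j = remQuot {m} n x
            inM = λ j → combination∈ M (λ i → lift {N} {M} N⊆M (k (combine {m} {n} i j))) (Basis.inL B)
            zeros = Basis.independent C (λ j → _ , inM j) (trans (sym (combination-combine N {m} {n} k v w)) e)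
        in trans (reflexive (≡.cong (λ y → proj₁ (k y)) (≡.sym (Fin.combine-remQuot {m} n x))))
             (Basis.independent B (λ i → k (combine {m} {n} i j)) (zeros j) i)
    }
    where
    v = Basis.vectors B
    w = Basis.vectors C

  -- Writing 1 as a multiple of the only basis vector makes that vector the inverse of an element of
  -- `N`.
  degree-1⇒⊆ : ∀ {M N} → Basis M N 1 → M ⊆ N
  degree-1⇒⊆ {M} {N} B {x} x∈M =
      let k , e = Basis.spanning B x∈M
          l , f = Basis.spanning B (1-closed M)
      in ≈-closed N (sym e) (+-closed N (*-closed N (proj₂ (k zero)) (v∈N l f)) (0-closed N))
    where
    v = Basis.vectors B zero
    v∈N : ∀ (l : Fin 1 → Elt N) → 1# ≈ combination N l (Basis.vectors B) → v ∈ elements N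
    v∈N l f = ⁻¹-closed N (proj₂ (l zero)) (trans (sym (+-identityʳ _)) (sym f))

  basis-1 : ∀ {M N} → N ⊆ M → M ⊆ N → Basis M N 1
  basis-1 {M} {N} N⊆M M⊆N = record
    { vectors     = λ _ → 1#
    ; inL         = λ _ → 1-closed M
    ; spanning    = λ x∈M → (λ _ → _ , M⊆N x∈M) , sym (trans (+-identityʳ _) (*-identityʳ _))
    ; independent = λ { k e zero → trans (sym (trans (+-identityʳ _) (*-identityʳ _))) e }
    }

  basis-positive : ∀ {M N} → ¬ Basis M N 0
  basis-positive {M} B = 1≉0 (proj₂ (Basis.spanning B (1-closed M)))

  -- The tower law [L : N] = [M : N] [L : M] with [L : N] at most [L : M] leaves only [M : N] = 1.
  degree-≤⇒⊆ : ∀ {M N L} → N ⊆ M → M ⊆ L → Finite L N → Basis L M m → Basis L N n → n ℕ.≤ m → M ⊆ N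
  degree-≤⇒⊆ {m} {n} {M} {N} {L} N⊆M M⊆L fin B C n≤m with finite-sub {N} {M} {L} M⊆L fin
  ... | zero , D        = ⊥-elim (basis-positive D)
  ... | suc zero , D    = degree-1⇒⊆ D
  ... | suc (suc k) , D with basis-unique (tower {L = L} M⊆L N⊆M D B) C
  degree-≤⇒⊆ {zero} _ _ _ B _ _ | suc (suc k) , D | _ = ⊥-elim (basis-positive B)
  degree-≤⇒⊆ {suc m} _ _ _ _ _ n≤m | suc (suc k) , D | ≡.refl
    with s≤s () ← ℕ.*-cancelʳ-≤ (suc (suc k)) 1 (suc m) (ℕ.≤-trans n≤m (ℕ.≤-reflexive (≡.sym (ℕ.*-identityˡ (suc m)))))

-- Polynomials over Ω, derivatives and factorisation, and embeddings of subfields.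

module Polynomials (em : ∀ {a} → ExcludedMiddle a) {c ℓ} (Ω : Field c ℓ)
  (closed : ∀ (p : Subfields.Ω[X] Ω) → Subfields.NonConstant Ω p → ∃ λ x → Field._≈_ Ω (Subfields.eval Ω p x) (Field.0# Ω))
  where
  open Subfields Ω hiding (zero)
  open Polynomial rawRing using (coeff; _+ₚ_)
  open LinearAlgebra em Ω
  open Algebra.Properties.Semiring.Exp semiring public using (_^_; ^-congˡ)
  open Algebra.Properties.Ring ring using (-0#≈0#; x+x≈x⇒x≈0; +-inverseʳ-unique) renaming (x∙y⁻¹≈ε⇒x≈y to x-y≈0⇒x≈y)
  open Relation.Binary.Reasoning.Setoid setoid

  -- Applying `φ` during evaluation gives one list over a subfield a value under every embedding of
  -- that subfield.
  evalBy : ∀ {a} {A : Set a} → (A → Carrier) → Carrier → List A → Carrier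
  evalBy φ y = List.foldr (λ a v → φ a + y * v) 0#

  evalBy-map : ∀ {a} {A : Set a} (φ : A → Carrier) y p → evalBy φ y p ≡ eval (List.map φ p) y
  evalBy-map φ y []      = ≡.refl
  evalBy-map φ y (a ∷ p) = ≡.cong (λ v → φ a + y * v) (evalBy-map φ y p)

  evalBy-cong : ∀ {a} {A : Set a} (φ : A → Carrier) {x y} → x ≈ y → ∀ p → evalBy φ x p ≈ evalBy φ y p
  evalBy-cong φ x≈y []      = refl
  evalBy-cong φ x≈y (a ∷ p) = +-congˡ (*-cong x≈y (evalBy-cong φ x≈y p))

  evalBy-snoc : ∀ {a} {A : Set a} (φ : A → Carrier) y s t →
                evalBy φ y (s ++ t ∷ []) ≈ evalBy φ y s + φ t * y ^ length s
  evalBy-snoc φ y [] t = solve 2 (λ y t → t :+ y :* con (pos 0) := con (pos 0) :+ t :* con (pos 1)) refl y (φ t)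
  evalBy-snoc φ y (a ∷ s) t = trans (+-congˡ (*-congˡ (evalBy-snoc φ y s t)))
    (solve 5 (λ a y s t p → a :+ y :* (s :+ t :* p) := a :+ y :* s :+ t :* (y :* p)) refl _ _ _ _ _)

  module _ {r ρ} (R : RawRing r ρ) where
    private module R = RawRing R
    open Algebra.Definitions.RawMonoid R.+-rawMonoid using () renaming (_×_ to _×ᴿ_)

    -- `k` is the exponent of the head coefficient: weight 0 gives X p′, and dropping the constant
    -- term first gives p′.
    weighted : ℕ → List R.Carrier → List R.Carrier
    weighted k []      = []
    weighted k (a ∷ p) = (k ×ᴿ a) ∷ weighted (suc k) p

    derivative : List R.Carrier → List R.Carrier
    derivative []      = []
    derivative (a ∷ p) = weighted 1 p

  module Evaluation {r ρ} (R : RawRing r ρ) {φ : RawRing.Carrier R → Carrier}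
    (hom : RingMorphisms.IsRingHomomorphism R rawRing φ) where
    private
      module R = RawRing R
      module P = Polynomial R
    open RingMorphisms.IsRingHomomorphism hom
    open Algebra.Definitions.RawMonoid R.+-rawMonoid using () renaming (_×_ to _×ᴿ_)

    ev-+ : ∀ y p q → evalBy φ y (p P.+ₚ q) ≈ evalBy φ y p + evalBy φ y q
    ev-+ y []      q       = sym (+-identityˡ _)
    ev-+ y (a ∷ p) []      = sym (+-identityʳ _)
    ev-+ y (a ∷ p) (b ∷ q) = trans (+-cong (+-homo a b) (*-congˡ (ev-+ y p q)))
      (solve 5 (λ a b y p q → a :+ b :+ y :* (p :+ q) := (a :+ y :* p) :+ (b :+ y :* q)) refl _ _ _ _ _)

    ev-scale : ∀ y a p → evalBy φ y (List.map (a R.*_) p) ≈ φ a * evalBy φ y p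
    ev-scale y a []      = sym (zeroʳ _)
    ev-scale y a (b ∷ p) = trans (+-cong (*-homo a b) (*-congˡ (ev-scale y a p)))
      (solve 4 (λ a b y p → a :* b :+ y :* (a :* p) := a :* (b :+ y :* p)) refl _ _ _ _)

    ev-neg : ∀ y p → evalBy φ y (List.map R.-_ p) ≈ - evalBy φ y p
    ev-neg y []      = sym -0#≈0#
    ev-neg y (b ∷ p) = trans (+-cong (-‿homo b) (*-congˡ (ev-neg y p)))
      (solve 3 (λ b y p → :- b :+ y :* (:- p) := :- (b :+ y :* p)) refl _ _ _)

    ev-* : ∀ y p q → evalBy φ y (p P.*ₚ q) ≈ evalBy φ y p * evalBy φ y q
    ev-* y []      q = sym (zeroˡ _)
    ev-* y (a ∷ p) q = begin
      evalBy φ y (List.map (a R.*_) q P.+ₚ (R.0# ∷ (p P.*ₚ q)))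
        ≈⟨ ev-+ y (List.map (a R.*_) q) _ ⟩
      evalBy φ y (List.map (a R.*_) q) + (φ R.0# + y * evalBy φ y (p P.*ₚ q))
        ≈⟨ +-cong (ev-scale y a q) (+-cong 0#-homo (*-congˡ (ev-* y p q))) ⟩
      φ a * evalBy φ y q + (0# + y * (evalBy φ y p * evalBy φ y q))
        ≈⟨ solve 4 (λ a q y p → a :* q :+ (con (pos 0) :+ y :* (p :* q)) := (a :+ y :* p) :* q) refl _ _ _ _ ⟩
      (φ a + y * evalBy φ y p) * evalBy φ y q ∎

    ev-0s : ∀ y n → evalBy φ y (replicate n R.0#) ≈ 0#
    ev-0s y zero    = refl
    ev-0s y (suc n) = trans (+-cong 0#-homo (trans (*-congˡ (ev-0s y n)) (zeroʳ y))) (+-identityˡ 0#)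

    ev-weighted : ∀ y k p → evalBy φ y (weighted R (suc k) p) ≈ evalBy φ y p + evalBy φ y (weighted R k p)
    ev-weighted y k []      = sym (+-identityˡ _)
    ev-weighted y k (a ∷ p) = trans (+-cong (+-homo a (k ×ᴿ a)) (*-congˡ (ev-weighted y (suc k) p)))
      (solve 5 (λ a b y p q → a :+ b :+ y :* (p :+ q) := (a :+ y :* p) :+ (b :+ y :* q)) refl _ _ _ _ _)

    -- The product rule for a + X p. It trades the weight counter for a recursion on the list, on
    -- which the later rules for derivatives rest.
    ev-derivative : ∀ y a p → evalBy φ y (derivative R (a ∷ p)) ≈ evalBy φ y p + y * evalBy φ y (derivative R p)
    ev-derivative y a []      = sym (trans (+-identityˡ _) (zeroʳ y))
    ev-derivative y a (b ∷ p) = trans (ev-weighted y 0 (b ∷ p)) (+-congˡ (trans (+-congʳ 0#-homo) (+-identityˡ _)))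

  module _ where
    open Evaluation rawRing (Identity.isRingHomomorphism rawRing refl) public
      using () renaming (ev-+ to eval-+; ev-scale to eval-scale; ev-neg to eval-neg; ev-* to eval-*; ev-derivative to eval-derivative)

  deriv : Ω[X] → Ω[X]
  deriv = derivative rawRing

  Zero : Ω[X] → Set ℓ
  Zero p = ∀ n → coeff p n ≈ 0#

  zero⇒eval : ∀ p → Zero p → ∀ y → eval p y ≈ 0#
  zero⇒eval []      z y = refl
  zero⇒eval (a ∷ p) z y = trans (+-cong (z 0) (trans (*-congˡ (zero⇒eval p (z ∘ suc) y)) (zeroʳ y))) (+-identityˡ 0#)

  -- A nonconstant u vanishing everywhere would leave u + 1 without a root.
  eval⇒zero : ∀ p → (∀ y → eval p y ≈ 0#) → Zero p
  eval⇒zero []      z n = refl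
  eval⇒zero (a ∷ p) z = λ where
      zero    → trans (sym (trans (+-congˡ (zeroˡ _)) (+-identityʳ a))) (z 0#)
      (suc n) → dne em λ pn≉0 → let x , e = closed ((a + 1#) ∷ p) (n , pn≉0) in 1≉0 (begin
        1#                                          ≈⟨ +-identityʳ _ ⟨
        1# + 0#                                     ≈⟨ +-congˡ (z x) ⟨
        1# + (a + x * eval p x)                     ≈⟨ solve 2 (λ a b → con (pos 1) :+ (a :+ b) := (a :+ con (pos 1)) :+ b) refl _ _ ⟩
        (a + 1#) + x * eval p x                     ≈⟨ e ⟩
        0#                                          ∎)

  coeff-+ : ∀ p q n → coeff (p +ₚ q) n ≈ coeff p n + coeff q n
  coeff-+ []      q       n       = sym (+-identityˡ _)
  coeff-+ (a ∷ p) []      n       = sym (+-identityʳ _)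
  coeff-+ (a ∷ p) (b ∷ q) zero    = refl
  coeff-+ (a ∷ p) (b ∷ q) (suc n) = coeff-+ p q n

  coeff-neg : ∀ p n → coeff (List.map -_ p) n ≈ - coeff p n
  coeff-neg []      n       = sym -0#≈0#
  coeff-neg (a ∷ p) zero    = refl
  coeff-neg (a ∷ p) (suc n) = coeff-neg p n

  infix 4 _≗ₚ_
  _≗ₚ_ : Ω[X] → Ω[X] → Set (c ⊔ ℓ)
  p ≗ₚ q = ∀ y → eval p y ≈ eval q y

  difference : ∀ p q → Ω[X]
  difference p q = p +ₚ List.map -_ q

  ≈ₚ⇒zero : ∀ p q → p ≈ₚ q → Zero (difference p q)
  ≈ₚ⇒zero p q e n = trans (coeff-+ p _ n) (trans (+-cong (e n) (coeff-neg q n)) (-‿inverseʳ _))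

  ≗ₚ⇒≈ₚ : ∀ p q → p ≗ₚ q → p ≈ₚ q
  ≗ₚ⇒≈ₚ p q e n = x-y≈0⇒x≈y _ _ (trans (sym (trans (coeff-+ p _ n) (+-congˡ (coeff-neg q n))))
    (eval⇒zero (difference p q) (λ y → trans (eval-+ y p _) (trans (+-cong (e y) (eval-neg y q)) (-‿inverseʳ _))) n))

  ≈ₚ⇒≗ₚ : ∀ p q → p ≈ₚ q → p ≗ₚ q
  ≈ₚ⇒≗ₚ p q e y = x-y≈0⇒x≈y _ _ (trans (sym (trans (eval-+ y p _) (+-congˡ (eval-neg y q))))
    (zero⇒eval (difference p q) (≈ₚ⇒zero p q e) y))

  deriv-zero : ∀ p → Zero p → ∀ y → eval (deriv p) y ≈ 0#
  deriv-zero []      z y = refl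
  deriv-zero (a ∷ p) z y = trans (eval-derivative y a p)
    (trans (+-cong (zero⇒eval p (z ∘ suc) y) (trans (*-congˡ (deriv-zero p (z ∘ suc) y)) (zeroʳ y))) (+-identityˡ 0#))

  deriv-+ : ∀ y p q → eval (deriv (p +ₚ q)) y ≈ eval (deriv p) y + eval (deriv q) y
  deriv-+ y []      q       = sym (+-identityˡ _)
  deriv-+ y (a ∷ p) []      = sym (+-identityʳ _)
  deriv-+ y (a ∷ p) (b ∷ q) = begin
    eval (deriv ((a ∷ p) +ₚ (b ∷ q))) y
      ≈⟨ eval-derivative y (a + b) (p +ₚ q) ⟩
    eval (p +ₚ q) y + y * eval (deriv (p +ₚ q)) y
      ≈⟨ +-cong (eval-+ y p q) (*-congˡ (deriv-+ y p q)) ⟩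
    (eval p y + eval q y) + y * (eval (deriv p) y + eval (deriv q) y)
      ≈⟨ solve 5 (λ p q y r s → (p :+ q) :+ y :* (r :+ s) := (p :+ y :* r) :+ (q :+ y :* s)) refl _ _ _ _ _ ⟩
    (eval p y + y * eval (deriv p) y) + (eval q y + y * eval (deriv q) y)
      ≈⟨ +-cong (eval-derivative y a p) (eval-derivative y b q) ⟨
    eval (deriv (a ∷ p)) y + eval (deriv (b ∷ q)) y ∎

  deriv-scale : ∀ y a p → eval (deriv (List.map (a *_) p)) y ≈ a * eval (deriv p) y
  deriv-scale y a []      = sym (zeroʳ a)
  deriv-scale y a (b ∷ p) = begin
    eval (deriv (List.map (a *_) (b ∷ p))) y
      ≈⟨ eval-derivative y (a * b) (List.map (a *_) p) ⟩
    eval (List.map (a *_) p) y + y * eval (deriv (List.map (a *_) p)) y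
      ≈⟨ +-cong (eval-scale y a p) (*-congˡ (deriv-scale y a p)) ⟩
    a * eval p y + y * (a * eval (deriv p) y)
      ≈⟨ solve 4 (λ a p y q → a :* p :+ y :* (a :* q) := a :* (p :+ y :* q)) refl _ _ _ _ ⟩
    a * (eval p y + y * eval (deriv p) y)
      ≈⟨ *-congˡ (eval-derivative y b p) ⟨
    a * eval (deriv (b ∷ p)) y ∎

  deriv-neg : ∀ y p → eval (deriv (List.map -_ p)) y ≈ - eval (deriv p) y
  deriv-neg y []      = sym -0#≈0#
  deriv-neg y (b ∷ p) = begin
    eval (deriv (List.map -_ (b ∷ p))) y
      ≈⟨ eval-derivative y (- b) (List.map -_ p) ⟩
    eval (List.map -_ p) y + y * eval (deriv (List.map -_ p)) y
      ≈⟨ +-cong (eval-neg y p) (*-congˡ (deriv-neg y p)) ⟩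
    - eval p y + y * (- eval (deriv p) y)
      ≈⟨ solve 3 (λ p y q → :- p :+ y :* (:- q) := :- (p :+ y :* q)) refl _ _ _ ⟩
    - (eval p y + y * eval (deriv p) y)
      ≈⟨ -‿cong (eval-derivative y b p) ⟨
    - eval (deriv (b ∷ p)) y ∎

  -- The value of a polynomial at one point does not determine its derivative there; equality of all
  -- values is first turned into equality of coefficients.
  deriv-cong : ∀ p q → p ≗ₚ q → ∀ y → eval (deriv p) y ≈ eval (deriv q) y
  deriv-cong p q e y = x-y≈0⇒x≈y _ _ (trans (sym (trans (deriv-+ y p _) (+-congˡ (deriv-neg y q))))
    (deriv-zero (difference p q) (≈ₚ⇒zero p q (≗ₚ⇒≈ₚ p q e)) y))

  deriv-* : ∀ y p q → eval (deriv (p *ₚ q)) y ≈ eval (deriv p) y * eval q y + eval p y * eval (deriv q) y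
  deriv-* y []      q = solve 2 (λ a b → con (pos 0) := con (pos 0) :* a :+ con (pos 0) :* b) refl _ _
  deriv-* y (a ∷ p) q = begin
    eval (deriv (List.map (a *_) q +ₚ (0# ∷ (p *ₚ q)))) y
      ≈⟨ deriv-+ y (List.map (a *_) q) _ ⟩
    eval (deriv (List.map (a *_) q)) y + eval (deriv (0# ∷ (p *ₚ q))) y
      ≈⟨ +-cong (deriv-scale y a q) (trans (eval-derivative y 0# (p *ₚ q)) (+-cong (eval-* y p q) (*-congˡ (deriv-* y p q)))) ⟩
    a * q′ + (p₀ * q₀ + y * (p′ * q₀ + p₀ * q′))
      ≈⟨ solve 6 (λ a q₁ p₀ q₀ y p₁ → a :* q₁ :+ (p₀ :* q₀ :+ y :* (p₁ :* q₀ :+ p₀ :* q₁)) :=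
            (p₀ :+ y :* p₁) :* q₀ :+ (a :+ y :* p₀) :* q₁) refl a q′ p₀ q₀ y p′ ⟩
    (p₀ + y * p′) * q₀ + (a + y * p₀) * q′
      ≈⟨ +-congʳ (*-congʳ (eval-derivative y a p)) ⟨
    eval (deriv (a ∷ p)) y * q₀ + (a + y * p₀) * q′ ∎
    where
    p₀ = eval p y
    q₀ = eval q y
    p′ = eval (deriv p) y
    q′ = eval (deriv q) y

  linear : ∀ b y → eval ((- b) ∷ 1# ∷ []) y ≈ y + - b
  linear = solve 2 (λ b y → :- b :+ y :* (con (pos 1) :+ y :* con (pos 0)) := y :+ :- b) refl

  deriv-linear : ∀ b y → eval (deriv ((- b) ∷ 1# ∷ [])) y ≈ 1#
  deriv-linear b = solve 1 (λ y → (con (pos 1) :+ con (pos 0)) :+ y :* con (pos 0) := con (pos 1)) refl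

  prod : List Carrier → Carrier → Carrier
  prod bs y = List.foldr (λ b v → (y + - b) * v) 1# bs

  eval-linearProduct : ∀ bs y → eval (linearProduct bs) y ≈ prod bs y
  eval-linearProduct []       y = trans (+-congˡ (zeroʳ y)) (+-identityʳ 1#)
  eval-linearProduct (b ∷ bs) y = trans (eval-* y ((- b) ∷ 1# ∷ []) (linearProduct bs))
    (*-cong (linear b y) (eval-linearProduct bs y))

  eval-scaledProduct : ∀ k bs y → eval ((k ∷ []) *ₚ linearProduct bs) y ≈ k * prod bs y
  eval-scaledProduct k bs y = trans (eval-* y (k ∷ []) (linearProduct bs))
    (*-cong (trans (+-congˡ (zeroʳ y)) (+-identityʳ k)) (eval-linearProduct bs y))

  deriv-linearProduct : ∀ b bs y → eval (deriv (linearProduct (b ∷ bs))) y ≈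
                        prod bs y + (y + - b) * eval (deriv (linearProduct bs)) y
  deriv-linearProduct b bs y = trans (deriv-* y ((- b) ∷ 1# ∷ []) (linearProduct bs))
    (+-cong (trans (*-cong (deriv-linear b y) (eval-linearProduct bs y)) (*-identityˡ _)) (*-congʳ (linear b y)))

  prod-root : ∀ {bs y} → prod bs y ≈ 0# → Any (y ≈_) bs
  prod-root {[]}     e = ⊥-elim (1≉0 e)
  prod-root {b ∷ bs} {y} e with em {P = y ≈ b}
  ... | yes y≈b = here y≈b
  ... | no y≉b  = there (prod-root (integral e (y≉b ∘ x-y≈0⇒x≈y _ _)))

  root-prod : ∀ {bs y} → Any (y ≈_) bs → prod bs y ≈ 0#
  root-prod {b ∷ bs} {y} (here y≈b) = trans (*-congʳ (trans (+-congʳ y≈b) (-‿inverseʳ b))) (zeroˡ _)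
  root-prod {b ∷ bs} (there i)  = trans (*-congˡ (root-prod i)) (zeroʳ _)

  SimpleRoots : Ω[X] → Set (c ⊔ ℓ)
  SimpleRoots p = ∀ y → eval p y ≈ 0# → eval (deriv p) y ≉ 0#

  Distinct : List Carrier → Set (c ⊔ ℓ)
  Distinct = UniqueSetoid.Unique setoid

  -- The derivative of (X - b) q is q(b) at b, nonzero as b is not repeated, and (y - b) q′(y) at a
  -- root y of q other than b, which reduces the claim to q.
  distinct⇒simple : ∀ {bs} → Distinct bs → SimpleRoots (linearProduct bs)
  distinct⇒simple {[]} _ y e = ⊥-elim (1≉0 (trans (sym (eval-linearProduct [] y)) e))
  distinct⇒simple {b ∷ bs} (b∉ ∷ u) y e e′ with em {P = y ≈ b}
  ... | yes y≈b = All¬⇒¬Any b∉ (Any.map (trans (sym y≈b)) (prod-root (trans (sym (trans (deriv-linearProduct b bs y)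
                    (trans (+-congˡ (trans (*-congʳ (trans (+-congʳ y≈b) (-‿inverseʳ b))) (zeroˡ _))) (+-identityʳ _)))) e′)))
  ... | no y≉b = distinct⇒simple u y (trans (eval-linearProduct bs y) root)
      (integral (trans (sym (trans (deriv-linearProduct b bs y) (trans (+-congʳ root) (+-identityˡ _)))) e′) (y≉b ∘ x-y≈0⇒x≈y _ _))
    where
    root : prod bs y ≈ 0#
    root = integral (trans (sym (eval-linearProduct (b ∷ bs) y)) e) (y≉b ∘ x-y≈0⇒x≈y _ _)

  simple⇒distinct : ∀ {bs} → SimpleRoots (linearProduct bs) → Distinct bs
  simple⇒distinct {[]}     s = []
  simple⇒distinct {b ∷ bs} s = ¬Any⇒All¬ bs b∉ ∷ simple⇒distinct tail
    where
    b∉ : ¬ Any (b ≈_) bs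
    b∉ i = s b (trans (eval-linearProduct (b ∷ bs) b) (root-prod {b ∷ bs} (here refl)))
      (trans (deriv-linearProduct b bs b) (trans (+-cong (root-prod i) (trans (*-congʳ (-‿inverseʳ b)) (zeroˡ _))) (+-identityˡ 0#)))
    tail : SimpleRoots (linearProduct bs)
    tail y e e′ = s y (trans (eval-linearProduct (b ∷ bs) y) (trans (*-congˡ root) (zeroʳ _)))
      (trans (deriv-linearProduct b bs y) (trans (+-cong root (trans (*-congˡ e′) (zeroʳ _))) (+-identityˡ 0#)))
      where
      root = trans (sym (eval-linearProduct bs y)) e

  monic-nonConstant : ∀ {m} r → length r ≡ suc m → NonConstant (r ++ 1# ∷ [])
  monic-nonConstant (a ∷ [])    ≡.refl = 0 , 1≉0
  monic-nonConstant (a ∷ b ∷ r) ≡.refl = let n , e = monic-nonConstant (b ∷ r) ≡.refl in suc n , e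

  monic-root : ∀ {m} r → length r ≡ suc m → ∃ λ b → eval r b + b ^ length r ≈ 0#
  monic-root r l = let b , e = closed (r ++ 1# ∷ []) (monic-nonConstant r l) in
    b , trans (sym (trans (evalBy-snoc id b r 1#) (+-congˡ (*-identityˡ _)))) e

  -- Synthetic division of the monic polynomial X^(n+1) + (a ∷ r) by X - b.
  deflate-root : ∀ b a r → ∃ λ s → length s ≡ length r ×
    (∀ y → eval (a ∷ r) y + y * y ^ length r ≈ (eval (a ∷ r) b + b * b ^ length r) + (y + - b) * (eval s y + y ^ length s))
  deflate-root b a [] = [] , ≡.refl , λ y →
    solve 3 (λ a b y → a :+ y :* con (pos 0) :+ y :* con (pos 1) :=
                       (a :+ b :* con (pos 0) :+ b :* con (pos 1)) :+ (y :+ :- b) :* (con (pos 0) :+ con (pos 1))) refl a b y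
  deflate-root b a (a₁ ∷ r) = let s , l , e = deflate-root b a₁ r ; v = eval (a₁ ∷ r) b + b * b ^ length r in
    v ∷ s , ≡.cong suc l , λ y → begin
      a + y * eval (a₁ ∷ r) y + y * (y * y ^ length r)
        ≈⟨ solve 4 (λ a y e p → a :+ y :* e :+ y :* p := a :+ y :* (e :+ p)) refl a y _ _ ⟩
      a + y * (eval (a₁ ∷ r) y + y * y ^ length r)
        ≈⟨ +-congˡ (*-congˡ (e y)) ⟩
      a + y * (v + (y + - b) * (eval s y + y ^ length s))
        ≈⟨ solve 7 (λ a b y e p s q →
             a :+ y :* ((e :+ p) :+ (y :+ :- b) :* (s :+ q)) :=
             (a :+ b :* e :+ b :* p) :+ (y :+ :- b) :* ((e :+ p) :+ y :* s :+ y :* q))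
             refl a b y (eval (a₁ ∷ r) b) (b * b ^ length r) (eval s y) (y ^ length s) ⟩
      (a + b * eval (a₁ ∷ r) b + b * (b * b ^ length r)) + (y + - b) * (v + y * eval s y + y * y ^ length s) ∎

  factor : ∀ n r → length r ≡ n → ∃ λ bs → length bs ≡ n × (∀ y → eval r y + y ^ n ≈ prod bs y)
  factor zero    []      l      = [] , ≡.refl , λ y → +-identityˡ 1#
  factor (suc n) (a ∷ r) len =
    let lr             = ℕ.suc-injective len
        b , root       = monic-root (a ∷ r) ≡.refl
        s , l , e      = deflate-root b a r
        bs , l′ , e′   = factor n s (≡.trans l lr)
    in b ∷ bs , ≡.cong suc l′ , λ y → begin
      eval (a ∷ r) y + y * y ^ n
        ≡⟨ ≡.cong (λ k → eval (a ∷ r) y + y * y ^ k) lr ⟨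
      eval (a ∷ r) y + y * y ^ length r
        ≈⟨ trans (e y) (trans (+-congʳ root) (+-identityˡ _)) ⟩
      (y + - b) * (eval s y + y ^ length s)
        ≡⟨ ≡.cong (λ k → (y + - b) * (eval s y + y ^ k)) (≡.trans l lr) ⟩
      (y + - b) * (eval s y + y ^ n)
        ≈⟨ *-congˡ (e′ y) ⟩
      prod (b ∷ bs) y ∎

  record Hom (F : Subfield) : Set (c ⊔ ℓ) where
    field
      fun               : Elt F → Carrier
      isRingHomomorphism : RingMorphisms.IsRingHomomorphism (eltRing F) rawRing fun
    open RingMorphisms.IsRingHomomorphism isRingHomomorphism public

  open Hom public using (fun)

  module _ {F : Subfield} (f : Elt F → Carrier)
    (cong : ∀ x y → proj₁ x ≈ proj₁ y → f x ≈ f y)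
    (+-hom : ∀ x y → f (RawRing._+_ (eltRing F) x y) ≈ f x + f y)
    (*-hom : ∀ x y → f (RawRing._*_ (eltRing F) x y) ≈ f x * f y)
    (1-hom : f (RawRing.1# (eltRing F)) ≈ 1#) where

    private
      0-hom : f (RawRing.0# (eltRing F)) ≈ 0#
      0-hom = x+x≈x⇒x≈0 _ (trans (sym (+-hom _ _)) (cong _ _ (+-identityˡ 0#)))

      neg-hom : ∀ x → f (RawRing.-_ (eltRing F) x) ≈ - f x
      neg-hom x = +-inverseʳ-unique _ _ (trans (sym (+-hom _ _)) (trans (cong _ _ (-‿inverseʳ _)) 0-hom))

    mkHom : Hom F
    mkHom = record
      { fun = f
      ; isRingHomomorphism = record
        { isSemiringHomomorphism = record
          { isNearSemiringHomomorphism = record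
            { +-isMonoidHomomorphism = record
              { isMagmaHomomorphism = record
                { isRelHomomorphism = record { cong = λ {x} {y} → cong x y }
                ; homo              = +-hom
                }
              ; ε-homo = 0-hom
              }
            ; *-homo = *-hom
            }
          ; 1#-homo = 1-hom
          }
        ; -‿homo = neg-hom
        }
      }

  incl : ∀ F → Hom F
  incl F = mkHom proj₁ (λ _ _ e → e) (λ _ _ → refl) (λ _ _ → refl) refl

  restrict : ∀ {E F} → F ⊆ E → Hom E → Hom F
  restrict {E} {F} F⊆E σ = mkHom (fun σ ∘ lift {F} {E} F⊆E) (λ _ _ → Hom.⟦⟧-cong σ)
    (λ x y → trans (Hom.⟦⟧-cong σ refl) (Hom.+-homo σ _ _))
    (λ x y → trans (Hom.⟦⟧-cong σ refl) (Hom.*-homo σ _ _))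
    (trans (Hom.⟦⟧-cong σ refl) (Hom.1#-homo σ))

  hom-≉0 : ∀ {F} (σ : Hom F) x → proj₁ x ≉ 0# → fun σ x ≉ 0#
  hom-≉0 {F} σ (x , x∈F) x≉0 σx≈0 = let y , y∈F , e = inverseIn F x∈F x≉0 in 1≉0 (begin
    1#                               ≈⟨ Hom.1#-homo σ ⟨
    fun σ (1# , 1-closed F)          ≈⟨ Hom.⟦⟧-cong σ e ⟨
    fun σ (x * y , *-closed F x∈F y∈F) ≈⟨ Hom.*-homo σ (x , x∈F) (y , y∈F) ⟩
    fun σ (x , x∈F) * fun σ (y , y∈F)  ≈⟨ *-congʳ σx≈0 ⟩
    0# * fun σ (y , y∈F)             ≈⟨ zeroˡ _ ⟩
    0#                               ∎)

  hom-injective : ∀ {F} (σ : Hom F) x y → fun σ x ≈ fun σ y → proj₁ x ≈ proj₁ y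
  hom-injective {F} σ x y e = x-y≈0⇒x≈y _ _ (dne em λ x-y≉0 → hom-≉0 σ (x E.+ (E.- y)) x-y≉0 (begin
      fun σ (x E.+ (E.- y))          ≈⟨ Hom.+-homo σ x (E.- y) ⟩
      fun σ x + fun σ (E.- y)        ≈⟨ +-cong e (Hom.-‿homo σ y) ⟩
      fun σ y + - fun σ y            ≈⟨ -‿inverseʳ _ ⟩
      0#                             ∎))
    where module E = RawRing (eltRing F)

  ev : ∀ {F} → Hom F → Carrier → List (Elt F) → Carrier
  ev σ = evalBy (fun σ)

  -- Coefficients stay in F so that an embedding σ of F can be applied to them.
  -- As Ω is infinite, identities between polynomials over F are stated for their
  -- values, under every σ at once; a list r of length n also stands for the monic
  -- polynomial X^n + r, with value monicAt σ r.
  module PolynomialsOver (F : Subfield) where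
    open PolyOver F public using () renaming (_+ₚ_ to _+ᶠ_; _*ₚ_ to _*ᶠ_)
    module Ev (σ : Hom F) = Evaluation (eltRing F) (Hom.isRingHomomorphism σ)
    private module E = RawRing (eltRing F)

    AllZero : List (Elt F) → Set (c ⊔ ℓ)
    AllZero = All (λ a → proj₁ a ≈ 0#)

    at : Carrier → List (Elt F) → Carrier
    at = ev (incl F)

    at≡ : ∀ y p → at y p ≡ eval (toΩ F p) y
    at≡ = evalBy-map proj₁

    allZero⇒ev : ∀ {p} → AllZero p → ∀ (σ : Hom F) y → ev σ y p ≈ 0#
    allZero⇒ev []      σ y = refl
    allZero⇒ev (z ∷ zs) σ y = trans (+-cong (trans (Hom.⟦⟧-cong σ z) (Hom.0#-homo σ))
      (trans (*-congˡ (allZero⇒ev zs σ y)) (zeroʳ y))) (+-identityˡ 0#)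

    coeffs⇒allZero : ∀ p → Zero (toΩ F p) → AllZero p
    coeffs⇒allZero []      z = []
    coeffs⇒allZero (a ∷ p) z = z 0 ∷ coeffs⇒allZero p (z ∘ suc)

    at⇒allZero : ∀ p → (∀ y → at y p ≈ 0#) → AllZero p
    at⇒allZero p z = coeffs⇒allZero p (eval⇒zero (toΩ F p) (λ y → trans (reflexive (≡.sym (at≡ y p))) (z y)))

    monicAt : Hom F → List (Elt F) → Carrier → Carrier
    monicAt σ r y = ev σ y r + y ^ length r

    -- Lists may end in zeros, so a length is not yet a degree. The strict bound is what degree
    -- comparisons use: `length r` is the true degree of p.
    trim : ∀ p → AllZero p ⊎ ∃ λ (k : Elt F) → proj₁ k ≉ 0# × ∃ λ r → length r ℕ.< length p ×
           (∀ σ y → ev σ y p ≈ fun σ k * monicAt σ r y)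
    trim [] = inj₁ []
    trim (a ∷ p) with trim p
    ... | inj₂ (k , k≉0 , r , l , e) = let u , u∈F , ku≈1 = inverseIn F (proj₂ k) k≉0 in
      inj₂ (k , k≉0 , a E.* (u , u∈F) ∷ r , s≤s l , λ σ y → begin
        fun σ a + y * ev σ y p
          ≈⟨ +-cong (trans (Hom.⟦⟧-cong σ (trans (sym (*-identityʳ _)) (trans (*-congˡ (sym ku≈1))
               (solve 3 (λ a k u → a :* (k :* u) := k :* (a :* u)) refl _ _ _)))) (Hom.*-homo σ k (a E.* (u , u∈F)))) (*-congˡ (e σ y)) ⟩
        fun σ k * fun σ (a E.* (u , u∈F)) + y * (fun σ k * (ev σ y r + y ^ length r))
          ≈⟨ solve 5 (λ k a y r p → k :* a :+ y :* (k :* (r :+ p)) := k :* ((a :+ y :* r) :+ y :* p)) refl _ _ _ _ _ ⟩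
        fun σ k * monicAt σ (a E.* (u , u∈F) ∷ r) y ∎)
    ... | inj₁ z with em {P = proj₁ a ≈ 0#}
    ...   | yes a≈0 = inj₁ (a≈0 ∷ z)
    ...   | no a≉0  = inj₂ (a , a≉0 , [] , s≤s z≤n , λ σ y →
      trans (+-congˡ (trans (*-congˡ (allZero⇒ev z σ y)) (zeroʳ y)))
        (solve 1 (λ a → a :+ con (pos 0) := a :* (con (pos 0) :+ con (pos 1))) refl _))

    snoc : ∀ a s → ∃ λ s′ → ∃ λ t → a ∷ s ≡ s′ ++ t ∷ [] × length s′ ≡ length {A = Elt F} s
    snoc a []      = [] , a , ≡.refl , ≡.refl
    snoc a (b ∷ s) = let s′ , t , e , l = snoc b s in a ∷ s′ , t , ≡.cong (a ∷_) e , ≡.cong suc l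

    length-+ : ∀ {n} p q → length p ≡ n → length q ≡ n → length (p +ᶠ q) ≡ n
    length-+ []      q       _      lq = lq
    length-+ (a ∷ p) []      lp     _  = lp
    length-+ (a ∷ p) (b ∷ q) ≡.refl lq = ≡.cong suc (length-+ p q ≡.refl (ℕ.suc-injective lq))

    -- Horner's scheme: from g = f q + s, the list a + X s overflows by one term t Xⁿ, which is
    -- removed with t times the divisor. Remainders are padded to length n.
    divide : ∀ r g → ∃ λ q → ∃ λ s → length s ≡ length r ×
             (∀ σ y → ev σ y g ≈ monicAt σ r y * ev σ y q + ev σ y s)
    divide r [] = [] , replicate (length r) E.0# , List.length-replicate (length r) , λ σ y →
      sym (trans (+-cong (zeroʳ _) (Ev.ev-0s σ y (length r))) (+-identityˡ 0#))
    divide r (a ∷ g) =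
      let q , s , l , e     = divide r g
          s′ , t , as , l′  = snoc a s
          -tr               = List.map (E.- t E.*_) r
      in t ∷ q , s′ +ᶠ -tr , length-+ s′ -tr (≡.trans l′ l) (List.length-map _ r) , λ σ y →
        let R = ev σ y r
            p = y ^ length r
            Q = ev σ y q
            step : fun σ a + y * ev σ y s ≈ ev σ y s′ + fun σ t * p
            step = trans (reflexive (≡.cong (ev σ y) as)) (trans (evalBy-snoc (fun σ) y s′ t)
              (+-congˡ (*-congˡ (reflexive (≡.cong (y ^_) (≡.trans l′ l))))))
        in begin
        fun σ a + y * ev σ y g
          ≈⟨ +-congˡ (*-congˡ (e σ y)) ⟩
        fun σ a + y * ((R + p) * Q + ev σ y s)
          ≈⟨ solve 5 (λ a y R Q S → a :+ y :* (R :* Q :+ S) := (a :+ y :* S) :+ y :* (R :* Q)) refl (fun σ a) y (R + p) Q (ev σ y s) ⟩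
        (fun σ a + y * ev σ y s) + y * ((R + p) * Q)
          ≈⟨ +-congʳ step ⟩
        (ev σ y s′ + fun σ t * p) + y * ((R + p) * Q)
          ≈⟨ solve 6 (λ S t p y R Q → (S :+ t :* p) :+ y :* ((R :+ p) :* Q) :=
               (R :+ p) :* (t :+ y :* Q) :+ (S :+ :- t :* R)) refl (ev σ y s′) (fun σ t) p y R Q ⟩
        (R + p) * (fun σ t + y * Q) + (ev σ y s′ + - fun σ t * R)
          ≈⟨ +-congˡ (+-congˡ (*-congʳ (Hom.-‿homo σ t))) ⟨
        (R + p) * (fun σ t + y * Q) + (ev σ y s′ + fun σ (E.- t) * R)
          ≈⟨ +-congˡ (trans (Ev.ev-+ σ y s′ -tr) (+-congˡ (Ev.ev-scale σ y (E.- t) r))) ⟨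
        (R + p) * (fun σ t + y * Q) + ev σ y (s′ +ᶠ -tr) ∎

    -- Inverse to `factor`, but with coefficients kept in F: the same list is the expanded product
    -- under every embedding, which is what lets automorphisms act on orbit polynomials.
    expand : ∀ cs → ∃ λ r → length r ≡ length cs × (∀ (σ : Hom F) y → ev σ y r + y ^ length cs ≈ prod (List.map (fun σ) cs) y)
    expand [] = [] , ≡.refl , λ σ y → +-identityˡ 1#
    expand (b ∷ cs) =
      let r , l , e = expand cs
          -br = List.map (E.- b E.*_) (r ++ E.1# ∷ [])
          s = (E.0# ∷ r) +ᶠ -br
      in s , length-+ (E.0# ∷ r) -br (≡.cong suc l) (≡.trans (List.length-map _ (r ++ E.1# ∷ []))
               (≡.trans (List.length-++ r) (≡.trans (ℕ.+-comm (length r) 1) (≡.cong suc l)))) , λ σ y →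
        let R = ev σ y r
            p = y ^ length cs
            β = fun σ b
        in begin
        ev σ y s + y * p
          ≈⟨ +-congʳ (trans (Ev.ev-+ σ y (E.0# ∷ r) -br) (+-cong (+-congʳ (Hom.0#-homo σ)) (trans (Ev.ev-scale σ y (E.- b) (r ++ E.1# ∷ []))
               (*-cong (Hom.-‿homo σ b) (trans (evalBy-snoc (fun σ) y r E.1#) (+-congˡ (*-cong (Hom.1#-homo σ) (reflexive (≡.cong (y ^_) l))))))))) ⟩
        ((0# + y * R) + - β * (R + 1# * p)) + y * p
          ≈⟨ solve 4 (λ y R b p → ((con (pos 0) :+ y :* R) :+ :- b :* (R :+ con (pos 1) :* p)) :+ y :* p := (y :+ :- b) :* (R :+ p)) refl y R β p ⟩
        (y + - β) * (R + p)
          ≈⟨ *-congˡ (e σ y) ⟩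
        prod (List.map (fun σ) (b ∷ cs)) y ∎

-- Minimal polynomials, simple extensions, and the extension of embeddings.

module Extensions (em : ∀ {a} → ExcludedMiddle a) {c ℓ} {K : Field c ℓ} (K̄ : AlgebraicClosure K) where
  open AlgebraicClosure K̄ using (Ω; algebraicallyClosed; algebraic) renaming (base to K₀)
  open Subfields Ω hiding (zero)
  open LinearAlgebra em Ω
  open Polynomials em Ω algebraicallyClosed
  open Algebra.Properties.Ring ring using () renaming (x∙y⁻¹≈ε⇒x≈y to x-y≈0⇒x≈y)
  open Relation.Binary.Reasoning.Setoid setoid
  open PolynomialsOver

  evalBy-∘ : ∀ {a b} {A : Set a} {B : Set b} (φ : B → Carrier) (f : A → B) y p →
             evalBy φ y (List.map f p) ≡ evalBy (φ ∘ f) y p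
  evalBy-∘ φ f y []      = ≡.refl
  evalBy-∘ φ f y (a ∷ p) = ≡.cong (λ v → φ (f a) + y * v) (evalBy-∘ φ f y p)

  monic-snoc : ∀ {F} (σ : Hom F) r y → ev σ y (r ++ (1# , 1-closed F) ∷ []) ≈ monicAt F σ r y
  monic-snoc {F} σ r y = trans (evalBy-snoc (fun σ) y r _) (+-congˡ (trans (*-congʳ (Hom.1#-homo σ)) (*-identityˡ _)))

  allZero⇒≈[] : ∀ {F} {p : F [X]} → AllZero F p → PolyOver._≈ₚ_ F p []
  allZero⇒≈[] []       n       = refl
  allZero⇒≈[] (z ∷ zs) zero    = z
  allZero⇒≈[] {F} (z ∷ zs) (suc n) = allZero⇒≈[] {F} zs n

  -- Minimality speaks of all lists no longer than `coeffs`, that is, of all polynomials of smaller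
  -- degree. Read on lists of coefficients, it is the independence of the powers of x.
  record MinimalPolynomial (F : Subfield) (x : Carrier) : Set (c ⊔ ℓ) where
    field
      coeffs  : F [X]
      root    : monicAt F (incl F) coeffs x ≈ 0#
      minimal : ∀ s → length s ℕ.≤ length coeffs → at F x s ≈ 0# → AllZero F s

    degree : ℕ
    degree = length coeffs

    divides : ∀ g → at F x g ≈ 0# → ∃ λ q → ∀ σ y → ev σ y g ≈ monicAt F σ coeffs y * ev σ y q
    divides g gx≈0 =
      let q , s , l , e = divide F coeffs g
          sx≈0 = begin
            at F x s                                            ≈⟨ +-identityˡ _ ⟨
            0# + at F x s                                       ≈⟨ +-congʳ (trans (*-congʳ root) (zeroˡ _)) ⟨
            monicAt F (incl F) coeffs x * at F x q + at F x s   ≈⟨ e (incl F) x ⟨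
            at F x g                                            ≈⟨ gx≈0 ⟩
            0#                                                  ∎
      in q , λ σ y → trans (e σ y) (trans (+-congˡ (allZero⇒ev F (minimal s (ℕ.≤-reflexive l) sx≈0) σ y)) (+-identityʳ _))

    -- A polynomial vanishing at x is a multiple of the minimal one, also after applying σ. This is
    -- what makes g(x) ↦ (σ g)(y) well defined.
    transfer : ∀ σ {y} → monicAt F σ coeffs y ≈ 0# → ∀ g → at F x g ≈ 0# → ev σ y g ≈ 0#
    transfer σ root′ g gx≈0 = let q , e = divides g gx≈0 in trans (e σ _) (trans (*-congʳ root′) (zeroˡ _))

  algebraic-monic : ∀ x → ∃ λ r → monicAt K₀ (incl K₀) r x ≈ 0#
  algebraic-monic x with algebraic x
  ... | p , p≉0 , px≈0 with trim K₀ p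
  ...   | inj₁ z = ⊥-elim (p≉0 (allZero⇒≈[] {K₀} z))
  ...   | inj₂ (k , k≉0 , r , _ , e) =
    r , integral (trans (sym (e (incl K₀) x)) (trans (reflexive (at≡ K₀ x p)) px≈0)) k≉0

  module _ (F : Subfield) (K⊆F : K₀ ⊆ F) (x : Carrier) where

    opaque
      minimalPolynomial : MinimalPolynomial F x
      minimalPolynomial with least em (λ n → ∃ λ r → length r ≡ n × monicAt F (incl F) r x ≈ 0#)
        (let r , e = algebraic-monic x in _ , List.map (lift {K₀} {F} K⊆F) r , ≡.refl ,
          trans (+-cong (reflexive (evalBy-∘ proj₁ (lift {K₀} {F} K⊆F) x r)) (reflexive (≡.cong (x ^_) (List.length-map _ r)))) e)
      ... | n , (r , ≡.refl , root) , none = record { coeffs = r ; root = root ; minimal = minimal }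
        where
        minimal : ∀ s → length s ℕ.≤ length r → at F x s ≈ 0# → AllZero F s
        minimal s s≤r sx≈0 with trim F s
        ... | inj₁ z = z
        ... | inj₂ (k , k≉0 , r′ , r′<s , e) =
          ⊥-elim (none (length r′) (ℕ.<-≤-trans r′<s s≤r) (r′ , ≡.refl , integral (trans (sym (e (incl F) x)) sx≈0) k≉0))

    private
      -- With p = a + X p₁ and p(z) = 0, the inverse of z is -p₁(z) / a when a is nonzero; otherwise
      -- a factor z cancels and p₁ takes the place of p.
      inverse-polynomial : ∀ p → ¬ AllZero K₀ p → ∀ {z w} → at K₀ z p ≈ 0# → z * w ≈ 1# → ∃ λ u → w ≈ at K₀ z u
      inverse-polynomial [] nz e _ = ⊥-elim (nz [])
      inverse-polynomial (a ∷ p) nz {z} {w} e zw≈1 with em {P = proj₁ a ≈ 0#}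
      ... | yes a≈0 = inverse-polynomial p (nz ∘ (a≈0 ∷_)) (begin
          at K₀ z p                     ≈⟨ *-identityˡ _ ⟨
          1# * at K₀ z p                ≈⟨ *-congʳ zw≈1 ⟨
          (z * w) * at K₀ z p           ≈⟨ solve 3 (λ z w p → (z :* w) :* p := w :* (con (pos 0) :+ z :* p)) refl _ _ _ ⟩
          w * (0# + z * at K₀ z p)      ≈⟨ *-congˡ (+-congʳ a≈0) ⟨
          w * (proj₁ a + z * at K₀ z p) ≈⟨ *-congˡ e ⟩
          w * 0#                        ≈⟨ zeroʳ w ⟩
          0#                            ∎) zw≈1
      ... | no a≉0 = let b , b∈K , ab≈1 = inverseIn K₀ (proj₂ a) a≉0
                         -b = - b , -‿closed K₀ b∈K
                         P = at K₀ z p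
        in List.map (RawRing._*_ (eltRing K₀) -b) p , (begin
          w                                       ≈⟨ *-identityʳ w ⟨
          w * 1#                                  ≈⟨ *-congˡ ab≈1 ⟨
          w * (proj₁ a * b)                       ≈⟨ solve 5 (λ w a b z P → w :* (a :* b) := b :* w :* (a :+ z :* P) :+ :- b :* P :* (z :* w)) refl _ _ _ z P ⟩
          b * w * (proj₁ a + z * P) + - b * P * (z * w)  ≈⟨ +-cong (trans (*-congˡ e) (zeroʳ _)) (trans (*-congˡ zw≈1) (*-identityʳ _)) ⟩
          0# + - b * P                            ≈⟨ +-identityˡ _ ⟩
          - b * P                                 ≈⟨ Ev.ev-scale K₀ (incl K₀) z -b p ⟨
          at K₀ z (List.map (RawRing._*_ (eltRing K₀) -b) p) ∎)

    opaque
      -- The ring F[x] is already a field: an element z of it is algebraic over K itself, so its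
      -- inverse is a polynomial in z over K, hence again a value at x. Opaque, so that membership
      -- is unpacked only through `Adjoin⇒value`.
      Adjoin : Subfield
      Adjoin = record
        { elements  = Value
        ; ≈-closed  = λ { x≈y (g , e) → g , trans (sym x≈y) e }
        ; 0-closed  = [] , refl
        ; 1-closed  = const (1# , 1-closed F) , sym (const-at (1# , 1-closed F))
        ; +-closed  = value-+
        ; *-closed  = value-*
        ; -‿closed  = λ { (g , e) → List.map (RawRing.-_ (eltRing F)) g ,
            trans (-‿cong e) (sym (Ev.ev-neg F (incl F) x g)) }
        ; ⁻¹-closed = λ { {z} z∈ zw≈1 →
            let r , e = algebraic-monic z
                p = r ++ (1# , 1-closed K₀) ∷ []
                u , w≈ = inverse-polynomial p (nonzero r) (trans (monic-snoc (incl K₀) r z) e) zw≈1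
                g , f = at-closed z∈ u
            in g , trans w≈ f }
        }
        where
        Value : Carrier → Set (c ⊔ ℓ)
        Value z = ∃ λ (g : F [X]) → z ≈ at F x g
        const : Elt F → F [X]
        const a = a ∷ []
        const-at : ∀ a → at F x (const a) ≈ proj₁ a
        const-at a = trans (+-congˡ (zeroʳ x)) (+-identityʳ _)
        value-+ : ∀ {y z} → Value y → Value z → Value (y + z)
        value-+ (g , e) (h , f) = PolyOver._+ₚ_ F g h , trans (+-cong e f) (sym (Ev.ev-+ F (incl F) x g h))
        value-* : ∀ {y z} → Value y → Value z → Value (y * z)
        value-* (g , e) (h , f) = PolyOver._*ₚ_ F g h , trans (*-cong e f) (sym (Ev.ev-* F (incl F) x g h))
        nonzero : ∀ r → ¬ AllZero K₀ (r ++ (1# , 1-closed K₀) ∷ [])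
        nonzero []      (z ∷ _)  = 1≉0 z
        nonzero (a ∷ r) (_ ∷ zs) = nonzero r zs
        at-closed : ∀ {z} → Value z → ∀ u → Value (at K₀ z u)
        at-closed z∈ []      = [] , refl
        at-closed z∈ (a ∷ u) = value-+ (const (lift {K₀} {F} K⊆F a) , sym (const-at (lift {K₀} {F} K⊆F a))) (value-* z∈ (at-closed z∈ u))

      Adjoin⇒value : ∀ {z} → z ∈ elements Adjoin → ∃ λ (g : F [X]) → z ≈ at F x g
      Adjoin⇒value z∈ = z∈

      value⇒Adjoin : ∀ {z} (g : F [X]) → z ≈ at F x g → z ∈ elements Adjoin
      value⇒Adjoin g e = g , e

    ⊆-Adjoin : F ⊆ Adjoin
    ⊆-Adjoin a∈F = value⇒Adjoin ((_ , a∈F) ∷ []) (sym (trans (+-congˡ (zeroʳ x)) (+-identityʳ _)))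

    ∈-Adjoin : x ∈ elements Adjoin
    ∈-Adjoin = value⇒Adjoin ((0# , 0-closed F) ∷ (1# , 1-closed F) ∷ [])
      (solve 1 (λ x → x := con (pos 0) :+ x :* (con (pos 1) :+ x :* con (pos 0))) refl x)

    at-closed : ∀ {E} → F ⊆ E → ∀ {z} → z ∈ elements E → ∀ p → at F z p ∈ elements E
    at-closed {E} F⊆E z∈E []      = 0-closed E
    at-closed {E} F⊆E z∈E (a ∷ p) = +-closed E (F⊆E (proj₂ a)) (*-closed E z∈E (at-closed {E} F⊆E z∈E p))

    Adjoin-⊆ : ∀ {E} → F ⊆ E → x ∈ elements E → Adjoin ⊆ E
    Adjoin-⊆ {E} F⊆E x∈E z∈ = let g , e = Adjoin⇒value z∈ in ≈-closed E (sym e) (at-closed {E} F⊆E x∈E g)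

    private
      -- The factor `t` carries the power of x accumulated along the induction.
      powers : ∀ {n} (k : Fin n → Elt F) t → combination F k (λ i → t * x ^ toℕ i) ≈ t * at F x (List.tabulate k)
      powers {zero}  k t = sym (zeroʳ t)
      powers {suc n} k t = begin
        proj₁ (k zero) * (t * 1#) + combination F (k ∘ suc) (λ i → t * (x * x ^ toℕ i))
          ≈⟨ +-congˡ (sum-cong-≋ {n} (λ i → *-congˡ (sym (*-assoc t x _)))) ⟩
        proj₁ (k zero) * (t * 1#) + combination F (k ∘ suc) (λ i → (t * x) * x ^ toℕ i)
          ≈⟨ +-congˡ (powers (k ∘ suc) (t * x)) ⟩
        proj₁ (k zero) * (t * 1#) + (t * x) * at F x (List.tabulate (k ∘ suc))
          ≈⟨ solve 4 (λ k t x p → k :* (t :* con (pos 1)) :+ (t :* x) :* p := t :* (k :+ x :* p)) refl _ _ _ _ ⟩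
        t * at F x (List.tabulate k) ∎

      powers-1 : ∀ {n} (k : Fin n → Elt F) → combination F k (λ i → x ^ toℕ i) ≈ at F x (List.tabulate k)
      powers-1 {n} k = trans (sum-cong-≋ {n} (λ i → *-congˡ (sym (*-identityˡ _)))) (trans (powers k 1#) (*-identityˡ _))

      as-combination : ∀ {n} s → length s ≡ n → ∃ λ (k : Fin n → Elt F) → at F x s ≈ combination F k (λ i → x ^ toℕ i)
      as-combination s ≡.refl = List.lookup s ,
        trans (reflexive (≡.cong (at F x) (≡.sym (List.tabulate-lookup s)))) (sym (powers-1 (List.lookup s)))

      power∈ : ∀ n → x ^ n ∈ elements Adjoin
      power∈ zero    = 1-closed Adjoin
      power∈ (suc n) = *-closed Adjoin ∈-Adjoin (power∈ n)

    -- Division by any monic polynomial killing x bounds the representatives. Taken for Φ x with a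
    -- short polynomial, this later bounds a degree.
    Adjoin-spanning : ∀ r → monicAt F (incl F) r x ≈ 0# → ∀ {z} → z ∈ elements Adjoin →
                      Span F (λ (i : Fin (length r)) → x ^ toℕ i) z
    Adjoin-spanning r root z∈ =
      let g , e = Adjoin⇒value z∈
          q , s , l , f = divide F r g
          k , h = as-combination s l
      in k , trans e (trans (f (incl F) x) (trans (+-congʳ (trans (*-congʳ root) (zeroˡ _))) (trans (+-identityˡ _) h)))

    module _ (m : MinimalPolynomial F x) where
      open MinimalPolynomial m

      Adjoin-basis : Basis Adjoin F degree
      Adjoin-basis = record
        { vectors     = λ i → x ^ toℕ i
        ; inL         = λ i → power∈ (toℕ i)
        ; spanning    = Adjoin-spanning coeffs root
        ; independent = λ k e → tabulate⁻ (minimal (List.tabulate k) (ℕ.≤-reflexive (List.length-tabulate k))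
            (trans (sym (powers-1 k)) e))
        }

  -- An embedding takes a membership proof as part of its argument; both proofs are arbitrary here,
  -- so that any two choices can be compared.
  Extends : ∀ {E F} → Hom E → Hom F → Set (c ⊔ ℓ)
  Extends {E} {F} τ σ = ∀ {z} (p : z ∈ elements F) (q : z ∈ elements E) → fun τ (z , q) ≈ fun σ (z , p)

  infix 4 _≈ₕ_
  _≈ₕ_ : ∀ {E} → Hom E → Hom E → Set (c ⊔ ℓ)
  τ ≈ₕ υ = ∀ z → fun τ z ≈ fun υ z

  fun-cong : ∀ {E} (τ : Hom E) {z w} → z ≈ w → (p : z ∈ elements E) (q : w ∈ elements E) → fun τ (z , p) ≈ fun τ (w , q)
  fun-cong τ e p q = Hom.⟦⟧-cong τ e

  extends-trans : ∀ {E M F} (τ : Hom E) (υ : Hom M) (σ : Hom F) → F ⊆ M → Extends τ υ → Extends υ σ → Extends τ σ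
  extends-trans τ υ σ F⊆M e f p q = trans (e (F⊆M p) q) (f p (F⊆M p))

  hom-at : ∀ {E F} (τ : Hom E) (σ : Hom F) → F ⊆ E → Extends τ σ → ∀ {z} (z∈E : z ∈ elements E) p (q : at F z p ∈ elements E) →
           fun τ (at F z p , q) ≈ ev σ (fun τ (z , z∈E)) p
  hom-at {E} {F} τ σ F⊆E ext z∈E [] q = trans (Hom.⟦⟧-cong τ refl) (Hom.0#-homo τ)
  hom-at {E} {F} τ σ F⊆E ext z∈E (a ∷ p) q = trans (Hom.⟦⟧-cong τ refl)
    (trans (Hom.+-homo τ (_ , F⊆E (proj₂ a)) (_ , *-closed E z∈E (ev∈ p)))
      (+-cong (ext (proj₂ a) (F⊆E (proj₂ a))) (trans (Hom.*-homo τ (_ , z∈E) (_ , ev∈ p)) (*-congˡ (hom-at τ σ F⊆E ext z∈E p (ev∈ p))))))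
    where
    ev∈ : ∀ p → at F _ p ∈ elements E
    ev∈ []      = 0-closed E
    ev∈ (a ∷ p) = +-closed E (F⊆E (proj₂ a)) (*-closed E z∈E (ev∈ p))

  hom-root : ∀ {E F} (τ : Hom E) (σ : Hom F) → F ⊆ E → Extends τ σ → ∀ {z} (z∈E : z ∈ elements E) p →
             at F z p ≈ 0# → ev σ (fun τ (z , z∈E)) p ≈ 0#
  hom-root {E} {F} τ σ F⊆E ext z∈E p pz≈0 =
    trans (sym (hom-at τ σ F⊆E ext z∈E p (≈-closed E (sym pz≈0) (0-closed E))))
      (trans (Hom.⟦⟧-cong τ pz≈0) (Hom.0#-homo τ))

  hom-monicRoot : ∀ {E F} (τ : Hom E) (σ : Hom F) → F ⊆ E → Extends τ σ → ∀ {z} (z∈E : z ∈ elements E) r →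
                  monicAt F (incl F) r z ≈ 0# → monicAt F σ r (fun τ (z , z∈E)) ≈ 0#
  hom-monicRoot {F = F} τ σ F⊆E ext z∈E r e = trans (sym (monic-snoc σ r _))
    (hom-root τ σ F⊆E ext z∈E (r ++ (1# , 1-closed F) ∷ []) (trans (monic-snoc (incl F) r _) e))

  module _ (F : Subfield) (K⊆F : K₀ ⊆ F) (x : Carrier) (m : MinimalPolynomial F x) (σ : Hom F) {y : Carrier} where
    open MinimalPolynomial m

    private
      well-defined : monicAt F σ coeffs y ≈ 0# → ∀ g h → at F x g ≈ at F x h → ev σ y g ≈ ev σ y h
      well-defined e g h g≈h = x-y≈0⇒x≈y _ _
          (trans (sym (trans (Ev.ev-+ F σ y g -h) (+-congˡ (Ev.ev-neg F σ y h))))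
            (transfer σ e (PolynomialsOver._+ᶠ_ F g -h) (trans (Ev.ev-+ F (incl F) x g -h)
              (trans (+-cong g≈h (Ev.ev-neg F (incl F) x h)) (-‿inverseʳ _)))))
        where -h = List.map (RawRing.-_ (eltRing F)) h

      polynomial : Elt (Adjoin F K⊆F x) → F [X]
      polynomial (_ , z∈) = proj₁ (Adjoin⇒value F K⊆F x z∈)

      polynomial-at : ∀ z → proj₁ z ≈ at F x (polynomial z)
      polynomial-at (_ , z∈) = proj₂ (Adjoin⇒value F K⊆F x z∈)

    -- A polynomial is chosen for every element of F(x); `well-defined` makes the choice irrelevant,
    -- and from this all the laws follow.
    extendRoot : monicAt F σ coeffs y ≈ 0# → Hom (Adjoin F K⊆F x)
    extendRoot e = mkHom (λ z → ev σ y (polynomial z))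
        (λ u v u≈v → value u (polynomial v) (trans u≈v (polynomial-at v)))
        (λ u v → let g = polynomial u ; h = polynomial v in
          trans (value (u A.+ v) (g +ᶠ′ h) (trans (+-cong (polynomial-at u) (polynomial-at v)) (sym (Ev.ev-+ F (incl F) x g h))))
            (Ev.ev-+ F σ y g h))
        (λ u v → let g = polynomial u ; h = polynomial v in
          trans (value (u A.* v) (g *ᶠ′ h) (trans (*-cong (polynomial-at u) (polynomial-at v)) (sym (Ev.ev-* F (incl F) x g h))))
            (Ev.ev-* F σ y g h))
        (trans (value A.1# ((1# , 1-closed F) ∷ []) (sym (trans (+-congˡ (zeroʳ x)) (+-identityʳ _))))
          (trans (+-congˡ (zeroʳ y)) (trans (+-identityʳ _) (Hom.1#-homo σ))))
      where
      module A = RawRing (eltRing (Adjoin F K⊆F x))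
      open PolynomialsOver F using () renaming (_+ᶠ_ to _+ᶠ′_; _*ᶠ_ to _*ᶠ′_)
      value : ∀ z h → proj₁ z ≈ at F x h → ev σ y (polynomial z) ≈ ev σ y h
      value z h z≈h = well-defined e (polynomial z) h (trans (sym (polynomial-at z)) z≈h)

    extendRoot-value : ∀ e g {z} (p : z ∈ elements (Adjoin F K⊆F x)) → z ≈ at F x g → fun (extendRoot e) (z , p) ≈ ev σ y g
    extendRoot-value e g p z≈g = well-defined e (polynomial (_ , p)) g (trans (sym (polynomial-at (_ , p))) z≈g)

    extendRoot-extends : ∀ e → Extends (extendRoot e) σ
    extendRoot-extends e p q = trans (extendRoot-value e ((_ , p) ∷ []) q (sym (trans (+-congˡ (zeroʳ x)) (+-identityʳ _))))
      (trans (+-congˡ (zeroʳ y)) (+-identityʳ _))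

    extendRoot-root : ∀ e q → fun (extendRoot e) (x , q) ≈ y
    extendRoot-root e q = trans (extendRoot-value e ((0# , 0-closed F) ∷ (1# , 1-closed F) ∷ []) q
        (solve 1 (λ x → x := con (pos 0) :+ x :* (con (pos 1) :+ x :* con (pos 0))) refl x))
      (trans (+-cong (Hom.0#-homo σ) (*-congˡ (+-congʳ (Hom.1#-homo σ))))
        (solve 1 (λ y → con (pos 0) :+ y :* (con (pos 1) :+ y :* con (pos 0)) := y) refl y))

    extendRoot-unique : ∀ e {E} (τ : Hom E) (A⊆E : Adjoin F K⊆F x ⊆ E) → Extends τ σ →
      fun τ (x , A⊆E (∈-Adjoin F K⊆F x)) ≈ y → Extends τ (extendRoot e)
    extendRoot-unique e {E} τ A⊆E ext τx≈y {z} p q =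
      let g , z≈g = Adjoin⇒value F K⊆F x p
          at∈     = ≈-closed E z≈g q
      in trans (fun-cong τ z≈g q at∈)
        (trans (hom-at τ σ (A⊆E ∘ ⊆-Adjoin F K⊆F x) ext (A⊆E (∈-Adjoin F K⊆F x)) g at∈)
          (trans (evalBy-cong (fun σ) τx≈y g) (sym (extendRoot-value e g p z≈g))))

  module _ {a} {L : Subfield} (P : Subfield → Set a)
    (stop : ∀ F → K₀ ⊆ F → F ⊆ L → L ⊆ F → P F)
    (step : ∀ F (K⊆F : K₀ ⊆ F) → F ⊆ L → Finite L F → ∀ x → x ∈ elements L → ¬ (x ∈ elements F) → P (Adjoin F K⊆F x) → P F)
    where

    -- Induction on [L : F]: an x in L outside F makes [F(x) : F] at least 2, so [L : F(x)] is
    -- smaller. This plays the role of a tower of simple extensions.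
    adjoin-induction : ∀ F → K₀ ⊆ F → F ⊆ L → Finite L F → P F
    adjoin-induction F K⊆F F⊆L (n , B) = <-rec Goal go n F K⊆F F⊆L B
      where
      Goal : ℕ → Set _
      Goal n = ∀ F → K₀ ⊆ F → F ⊆ L → Basis L F n → P F
      go : ∀ n → (∀ {k} → k ℕ.< n → Goal k) → Goal n
      go n rec F K⊆F F⊆L B with em {P = ∃ λ x → x ∈ elements L × ¬ (x ∈ elements F)}
      ... | no none = stop F K⊆F F⊆L (λ x∈L → dne em λ x∉F → none (_ , x∈L , x∉F))
      ... | yes (x , x∈L , x∉F) = step F K⊆F F⊆L (n , B) x x∈L x∉F
          (rec (smaller (Adjoin-basis F K⊆F x m) C) (Adjoin F K⊆F x) (⊆-Adjoin F K⊆F x ∘ K⊆F) A⊆L C)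
        where
        m = minimalPolynomial F K⊆F x
        A⊆L = Adjoin-⊆ F K⊆F x {L} F⊆L x∈L
        C = proj₂ (finite-over {F} {Adjoin F K⊆F x} {L} (⊆-Adjoin F K⊆F x) (n , B))
        smaller : ∀ {j k} → Basis (Adjoin F K⊆F x) F j → Basis L (Adjoin F K⊆F x) k → k ℕ.< n
        smaller {zero} D C = ⊥-elim (basis-positive D)
        smaller {suc zero} D C = ⊥-elim (x∉F (degree-1⇒⊆ D (∈-Adjoin F K⊆F x)))
        smaller {suc (suc j)} {zero} D C = ⊥-elim (basis-positive C)
        smaller {suc (suc j)} {suc k} D C = ≡.subst (suc k ℕ.<_) (basis-unique (tower {N = F} {Adjoin F K⊆F x} {L} A⊆L (⊆-Adjoin F K⊆F x) D C) B)
          (ℕ.m<m+n (suc k) (s≤s z≤n))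

  -- Each step needs one root in Ω of the image of a minimal polynomial. Its degree is positive
  -- because no extension has an empty basis.
  extend : ∀ F L → K₀ ⊆ F → F ⊆ L → Finite L F → (σ : Hom F) → ∃ λ (τ : Hom L) → Extends τ σ
  extend F₀ L = adjoin-induction {L = L} (λ F → (σ : Hom F) → ∃ λ (τ : Hom L) → Extends τ σ)
    (λ F _ _ L⊆F σ → restrict {F} {L} L⊆F σ , λ p q → fun-cong σ refl (L⊆F q) p)
    (λ F K⊆F F⊆L fin x x∈L x∉F rec σ →
      let m = minimalPolynomial F K⊆F x
          open MinimalPolynomial m
          y , e = root-exists {F} σ coeffs (non-constant F K⊆F m)
          τ , ext = rec (extendRoot F K⊆F x m σ e)
      in τ , extends-trans τ (extendRoot F K⊆F x m σ e) σ (⊆-Adjoin F K⊆F x) ext (extendRoot-extends F K⊆F x m σ e))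
    F₀
    where
    non-constant : ∀ F {x} → K₀ ⊆ F → (m : MinimalPolynomial F x) → ∃ λ n → MinimalPolynomial.degree m ≡ suc n
    non-constant F {x} K⊆F m with MinimalPolynomial.degree m | Adjoin-basis F K⊆F x m
    ... | zero  | B = ⊥-elim (basis-positive B)
    ... | suc n | _ = n , ≡.refl
    root-exists : ∀ {F} (σ : Hom F) r → (∃ λ n → length r ≡ suc n) → ∃ λ y → monicAt F σ r y ≈ 0#
    root-exists {F} σ r (n , l) = let b , e = monic-root (List.map (fun σ) r) (≡.trans (List.length-map _ r) l) in
      b , trans (+-cong (reflexive (evalBy-map (fun σ) b r)) (reflexive (≡.cong (b ^_) (≡.sym (List.length-map (fun σ) r))))) e

-- Both terms of Pascal's rule are absorbed by induction. For n + 1 = p the right side is a multiple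
-- of p, which makes the inner binomial coefficients vanish in Ω.
absorption : ∀ n k → suc k ℕ.* (suc n ℕ.C suc k) ≡ suc n ℕ.* (n ℕ.C k)
absorption n zero = ≡.trans (ℕ.*-identityˡ _) (≡.trans (ℕ.nC1≡n (suc n)) (≡.sym (ℕ.*-identityʳ (suc n))))
absorption zero (suc k) = ℕ.*-zeroʳ (suc (suc k))
absorption (suc n) (suc k) = begin
  suc (suc k) ℕ.* (suc (suc n) ℕ.C suc (suc k))
    ≡⟨ ≡.cong (suc (suc k) ℕ.*_) (ℕ.nCk+nC[k+1]≡[n+1]C[k+1] (suc n) (suc k)) ⟨
  suc (suc k) ℕ.* ((suc n ℕ.C suc k) ℕ.+ (suc n ℕ.C suc (suc k)))
    ≡⟨ ℕ.*-distribˡ-+ (suc (suc k)) (suc n ℕ.C suc k) _ ⟩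
  ((suc n ℕ.C suc k) ℕ.+ suc k ℕ.* (suc n ℕ.C suc k)) ℕ.+ suc (suc k) ℕ.* (suc n ℕ.C suc (suc k))
    ≡⟨ ≡.cong₂ (λ a b → ((suc n ℕ.C suc k) ℕ.+ a) ℕ.+ b) (absorption n k) (absorption n (suc k)) ⟩
  ((suc n ℕ.C suc k) ℕ.+ suc n ℕ.* (n ℕ.C k)) ℕ.+ suc n ℕ.* (n ℕ.C suc k)
    ≡⟨ ≡.trans (ℕ.+-assoc (suc n ℕ.C suc k) _ _) (≡.cong ((suc n ℕ.C suc k) ℕ.+_) (≡.sym (ℕ.*-distribˡ-+ (suc n) (n ℕ.C k) _))) ⟩
  (suc n ℕ.C suc k) ℕ.+ suc n ℕ.* ((n ℕ.C k) ℕ.+ (n ℕ.C suc k))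
    ≡⟨ ≡.cong (λ a → (suc n ℕ.C suc k) ℕ.+ suc n ℕ.* a) (ℕ.nCk+nC[k+1]≡[n+1]C[k+1] n k) ⟩
  suc (suc n) ℕ.* (suc n ℕ.C suc k) ∎
  where open ≡.≡-Reasoning

-- Counting the embeddings of a separable extension.

module Counting (em : ∀ {a} → ExcludedMiddle a) {c ℓ} {K : Field c ℓ} (K̄ : AlgebraicClosure K) where
  open AlgebraicClosure K̄ using (Ω; algebraicallyClosed) renaming (base to K₀)
  open Subfields Ω hiding (zero)
  open Polynomial rawRing using (coeff)
  open LinearAlgebra em Ω
  open Polynomials em Ω algebraicallyClosed
  open Extensions em K̄
  open Relation.Binary.Reasoning.Setoid setoid
  open PolynomialsOver

  -- Separability over K in a form that passes up a tower: one polynomial over K serves over every F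
  -- above K, since the minimal polynomial over F divides it.
  SimpleAlgebraic : Carrier → Set (c ⊔ ℓ)
  SimpleAlgebraic x = ∃ λ (p : K₀ [X]) → at K₀ x p ≈ 0# × SimpleRoots (toΩ K₀ p)

  coeff-toΩ : ∀ F p n → coeff (toΩ F p) n ≈ proj₁ (PolyOver.coeff F p n)
  coeff-toΩ F []      n       = refl
  coeff-toΩ F (a ∷ p) zero    = refl
  coeff-toΩ F (a ∷ p) (suc n) = coeff-toΩ F p n

  separable⇒simple : ∀ {x} → SeparableOver K₀ x → SimpleAlgebraic x
  separable⇒simple {x} (p , ((n , pn≈1 , _) , _ , root) , k , as , unique , p≈) =
      p , trans (reflexive (at≡ K₀ x p)) root , λ y e e′ →
        distinct⇒simple unique y (trans (eval-linearProduct as y)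
          (integral (trans (sym (eval-scaledProduct k as y)) (trans (sym (p≗ y)) e)) k≉0))
          (integral (begin
            k * eval (deriv (linearProduct as)) y
              ≈⟨ solve 4 (λ k d y l → k :* d := con (pos 0) :* l :+ (k :+ y :* con (pos 0)) :* d) refl k _ y (eval (linearProduct as) y) ⟩
            0# * eval (linearProduct as) y + (k + y * 0#) * eval (deriv (linearProduct as)) y
              ≈⟨ deriv-* y (k ∷ []) (linearProduct as) ⟨
            eval (deriv ((k ∷ []) *ₚ linearProduct as)) y
              ≈⟨ deriv-cong (toΩ K₀ p) ((k ∷ []) *ₚ linearProduct as) p≗ y ⟨
            eval (deriv (toΩ K₀ p)) y
              ≈⟨ e′ ⟩
            0# ∎) k≉0)
    where
    p≗ : toΩ K₀ p ≗ₚ (k ∷ []) *ₚ linearProduct as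
    p≗ = ≈ₚ⇒≗ₚ (toΩ K₀ p) ((k ∷ []) *ₚ linearProduct as) p≈
    k≉0 : k ≉ 0#
    k≉0 k≈0 = 1≉0 (trans (sym pn≈1) (trans (sym (coeff-toΩ K₀ p n)) (eval⇒zero (toΩ K₀ p) (λ y →
      trans (p≗ y) (trans (eval-scaledProduct k as y) (trans (*-congʳ k≈0) (zeroˡ _)))) n)))

  FixesBase : ∀ {F} → Hom F → Set (c ⊔ ℓ)
  FixesBase {F} σ = ∀ {z} → z ∈ elements K₀ → (p : z ∈ elements F) → fun σ (z , p) ≈ z

  ev-base : ∀ F (K⊆F : K₀ ⊆ F) (σ : Hom F) → FixesBase σ → ∀ p y → ev σ y (List.map (lift {K₀} {F} K⊆F) p) ≈ eval (toΩ K₀ p) y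
  ev-base F K⊆F σ fixes []      y = refl
  ev-base F K⊆F σ fixes (a ∷ p) y = +-cong (fixes (proj₂ a) (K⊆F (proj₂ a))) (*-congˡ (ev-base F K⊆F σ fixes p y))

  lookup-injective : ∀ {bs} → Distinct bs → ∀ i j → List.lookup bs i ≈ List.lookup bs j → i ≡ j
  lookup-injective (_ ∷ _)        zero    zero    e = ≡.refl
  lookup-injective (_∷_ {xs = bs} b∉ _) zero (suc j) e = ⊥-elim (All¬⇒¬Any b∉ (Any.map (trans e) (∈-lookup setoid bs j)))
  lookup-injective (_∷_ {xs = bs} b∉ _) (suc i) zero e = ⊥-elim (All¬⇒¬Any b∉ (Any.map (trans (sym e)) (∈-lookup setoid bs i)))
  lookup-injective (_ ∷ u)        (suc i) (suc j) e = ≡.cong suc (lookup-injective u i j e)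

  record Roots {F} (σ : Hom F) (r : F [X]) : Set (c ⊔ ℓ) where
    field
      value     : Fin (length r) → Carrier
      isRoot    : ∀ i → monicAt F σ r (value i) ≈ 0#
      injective : ∀ i j → value i ≈ value j → i ≡ j
      complete  : ∀ y → monicAt F σ r y ≈ 0# → ∃ λ i → y ≈ value i

  -- Let f be the minimal polynomial. As σ fixes the coefficients of p, the image σ f divides p, and
  -- a divisor of a polynomial with simple roots has simple roots; so σ f has as many distinct roots
  -- as its degree.
  roots : ∀ F (K⊆F : K₀ ⊆ F) (σ : Hom F) → FixesBase σ → ∀ {x} → SimpleAlgebraic x → (m : MinimalPolynomial F x) →
          Roots σ (MinimalPolynomial.coeffs m)
  roots F K⊆F σ fixes {x} (p , px≈0 , simple) m = indexed len
    where
    open MinimalPolynomial m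
    factors = factor degree (List.map (fun σ) coeffs) (List.length-map (fun σ) coeffs)
    bs = proj₁ factors
    len = proj₁ (proj₂ factors)
    monic≈prod : ∀ y → monicAt F σ coeffs y ≈ prod bs y
    monic≈prod y = trans (+-congʳ (reflexive (evalBy-map (fun σ) y coeffs))) (proj₂ (proj₂ factors) y)
    quotient = divides (List.map (lift {K₀} {F} K⊆F) p) (trans (reflexive (evalBy-∘ proj₁ _ x p)) px≈0)
    q = List.map (fun σ) (proj₁ quotient)
    p≗ : toΩ K₀ p ≗ₚ linearProduct bs *ₚ q
    p≗ y = begin
      eval (toΩ K₀ p) y                                   ≈⟨ ev-base F K⊆F σ fixes p y ⟨
      ev σ y (List.map (lift {K₀} {F} K⊆F) p)             ≈⟨ proj₂ quotient σ y ⟩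
      monicAt F σ coeffs y * ev σ y (proj₁ quotient)      ≈⟨ *-cong (trans (monic≈prod y) (sym (eval-linearProduct bs y)))
                                                                    (reflexive (evalBy-map (fun σ) y (proj₁ quotient))) ⟩
      eval (linearProduct bs) y * eval q y                ≈⟨ eval-* y (linearProduct bs) q ⟨
      eval (linearProduct bs *ₚ q) y                      ∎
    distinct : Distinct bs
    distinct = simple⇒distinct λ y e e′ →
      simple y (trans (p≗ y) (trans (eval-* y (linearProduct bs) q) (trans (*-congʳ e) (zeroˡ _))))
        (trans (deriv-cong (toΩ K₀ p) (linearProduct bs *ₚ q) p≗ y) (trans (deriv-* y (linearProduct bs) q)
          (trans (+-cong (trans (*-congʳ e′) (zeroˡ _)) (trans (*-congʳ e) (zeroˡ _))) (+-identityˡ 0#))))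
    indexed : length bs ≡ length coeffs → Roots σ coeffs
    indexed l = record
      { value     = value
      ; isRoot    = λ i → trans (monic≈prod _) (root-prod (∈-lookup setoid bs (Fin.cast (≡.sym l) i)))
      ; injective = λ i j e → Fin.toℕ-injective (≡.trans (≡.sym (Fin.toℕ-cast (≡.sym l) i))
          (≡.trans (≡.cong toℕ (lookup-injective distinct (Fin.cast (≡.sym l) i) (Fin.cast (≡.sym l) j) e)) (Fin.toℕ-cast (≡.sym l) j)))
      ; complete  = λ y e → let i = prod-root {bs} (trans (sym (monic≈prod y)) e) in
          Fin.cast l (Any.index i) , trans (lookup-index i)
            (reflexive (≡.cong (List.lookup bs) (≡.sym (Fin.cast-involutive (≡.sym l) l (Any.index i)))))
      }
      where
      value : Fin (length coeffs) → Carrier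
      value i = List.lookup bs (Fin.cast (≡.sym l) i)

  record ExtensionsTo (E : Subfield) {F} (σ : Hom F) (n : ℕ) : Set (c ⊔ ℓ) where
    field
      hom       : Fin n → Hom E
      extends   : ∀ i → Extends (hom i) σ
      injective : ∀ i j → hom i ≈ₕ hom j → i ≡ j
      complete  : ∀ τ → Extends τ σ → ∃ λ i → hom i ≈ₕ τ

  module ThroughAdjoin {E : Subfield} (simple : ∀ {x} → x ∈ elements E → SimpleAlgebraic x)
    (F : Subfield) (K⊆F : K₀ ⊆ F) (F⊆E : F ⊆ E) (x : Carrier) (x∈E : x ∈ elements E) (m : MinimalPolynomial F x)
    (σ : Hom F) (fixes : FixesBase σ) {k : ℕ}
    (rec : (υ : Hom (Adjoin F K⊆F x)) → FixesBase υ → ExtensionsTo E υ k) where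

    private
      A : Subfield
      A = Adjoin F K⊆F x

      A⊆E : A ⊆ E
      A⊆E = Adjoin-⊆ F K⊆F x {E} F⊆E x∈E

    open MinimalPolynomial m using (coeffs; root; degree)
    open Roots (roots F K⊆F σ fixes (simple x∈E) m)

    private
      root-hom : Fin degree → Hom A
      root-hom i = extendRoot F K⊆F x m σ (isRoot i)

      root-hom-extends : ∀ i → Extends (root-hom i) σ
      root-hom-extends i = extendRoot-extends F K⊆F x m σ (isRoot i)

      exts : ∀ i → ExtensionsTo E (root-hom i) k
      exts i = rec (root-hom i) λ z∈K p → trans (root-hom-extends i (K⊆F z∈K) p) (fixes z∈K (K⊆F z∈K))

      hom : Fin degree × Fin k → Hom E
      hom (i , l) = ExtensionsTo.hom (exts i) l

      hom-x : ∀ i l → fun (hom (i , l)) (x , x∈E) ≈ value i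
      hom-x i l = trans (ExtensionsTo.extends (exts i) l (∈-Adjoin F K⊆F x) x∈E) (extendRoot-root F K⊆F x m σ (isRoot i) (∈-Adjoin F K⊆F x))

      hom-extends : ∀ p → Extends (hom p) σ
      hom-extends (i , l) = extends-trans (hom (i , l)) (root-hom i) σ (⊆-Adjoin F K⊆F x) (ExtensionsTo.extends (exts i) l) (root-hom-extends i)

      same-root : ∀ {i l i′ l′} → i ≡ i′ → hom (i , l) ≈ₕ hom (i′ , l′) → (i , l) ≡ (i′ , l′)
      same-root {i} {l} {_} {l′} ≡.refl e = ≡.cong (i ,_) (ExtensionsTo.injective (exts i) l l′ e)

      hom-distinct : ∀ s t → hom s ≈ₕ hom t → s ≡ t
      hom-distinct (i , l) (i′ , l′) e =
        same-root (injective i i′ (trans (sym (hom-x i l)) (trans (e (x , x∈E)) (hom-x i′ l′)))) e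

      root-of : ∀ (τ : Hom E) → Extends τ σ → ∃ λ i → fun τ (x , x∈E) ≈ value i
      root-of τ ext = complete (fun τ (x , x∈E)) (hom-monicRoot {E} {F} τ σ F⊆E ext x∈E coeffs root)

      extends-root-hom : ∀ (τ : Hom E) → Extends τ σ → ∀ i → fun τ (x , x∈E) ≈ value i → Extends τ (root-hom i)
      extends-root-hom τ ext i e = extendRoot-unique F K⊆F x m σ (isRoot i) τ A⊆E ext
        (trans (fun-cong τ refl (A⊆E (∈-Adjoin F K⊆F x)) x∈E) e)

      hom-complete : ∀ (τ : Hom E) → Extends τ σ → ∃ λ p → hom p ≈ₕ τ
      hom-complete τ ext = let i , e = root-of τ ext
                               l , f = ExtensionsTo.complete (exts i) τ (extends-root-hom τ ext i e)
                           in (i , l) , f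

    -- An extension of σ to E is determined by the root to which it sends x and by its place among
    -- the `k` extensions of the resulting embedding of F(x).
    through-adjoin : ExtensionsTo E σ (degree ℕ.* k)
    through-adjoin = record
      { hom       = λ t → hom (remQuot {degree} k t)
      ; extends   = λ t → hom-extends (remQuot {degree} k t)
      ; injective = λ s t e → ≡.trans (≡.sym (Fin.combine-remQuot {degree} k s))
          (≡.trans (≡.cong (uncurry (combine {degree} {k})) (hom-distinct (remQuot {degree} k s) (remQuot {degree} k t) e)) (Fin.combine-remQuot {degree} k t))
      ; complete  = λ τ ext → let (i , l) , e = hom-complete τ ext in
          combine {degree} {k} i l , ≡.subst (λ p → hom p ≈ₕ τ) (≡.sym (Fin.remQuot-combine {degree} {k} i l)) e
      }

  extensions-trivial : ∀ {E F} → F ⊆ E → E ⊆ F → (σ : Hom F) → ExtensionsTo E σ 1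
  extensions-trivial {E} {F} F⊆E E⊆F σ = record
    { hom       = λ _ → restrict {F} {E} E⊆F σ
    ; extends   = λ _ p q → fun-cong σ refl (E⊆F q) p
    ; injective = λ { zero zero _ → ≡.refl }
    ; complete  = λ τ ext → zero , λ { (z , p) → sym (ext (E⊆F p) p) }
    }

  -- Along `adjoin-induction` the numbers of extensions multiply like degrees; the uniqueness of
  -- basis sizes turns the product into the given `n`.
  extensions : ∀ {E} → (∀ {x} → x ∈ elements E → SimpleAlgebraic x) →
               ∀ F → K₀ ⊆ F → F ⊆ E → Finite E F → ∀ n → Basis E F n → (σ : Hom F) → FixesBase σ → ExtensionsTo E σ n
  extensions {E} simple = adjoin-induction {L = E} (λ F → ∀ n → Basis E F n → (σ : Hom F) → FixesBase σ → ExtensionsTo E σ n)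
    (λ F _ F⊆E E⊆F n B σ _ →
      ≡.subst (ExtensionsTo E σ) (basis-unique {N = F} {E} (basis-1 {E} {F} F⊆E E⊆F) B) (extensions-trivial {E} {F} F⊆E E⊆F σ))
    (λ F K⊆F F⊆E fin x x∈E _ rec n B σ fixes →
      let k , D = finite-over {F} {Adjoin F K⊆F x} {E} (⊆-Adjoin F K⊆F x) fin
          m     = minimalPolynomial F K⊆F x
      in ≡.subst (ExtensionsTo E σ)
           (basis-unique {N = F} {E} (tower {N = F} {Adjoin F K⊆F x} {E} (Adjoin-⊆ F K⊆F x {E} F⊆E x∈E) (⊆-Adjoin F K⊆F x) (Adjoin-basis F K⊆F x m) D) B)
           (ThroughAdjoin.through-adjoin {E} simple F K⊆F F⊆E x x∈E m σ fixes (rec k D)))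

-- The Frobenius map and polynomials with zero derivative.

module FrobeniusMap (em : ∀ {a} → ExcludedMiddle a) {c ℓ} (Ω : Field c ℓ)
  (closed : ∀ (p : Subfields.Ω[X] Ω) → Subfields.NonConstant Ω p → ∃ λ x → Field._≈_ Ω (Subfields.eval Ω p x) (Field.0# Ω))
  where
  open Subfields Ω hiding (zero)
  open LinearAlgebra em Ω
  open Polynomials em Ω closed
  open Relation.Binary.Reasoning.Setoid setoid
  open PolynomialsOver
  open Algebra.Properties.Semiring.Mult semiring using (×-homo-+; ×-homo-1; ×1-homo-*; ×-assoc-*; ×-congʳ) renaming (_×_ to _·_)
  open Algebra.Properties.Semiring.Sum semiring using (sum-init-last)
  open Algebra.Properties.Ring ring using () renaming (x∙y⁻¹≈ε⇒x≈y to x-y≈0⇒x≈y)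
  open Algebra.Properties.CommutativeSemiring.Exp commutativeSemiring using (^-distrib-*)
  import Algebra.Properties.CommutativeSemiring.Binomial commutativeSemiring as Binomial

  -- An interface that the identity also satisfies in characteristic 0. The bound in `deflate` says
  -- that h has smaller degree than the monic polynomial given by r, since n coefficients allow
  -- degree at most n - 1.
  record Frobenius : Set (lsuc (c ⊔ ℓ)) where
    field
      Φ           : Carrier → Carrier
      Φ-cong      : ∀ {x y} → x ≈ y → Φ x ≈ Φ y
      Φ-+         : ∀ x y → Φ (x + y) ≈ Φ x + Φ y
      Φ-*         : ∀ x y → Φ (x * y) ≈ Φ x * Φ y
      Φ-injective : ∀ {x y} → Φ x ≈ Φ y → x ≈ y
      Φ-closed    : ∀ F {x} → x ∈ elements F → Φ x ∈ elements F
      Φ-hom       : ∀ {F} (σ : Hom F) {x} (p : x ∈ elements F) (q : Φ x ∈ elements F) → fun σ (Φ x , q) ≈ Φ (fun σ (x , p))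
      deflate     : ∀ F (r : F [X]) → 0 ℕ.< length r → AllZero F (derivative (eltRing F) (r ++ (1# , 1-closed F) ∷ [])) →
                    ∃ λ h → length h ℕ.≤ length r × (∀ y → at F y (r ++ (1# , 1-closed F) ∷ []) ≈ at F (Φ y) h)

  times-elt : ∀ F k (a : Elt F) → proj₁ (Algebra.Definitions.RawMonoid._×_ (RawRing.+-rawMonoid (eltRing F)) k a) ≡ k · proj₁ a
  times-elt F zero    a = ≡.refl
  times-elt F (suc k) a = ≡.cong (proj₁ a +_) (times-elt F k a)

  weighted-last : ∀ F k s → AllZero F (weighted (eltRing F) k (s ++ (1# , 1-closed F) ∷ [])) → (length s ℕ.+ k) · 1# ≈ 0#
  weighted-last F k []      (z ∷ _)  = trans (reflexive (≡.sym (times-elt F k _))) z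
  weighted-last F k (a ∷ s) (_ ∷ zs) = trans (reflexive (≡.cong (_· 1#) (≡.sym (ℕ.+-suc (length s) k)))) (weighted-last F (suc k) s zs)

  -- The leading term of the derivative of a monic polynomial of degree n is n times 1, so a zero
  -- derivative forces positive characteristic.
  derivative-last : ∀ F r → 0 ℕ.< length r → AllZero F (derivative (eltRing F) (r ++ (1# , 1-closed F) ∷ [])) →
                    ∃ λ n → suc n · 1# ≈ 0#
  derivative-last F (a ∷ r) _ z = length r , trans (reflexive (≡.cong (_· 1#) (≡.sym (ℕ.+-comm (length r) 1)))) (weighted-last F 1 r z)

  power-closed : ∀ F n {x} → x ∈ elements F → x ^ n ∈ elements F
  power-closed F zero    x∈F = 1-closed F
  power-closed F (suc n) x∈F = *-closed F x∈F (power-closed F n x∈F)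

  hom-power : ∀ n {F} (σ : Hom F) {x} (x∈F : x ∈ elements F) (q : x ^ n ∈ elements F) → fun σ (x ^ n , q) ≈ fun σ (x , x∈F) ^ n
  hom-power zero    σ x∈F q = trans (Hom.⟦⟧-cong σ refl) (Hom.1#-homo σ)
  hom-power (suc n) {F} σ x∈F q = trans (Hom.⟦⟧-cong σ refl)
    (trans (Hom.*-homo σ (_ , x∈F) (_ , power-closed F n x∈F)) (*-congˡ (hom-power n σ x∈F (power-closed F n x∈F))))

  power≈0 : ∀ n {x} → x ^ n ≈ 0# → x ≈ 0#
  power≈0 zero    e = ⊥-elim (1≉0 e)
  power≈0 (suc n) e = dne em λ x≉0 → x≉0 (power≈0 n (integral e x≉0))

  module PositiveCharacteristic (p′ : ℕ) (p≈0 : suc p′ · 1# ≈ 0#) (smaller : ∀ k → k ℕ.< p′ → suc k · 1# ≉ 0#) where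
    p = suc p′

    multiple≈0 : ∀ q → (q ℕ.* p) · 1# ≈ 0#
    multiple≈0 q = trans (×1-homo-* q p) (trans (*-congˡ p≈0) (zeroʳ _))

    -- The remainder modulo p has the same image in Ω and lies strictly between 0 and p.
    ¬∣⇒≉0 : ∀ n → ¬ (p ℕ.∣ n) → n · 1# ≉ 0#
    ¬∣⇒≉0 n p∤n n≈0 with n ℕ.% p in eq | ℕ.m%n<n n p
    ... | zero  | _       = p∤n (ℕ.m%n≡0⇒n∣m n p eq)
    ... | suc k | s≤s k<p′ = smaller k k<p′ (begin
      suc k · 1#                                 ≈⟨ +-identityʳ _ ⟨
      suc k · 1# + 0#                            ≈⟨ +-congˡ (multiple≈0 (n ℕ./ p)) ⟨
      suc k · 1# + (n ℕ./ p ℕ.* p) · 1#            ≈⟨ ×-homo-+ 1# (suc k) (n ℕ./ p ℕ.* p) ⟨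
      (suc k ℕ.+ n ℕ./ p ℕ.* p) · 1#               ≡⟨ ≡.cong (λ j → (j ℕ.+ n ℕ./ p ℕ.* p) · 1#) eq ⟨
      (n ℕ.% p ℕ.+ n ℕ./ p ℕ.* p) · 1#               ≡⟨ ≡.cong (_· 1#) (ℕ.m≡m%n+[m/n]*n n p) ⟨
      n · 1#                                     ≈⟨ n≈0 ⟩
      0#                                         ∎)

    as-product : ∀ n x → n · x ≈ (n · 1#) * x
    as-product n x = sym (trans (×-assoc-* n 1# x) (×-congʳ n (*-identityˡ x)))

    cancel : ∀ n x → ¬ (p ℕ.∣ n) → n · x ≈ 0# → x ≈ 0#
    cancel n x p∤n e = integral (trans (sym (as-product n x)) e) (¬∣⇒≉0 n p∤n)

    -- (k+1) C(p, k+1) = p C(p-1, k) vanishes in Ω, and k+1 is invertible there.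
    binomial≈0 : ∀ k → k ℕ.< p′ → ∀ x → (p ℕ.C suc k) · x ≈ 0#
    binomial≈0 k k<p′ x = trans (as-product (p ℕ.C suc k) x) (trans (*-congʳ (integral (begin
        (suc k · 1#) * ((p ℕ.C suc k) · 1#)    ≈⟨ ×1-homo-* (suc k) (p ℕ.C suc k) ⟨
        (suc k ℕ.* (p ℕ.C suc k)) · 1#         ≡⟨ ≡.cong (_· 1#) (absorption p′ k) ⟩
        (p ℕ.* (p′ ℕ.C k)) · 1#                ≡⟨ ≡.cong (_· 1#) (ℕ.*-comm p (p′ ℕ.C k)) ⟩
        ((p′ ℕ.C k) ℕ.* p) · 1#                ≈⟨ multiple≈0 (p′ ℕ.C k) ⟩
        0#                                   ∎) (smaller k k<p′))) (zeroˡ x))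

    power-+ : ∀ x y → (x + y) ^ p ≈ x ^ p + y ^ p
    power-+ x y = begin
      (x + y) ^ p                                       ≈⟨ Binomial.theorem p x y ⟩
      term zero + sum (λ i → term (suc i))              ≈⟨ +-cong first (trans (sum-init-last (λ i → term (suc i))) (+-cong middle last)) ⟩
      y ^ p + (0# + x ^ p)                              ≈⟨ solve 2 (λ x y → y :+ (con (pos 0) :+ x) := x :+ y) refl (x ^ p) (y ^ p) ⟩
      x ^ p + y ^ p                                     ∎
      where
      term : Fin (suc p) → Carrier
      term = Binomial.binomialTerm x y p
      first : term zero ≈ y ^ p
      first = trans (×-homo-1 _) (*-identityˡ _)
      middle : sum (λ (i : Fin p′) → term (suc (inject₁ i))) ≈ 0#
      middle = trans (sum-cong-≋ {p′} (λ i → trans (reflexive (≡.cong (λ k → (p ℕ.C suc k) · Binomial.binomial x y p (suc (inject₁ i))) (Fin.toℕ-inject₁ i)))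
        (binomial≈0 (toℕ i) (Fin.toℕ<n i) _))) (sum-replicate-zero p′)
      last : term (suc (fromℕ p′)) ≈ x ^ p
      last = begin
        (p ℕ.C suc (toℕ (fromℕ p′))) · (x ^ suc (toℕ (fromℕ p′)) * y ^ (p′ ℕ.∸ toℕ (fromℕ p′)))
          ≡⟨ ≡.cong (λ k → (p ℕ.C suc k) · (x ^ suc k * y ^ (p′ ℕ.∸ k))) (Fin.toℕ-fromℕ p′) ⟩
        (p ℕ.C p) · (x ^ p * y ^ (p′ ℕ.∸ p′))
          ≡⟨ ≡.cong₂ (λ k l → k · (x ^ p * y ^ l)) (ℕ.nCn≡1 p) (ℕ.n∸n≡0 p′) ⟩
        1 · (x ^ p * 1#)
          ≈⟨ trans (×-homo-1 _) (*-identityʳ _) ⟩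
        x ^ p ∎

    -- k is the exponent of the first coefficient of f, and k + e the next multiple of p.
    compress : ∀ F (f : F [X]) k e d → e ℕ.+ d ≡ p′ → p ℕ.∣ k ℕ.+ e → AllZero F (weighted (eltRing F) k f) →
               ∃ λ h → p ℕ.* length h ℕ.≤ length f ℕ.+ d × (∀ y → at F y f ≈ y ^ e * at F (y ^ p) h)
    compress F [] k e d _ _ _ = [] , ℕ.≤-trans (ℕ.≤-reflexive (ℕ.*-zeroʳ p)) z≤n , λ y → sym (zeroʳ _)
    -- At a multiple of p the coefficient is kept, and `e` restarts at `p′`, the distance from k + 1
    -- to the next multiple.
    compress F (a ∷ f) k zero d ≡.refl p∣k (_ ∷ zs) =
      let h , l , e = compress F f (suc k) p′ 0 (ℕ.+-identityʳ p′)
                        (≡.subst (p ℕ.∣_) (≡.trans (≡.cong (ℕ._+ p) (ℕ.+-identityʳ k)) (ℕ.+-suc k p′)) (ℕ.∣m∣n⇒∣m+n p∣k ℕ.∣-refl)) zs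
      in a ∷ h , ℕ.≤-trans (ℕ.≤-reflexive (ℕ.*-suc p (length h)))
           (ℕ.≤-trans (ℕ.+-monoʳ-≤ p l) (ℕ.≤-reflexive (≡.trans (≡.cong (p ℕ.+_) (ℕ.+-identityʳ (length f))) (≡.cong suc (ℕ.+-comm p′ (length f))))))
         , λ y → trans (+-congˡ (*-congˡ (e y)))
             (solve 4 (λ a y P H → a :+ y :* (P :* H) := con (pos 1) :* (a :+ (y :* P) :* H)) refl (proj₁ a) y (y ^ p′) _)
    compress F (a ∷ f) k (suc e) d ed p∣k (z ∷ zs) =
      let h , l , eq = compress F f (suc k) e (suc d) (≡.trans (ℕ.+-suc e d) ed) (≡.subst (p ℕ.∣_) (ℕ.+-suc k e) p∣k) zs
      in h , ℕ.≤-trans l (ℕ.≤-reflexive (ℕ.+-suc (length f) d)) , λ y →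
           trans (+-cong a≈0 (*-congˡ (eq y))) (solve 3 (λ y P H → con (pos 0) :+ y :* (P :* H) := (y :* P) :* H) refl y (y ^ e) _)
      where
      e<p : suc e ℕ.< p
      e<p = s≤s (ℕ.≤-trans (ℕ.m≤m+n (suc e) d) (ℕ.≤-reflexive ed))
      -- `k` times `a` vanishes, and p does not divide `k`, because a multiple of p lies between 1
      -- and `p′` places further on.
      a≈0 : proj₁ a ≈ 0#
      a≈0 = cancel k (proj₁ a) (λ p∣k′ → ℕ.>⇒∤ e<p (ℕ.∣m+n∣m⇒∣n p∣k p∣k′)) (trans (reflexive (≡.sym (times-elt F k a))) z)

    1<p : 1 ℕ.< p
    1<p = s≤s (ℕ.n≢0⇒n>0 λ p′≡0 → 1≉0 (trans (sym (+-identityʳ 1#)) (trans (reflexive (≡.cong (λ n → suc n · 1#) (≡.sym p′≡0))) p≈0)))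

    frobenius : Frobenius
    frobenius = record
      { Φ           = _^ p
      ; Φ-cong      = ^-congˡ p
      ; Φ-+         = power-+
      ; Φ-*         = λ x y → ^-distrib-* x y p
      ; Φ-injective = λ {x} {y} e → x-y≈0⇒x≈y x y (power≈0 p (x-y≈0 x y e))
      ; Φ-closed    = λ F → power-closed F p
      ; Φ-hom       = hom-power p
      ; deflate     = deflate
      }
      where
      -- Additivity is applied to (x - y) + y, so that no power of -y has to be computed.
      x-y≈0 : ∀ x y → x ^ p ≈ y ^ p → (x + - y) ^ p ≈ 0#
      x-y≈0 x y e = begin
        (x + - y) ^ p                          ≈⟨ solve 2 (λ a b → a := (a :+ b) :+ :- b) refl _ (y ^ p) ⟩
        ((x + - y) ^ p + y ^ p) + - (y ^ p)    ≈⟨ +-congʳ (power-+ (x + - y) y) ⟨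
        ((x + - y) + y) ^ p + - (y ^ p)        ≈⟨ +-congʳ (^-congˡ p (solve 2 (λ x y → (x :+ :- y) :+ y := x) refl x y)) ⟩
        x ^ p + - (y ^ p)                      ≈⟨ +-congʳ e ⟩
        y ^ p + - (y ^ p)                      ≈⟨ -‿inverseʳ _ ⟩
        0#                                     ∎
      deflate : ∀ F (r : F [X]) → 0 ℕ.< length r → AllZero F (derivative (eltRing F) (r ++ (1# , 1-closed F) ∷ [])) →
                ∃ λ h → length h ℕ.≤ length r × (∀ y → at F y (r ++ (1# , 1-closed F) ∷ []) ≈ at F (y ^ p) h)
      deflate F r@(a ∷ r′) 0<r z =
          -- The constant term enters with weight 0, whence `refl`; the derivative supplies the
          -- weights from 1 on. Here e = 0, as 0 is a multiple of p, and e + d = `p′` then fixes d.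
          let h , l , e = compress F (r ++ (1# , 1-closed F) ∷ []) 0 0 p′ ≡.refl (p ℕ.∣0) (refl ∷ z)
          in h , short (length r) (length h) 0<r (ℕ.≤-trans l (ℕ.≤-reflexive
               (≡.trans (≡.cong (ℕ._+ p′) (≡.trans (List.length-++ r) (ℕ.+-comm (length r) 1))) (≡.sym (ℕ.+-suc (length r) p′))))) ,
             λ y → trans (e y) (*-identityˡ _)
        where
        -- If k exceeded n, then p (n + 1) ≤ n + p and so p n ≤ n, impossible for p > 1 and n > 0.
        short : ∀ n k → 0 ℕ.< n → p ℕ.* k ℕ.≤ n ℕ.+ p → k ℕ.≤ n
        short n k 0<n pk≤ with k ℕ.≤? n
        ... | yes k≤n = k≤n
        ... | no k≰n = ⊥-elim (ℕ.<-irrefl ≡.refl (ℕ.<-≤-trans (ℕ.m<m*n n p {{ℕ.>-nonZero 0<n}} 1<p)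
          (ℕ.≤-trans (ℕ.≤-reflexive (ℕ.*-comm n p)) (ℕ.+-cancelʳ-≤ p (p ℕ.* n) n
            (ℕ.≤-trans (ℕ.≤-reflexive (≡.trans (ℕ.+-comm (p ℕ.* n) p) (≡.sym (ℕ.*-suc p n))))
              (ℕ.≤-trans (ℕ.*-monoʳ-≤ p (ℕ.≰⇒> k≰n)) pk≤))))))

  -- In characteristic 0 the identity serves: nonconstant polynomials have nonzero derivative.
  frobenius : Frobenius
  frobenius with em {P = ∃ λ n → suc n · 1# ≈ 0#}
  ... | no none = record
    { Φ = id ; Φ-cong = id ; Φ-+ = λ _ _ → refl ; Φ-* = λ _ _ → refl ; Φ-injective = id ; Φ-closed = λ _ → id
    ; Φ-hom = λ σ p q → Hom.⟦⟧-cong σ refl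
    ; deflate = λ F r 0<r z → ⊥-elim (none (derivative-last F r 0<r z)) }
  ... | yes some = let p′ , p≈0 , smaller = least em (λ n → suc n · 1# ≈ 0#) some in
    PositiveCharacteristic.frobenius p′ p≈0 smaller

-- Irreducibility, separability, and the iterates of Frobenius.

module Separability (em : ∀ {a} → ExcludedMiddle a) {c ℓ} {K : Field c ℓ} (K̄ : AlgebraicClosure K)
  (frob : FrobeniusMap.Frobenius em (AlgebraicClosure.Ω K̄) (AlgebraicClosure.algebraicallyClosed K̄)) where
  open AlgebraicClosure K̄ using (Ω; algebraicallyClosed) renaming (base to K₀)
  open Subfields Ω hiding (zero)
  open LinearAlgebra em Ω
  open Polynomials em Ω algebraicallyClosed
  open Extensions em K̄
  open Counting em K̄
  open FrobeniusMap em Ω algebraicallyClosed using (times-elt; module Frobenius)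
  open Frobenius frob
  open Relation.Binary.Reasoning.Setoid setoid
  open Algebra.Properties.Ring ring using (x+x≈x⇒x≈0) renaming (x∙y⁻¹≈ε⇒x≈y to x-y≈0⇒x≈y)
  open PolynomialsOver
  open Spans

  -- Ω as a subfield of itself, so that `expand` applies to arbitrary lists of roots.
  ⊤ᶠ : Subfield
  ⊤ᶠ = record
    { elements  = λ _ → Lift (c ⊔ ℓ) ⊤
    ; ≈-closed  = λ _ _ → _
    ; 0-closed  = _
    ; 1-closed  = _
    ; +-closed  = λ _ _ → _
    ; *-closed  = λ _ _ → _
    ; -‿closed  = λ _ → _
    ; ⁻¹-closed = λ _ _ → _
    }

  monic≉0 : ∀ F r → ¬ (∀ y → monicAt F (incl F) r y ≈ 0#)
  monic≉0 F r z = last r (at⇒allZero F (r ++ (1# , 1-closed F) ∷ []) (λ y → trans (monic-snoc (incl F) r y) (z y)))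
    where
    last : ∀ r → ¬ AllZero F (r ++ (1# , 1-closed F) ∷ [])
    last []      (e ∷ _)  = 1≉0 e
    last (_ ∷ r) (_ ∷ es) = last r es

  prod≉0 : ∀ bs → ¬ (∀ y → prod bs y ≈ 0#)
  prod≉0 bs z =
    let cs        = List.map (λ b → b , _) bs
        r , l , e = expand ⊤ᶠ cs
    in monic≉0 ⊤ᶠ r λ y → trans (+-congˡ (reflexive (≡.cong (y ^_) l)))
         (trans (e (incl ⊤ᶠ) y) (trans (reflexive (≡.cong (λ bs → prod bs y) (same bs))) (z y)))
    where
    same : ∀ bs → List.map proj₁ (List.map {B = Elt ⊤ᶠ} (λ b → b , _) bs) ≡ bs
    same []       = ≡.refl
    same (b ∷ bs) = ≡.cong (b ∷_) (same bs)

  prod-++ : ∀ as bs y → prod (as ++ bs) y ≈ prod as y * prod bs y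
  prod-++ []       bs y = sym (*-identityˡ _)
  prod-++ (a ∷ as) bs y = trans (*-congˡ (prod-++ as bs y)) (sym (*-assoc _ _ _))

  monic-factor : ∀ F r → ∃ λ bs → ∀ y → monicAt F (incl F) r y ≈ prod bs y
  monic-factor F r =
    let bs , _ , e = factor (length r) (List.map proj₁ r) (List.length-map proj₁ r)
    in bs , λ y → trans (+-congʳ (reflexive (evalBy-map proj₁ y r))) (e y)

  -- Both factors split into linear ones over Ω, up to a constant, and a product of linear factors
  -- cannot vanish everywhere, being the value of a monic polynomial.
  monic-cancel : ∀ F r v → (∀ y → monicAt F (incl F) r y * at F y v ≈ 0#) → AllZero F v
  monic-cancel F r v z with trim F v
  ... | inj₁ v≈0 = v≈0
  ... | inj₂ (k , k≉0 , s , _ , e) =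
    let as , f = monic-factor F r
        bs , g = monic-factor F s
    in ⊥-elim (prod≉0 (as ++ bs) λ y → trans (prod-++ as bs y) (integral (begin
         proj₁ k * (prod as y * prod bs y)
           ≈⟨ solve 3 (λ k a b → k :* (a :* b) := a :* (k :* b)) refl _ _ _ ⟩
         prod as y * (proj₁ k * prod bs y)
           ≈⟨ *-cong (f y) (trans (e (incl F) y) (*-congˡ (g y))) ⟨
         monicAt F (incl F) r y * at F y v
           ≈⟨ z y ⟩
         0# ∎) k≉0))

  ≈⇒at : ∀ F p q → PolyOver._≈ₚ_ F p q → ∀ y → at F y p ≈ at F y q
  ≈⇒at F p q e y = trans (reflexive (at≡ F y p)) (trans (≈ₚ⇒≗ₚ (toΩ F p) (toΩ F q)
    (λ n → trans (coeff-toΩ F p n) (trans (e n) (sym (coeff-toΩ F q n)))) y) (reflexive (≡.sym (at≡ F y q))))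

  at⇒≈ : ∀ F p q → (∀ y → at F y p ≈ at F y q) → PolyOver._≈ₚ_ F p q
  at⇒≈ F p q e n = trans (sym (coeff-toΩ F p n)) (trans (≗ₚ⇒≈ₚ (toΩ F p) (toΩ F q)
    (λ y → trans (reflexive (≡.sym (at≡ F y p))) (trans (e y) (reflexive (at≡ F y q)))) n) (coeff-toΩ F q n))

  module Minimal {F : Subfield} (K⊆F : K₀ ⊆ F) {x : Carrier} (m : MinimalPolynomial F x) where
    open MinimalPolynomial m
    private
      module P = PolyOver F

    1ᶠ : Elt F
    1ᶠ = 1# , 1-closed F

    polynomial : F [X]
    polynomial = coeffs ++ 1ᶠ ∷ []

    polynomial-at : ∀ σ y → ev σ y polynomial ≈ monicAt F σ coeffs y
    polynomial-at σ y = monic-snoc σ coeffs y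

    monic : P.Monic polynomial
    monic = degree , leading coeffs , λ n → above coeffs
      where
      leading : ∀ r → proj₁ (P.coeff (r ++ 1ᶠ ∷ []) (length r)) ≈ 1#
      leading []      = refl
      leading (_ ∷ r) = leading r
      above : ∀ r {n} → length r ℕ.< n → proj₁ (P.coeff (r ++ 1ᶠ ∷ []) n) ≈ 0#
      above []      {suc n} _         = refl
      above (_ ∷ r) {suc n} (s≤s l) = above r l

    constant-at : ∀ y → at F y (1ᶠ ∷ []) ≈ 1#
    constant-at y = trans (+-congˡ (zeroʳ y)) (+-identityʳ _)

    -- If x is a root of the factor g, then g = f q, so f (1 - q h) = 0 and h is a unit.
    factor-unit : ∀ g h → (∀ y → monicAt F (incl F) coeffs y ≈ at F y g * at F y h) → at F x g ≈ 0# →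
                  ∃ λ q → ∀ y → at F y q * at F y h ≈ 1#
    factor-unit g h f≈gh gx≈0 =
      let q , g≈fq = divides g gx≈0
          qh = q P.*ₚ h
          v = (1ᶠ ∷ []) P.+ₚ List.map (RawRing.-_ (eltRing F)) qh
          v-at : ∀ y → at F y v ≈ 1# + - (at F y q * at F y h)
          v-at y = trans (Ev.ev-+ F (incl F) y (1ᶠ ∷ []) (List.map (RawRing.-_ (eltRing F)) qh))
            (+-cong (constant-at y) (trans (Ev.ev-neg F (incl F) y qh) (-‿cong (Ev.ev-* F (incl F) y q h))))
          v≈0 = monic-cancel F coeffs v λ y → begin
            monicAt F (incl F) coeffs y * at F y v
              ≈⟨ *-congˡ (v-at y) ⟩
            monicAt F (incl F) coeffs y * (1# + - (at F y q * at F y h))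
              ≈⟨ solve 3 (λ f q h → f :* (con (pos 1) :+ :- (q :* h)) := f :+ :- ((f :* q) :* h)) refl _ (at F y q) (at F y h) ⟩
            monicAt F (incl F) coeffs y + - ((monicAt F (incl F) coeffs y * at F y q) * at F y h)
              ≈⟨ +-cong (f≈gh y) (-‿cong (*-congʳ (sym (g≈fq (incl F) y)))) ⟩
            at F y g * at F y h + - (at F y g * at F y h)
              ≈⟨ -‿inverseʳ _ ⟩
            0# ∎
      in q , λ y → sym (x-y≈0⇒x≈y _ _ (trans (sym (v-at y)) (allZero⇒ev F v≈0 (incl F) y)))

    private
      module UnitFactor (g h : F [X]) (e : P._≈ₚ_ polynomial (g P.*ₚ h)) where
        f≈gh : ∀ y → monicAt F (incl F) coeffs y ≈ at F y g * at F y h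
        f≈gh y = trans (sym (polynomial-at (incl F) y)) (trans (≈⇒at F polynomial (g P.*ₚ h) e y) (Ev.ev-* F (incl F) y g h))

        unit : ∀ h → (∃ λ q → ∀ y → at F y q * at F y h ≈ 1#) → ∃ λ q → P._≈ₚ_ (q P.*ₚ h) (1ᶠ ∷ [])
        unit h (q , f) = q , at⇒≈ F (q P.*ₚ h) (1ᶠ ∷ []) λ y → trans (Ev.ev-* F (incl F) y q h) (trans (f y) (sym (constant-at y)))

    -- x is a root of one of the two factors, since Ω has no zero divisors; the other factor is then
    -- a unit.
    unit-factor : ∀ g h → P._≈ₚ_ polynomial (g P.*ₚ h) →
                  (∃ λ q → P._≈ₚ_ (q P.*ₚ g) (1ᶠ ∷ [])) ⊎ (∃ λ q → P._≈ₚ_ (q P.*ₚ h) (1ᶠ ∷ []))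
    unit-factor g h e with em {P = at F x g ≈ 0#}
    ... | yes gx≈0 = inj₂ (unit h (factor-unit g h f≈gh gx≈0))
      where
      open UnitFactor g h e
    ... | no gx≉0 = inj₁ (unit g (factor-unit h g (λ y → trans (f≈gh y) (*-comm _ _))
            (integral (trans (sym (f≈gh x)) root) gx≉0)))
      where
      open UnitFactor g h e

    irreducible : P.Irreducible polynomial
    irreducible = record
      { p∤1      = λ d → let q = RawMagmaDefinitions._∣ʳ_.quotient d in 1≉0 (begin
          1#                                      ≈⟨ constant-at x ⟨
          at F x (1ᶠ ∷ [])                        ≈⟨ ≈⇒at F (q P.*ₚ polynomial) (1ᶠ ∷ []) (RawMagmaDefinitions._∣ʳ_.equality d) x ⟨
          at F x (q P.*ₚ polynomial)              ≈⟨ Ev.ev-* F (incl F) x q polynomial ⟩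
          at F x q * at F x polynomial            ≈⟨ *-congˡ (trans (polynomial-at (incl F) x) root) ⟩
          at F x q * 0#                           ≈⟨ zeroʳ _ ⟩
          0#                                      ∎)
      ; split-∣1 = λ {g} {h} e →
          [ (λ (q , f) → inj₁ record { quotient = q ; equality = f })
          , (λ (q , f) → inj₂ record { quotient = q ; equality = f }) ] (unit-factor g h e)
      }

    isMinimalPolynomial : IsMinimalPolynomial F x polynomial
    isMinimalPolynomial = monic , irreducible ,
      trans (reflexive (≡.sym (at≡ F x polynomial))) (trans (polynomial-at (incl F) x) root)

    -- The embedding F(x) → F(y) sending x to y is injective.
    conjugate-symmetric : ∀ {y} → monicAt F (incl F) coeffs y ≈ 0# → ∀ g → at F y g ≈ 0# → at F x g ≈ 0#
    conjugate-symmetric {y} e g gy≈0 = dne em λ gx≉0 → hom-≉0 τ (at F x g , gx∈) gx≉0 (begin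
        fun τ (at F x g , gx∈)                    ≈⟨ hom-at τ (incl F) (⊆-Adjoin F K⊆F x) τ-extends (∈-Adjoin F K⊆F x) g gx∈ ⟩
        at F (fun τ (x , ∈-Adjoin F K⊆F x)) g     ≈⟨ evalBy-cong proj₁ (extendRoot-root F K⊆F x m (incl F) e (∈-Adjoin F K⊆F x)) g ⟩
        at F y g                                  ≈⟨ gy≈0 ⟩
        0#                                        ∎)
      where
      τ = extendRoot F K⊆F x m (incl F) e
      τ-extends : Extends τ (incl F)
      τ-extends = extendRoot-extends F K⊆F x m (incl F) e
      gx∈ : at F x g ∈ elements (Adjoin F K⊆F x)
      gx∈ = value⇒Adjoin F K⊆F x g refl

    toΩ-weighted : ∀ k p → toΩ F (weighted (eltRing F) k p) ≡ weighted rawRing k (toΩ F p)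
    toΩ-weighted k []      = ≡.refl
    toΩ-weighted k (a ∷ p) = ≡.cong₂ _∷_ (times-elt F k a) (toΩ-weighted (suc k) p)

    toΩ-derivative : ∀ p → toΩ F (derivative (eltRing F) p) ≡ deriv (toΩ F p)
    toΩ-derivative []      = ≡.refl
    toΩ-derivative (a ∷ p) = toΩ-weighted 1 p

    positive : 0 ℕ.< degree
    positive = ℕ.n≢0⇒n>0 λ d≡0 → basis-positive (≡.subst (Basis (Adjoin F K⊆F x) F) d≡0 (Adjoin-basis F K⊆F x m))

    length-weighted : ∀ k p → length (weighted (eltRing F) k p) ≡ length p
    length-weighted k []      = ≡.refl
    length-weighted k (a ∷ p) = ≡.cong suc (length-weighted (suc k) p)

    length-derivative : length (derivative (eltRing F) polynomial) ≡ degree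
    length-derivative = go coeffs positive
      where
      go : ∀ r → 0 ℕ.< length r → length (derivative (eltRing F) (r ++ 1ᶠ ∷ [])) ≡ length r
      go (a ∷ r) _ = ≡.trans (length-weighted 1 (r ++ 1ᶠ ∷ [])) (≡.trans (List.length-++ r) (ℕ.+-comm (length r) 1))

    -- If f′ had a common root with f it would vanish, so f = h(X^p), and h would
    -- bound the degree of F(Φ x) = F(x) below that of f.
    simpleRoots : x ∈ elements (Adjoin F K⊆F (Φ x)) → SimpleRoots (toΩ F polynomial)
    simpleRoots x∈ y e e′ = impossible (trim F h)
      where
      derivative-root : at F y (derivative (eltRing F) polynomial) ≈ 0#
      derivative-root = trans (reflexive (at≡ F y (derivative (eltRing F) polynomial)))
        (trans (reflexive (≡.cong (λ p → eval p y) (toΩ-derivative polynomial))) e′)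
      derivative-zero : AllZero F (derivative (eltRing F) polynomial)
      derivative-zero = minimal (derivative (eltRing F) polynomial) (ℕ.≤-reflexive length-derivative)
        (conjugate-symmetric (trans (sym (polynomial-at (incl F) y)) (trans (reflexive (at≡ F y polynomial)) e))
          (derivative (eltRing F) polynomial) derivative-root)
      deflated : ∃ λ h → length h ℕ.≤ degree × (∀ y → at F y polynomial ≈ at F (Φ y) h)
      deflated = deflate F coeffs positive derivative-zero
      h = proj₁ deflated
      f≈h : ∀ y → monicAt F (incl F) coeffs y ≈ at F (Φ y) h
      f≈h y = trans (sym (polynomial-at (incl F) y)) (proj₂ (proj₂ deflated) y)
      Φx-degree : ∀ r → length r ℕ.< length h → ¬ (monicAt F (incl F) r (Φ x) ≈ 0#)
      Φx-degree r r<h rΦx≈0 = ℕ.<-irrefl ≡.refl (ℕ.<-≤-trans r<h (ℕ.≤-trans (proj₁ (proj₂ deflated))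
        (basis-≤ (Adjoin-basis F K⊆F x m) (λ z∈ → Adjoin-spanning F K⊆F (Φ x) r rΦx≈0
          (Adjoin-⊆ F K⊆F x {Adjoin F K⊆F (Φ x)} (⊆-Adjoin F K⊆F (Φ x)) x∈ z∈)))))
      impossible : ¬ (AllZero F h ⊎ ∃ λ (k : Elt F) → proj₁ k ≉ 0# × ∃ λ r → length r ℕ.< length h ×
                      (∀ σ y → ev σ y h ≈ fun σ k * monicAt F σ r y))
      impossible (inj₁ z) = monic≉0 F coeffs λ y → trans (f≈h y) (allZero⇒ev F z (incl F) (Φ y))
      impossible (inj₂ (k , k≉0 , r , r<h , f)) = Φx-degree r r<h
        (integral (trans (sym (f (incl F) (Φ x))) (trans (sym (f≈h x)) root)) k≉0)

    separable : x ∈ elements (Adjoin F K⊆F (Φ x)) → SeparableOver F x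
    separable x∈ = polynomial , isMinimalPolynomial , 1# , bs , simple⇒distinct simple , ≗ₚ⇒≈ₚ (toΩ F polynomial) ((1# ∷ []) *ₚ linearProduct bs) f≗
      where
      bs = proj₁ (monic-factor F coeffs)
      f≈prod : ∀ y → eval (toΩ F polynomial) y ≈ prod bs y
      f≈prod y = trans (reflexive (≡.sym (at≡ F y polynomial))) (trans (polynomial-at (incl F) y) (proj₂ (monic-factor F coeffs) y))
      f≗ : toΩ F polynomial ≗ₚ (1# ∷ []) *ₚ linearProduct bs
      f≗ y = trans (f≈prod y) (sym (trans (eval-scaledProduct 1# bs y) (*-identityˡ _)))
      f≗′ : linearProduct bs ≗ₚ toΩ F polynomial
      f≗′ y = trans (eval-linearProduct bs y) (sym (f≈prod y))
      simple : SimpleRoots (linearProduct bs)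
      simple y e e′ = simpleRoots x∈ y (trans (sym (f≗′ y)) e)
        (trans (sym (deriv-cong (linearProduct bs) (toΩ F polynomial) f≗′ y)) e′)

  Φ-0 : Φ 0# ≈ 0#
  Φ-0 = x+x≈x⇒x≈0 _ (trans (sym (Φ-+ 0# 0#)) (Φ-cong (+-identityˡ 0#)))

  -- Φ 1 is idempotent, and nonzero by injectivity.
  Φ-1 : Φ 1# ≈ 1#
  Φ-1 = x-y≈0⇒x≈y _ _ (integral (begin
      Φ 1# * (Φ 1# + - 1#)       ≈⟨ solve 1 (λ a → a :* (a :+ :- con (pos 1)) := a :* a :+ :- a) refl (Φ 1#) ⟩
      Φ 1# * Φ 1# + - Φ 1#       ≈⟨ +-congʳ (trans (sym (Φ-* 1# 1#)) (Φ-cong (*-identityˡ 1#))) ⟩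
      Φ 1# + - Φ 1#              ≈⟨ -‿inverseʳ _ ⟩
      0#                         ∎)
    (λ Φ1≈0 → 1≉0 (Φ-injective (trans Φ1≈0 (sym Φ-0)))))

  Φ-sum : ∀ {n} (t : Fin n → Carrier) → Φ (sum t) ≈ sum (λ i → Φ (t i))
  Φ-sum {zero}  t = Φ-0
  Φ-sum {suc n} t = trans (Φ-+ _ _) (+-congˡ (Φ-sum (t ∘ suc)))

  Φ-Adjoin : ∀ F (K⊆F : K₀ ⊆ F) {x z} → z ∈ elements (Adjoin F K⊆F x) → Φ z ∈ elements (Adjoin F K⊆F (Φ x))
  Φ-Adjoin F K⊆F {x} {z} z∈ = let g , e = Adjoin⇒value F K⊆F x z∈ in ≈-closed A (Φ-cong (sym e)) (go g)
    where
    A = Adjoin F K⊆F (Φ x)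
    go : ∀ g → Φ (at F x g) ∈ elements A
    go []      = ≈-closed A (sym Φ-0) (0-closed A)
    go (a ∷ g) = ≈-closed A (sym (trans (Φ-+ _ _) (+-congˡ (Φ-* _ _))))
      (+-closed A (⊆-Adjoin F K⊆F (Φ x) (Φ-closed F (proj₂ a))) (*-closed A (∈-Adjoin F K⊆F (Φ x)) (go g)))

  Φ-Adjoin-⊆ : ∀ F (K⊆F : K₀ ⊆ F) x → Adjoin F K⊆F (Φ x) ⊆ Adjoin F K⊆F x
  Φ-Adjoin-⊆ F K⊆F x = Adjoin-⊆ F K⊆F (Φ x) {Adjoin F K⊆F x} (⊆-Adjoin F K⊆F x) (Φ-closed (Adjoin F K⊆F x) (∈-Adjoin F K⊆F x))

  -- E = K(y) = K(Φ y) is spanned over K by Φ E, so Φ carries a basis of E over K(z)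
  -- to a spanning set over K(Φ z); hence [E : K(Φ z)] ≤ [E : K(z)].
  module _ (K⊆K : K₀ ⊆ K₀) (y : Carrier) (y∈ : y ∈ elements (Adjoin K₀ K⊆K (Φ y))) where

    private
      E : Subfield
      E = Adjoin K₀ K⊆K y

    Adjoin-Φ-closed : ∀ {z} → z ∈ elements E → z ∈ elements (Adjoin K₀ K⊆K (Φ z))
    Adjoin-Φ-closed {z} z∈E = degree-≤⇒⊆ {M = M} {N} {E} (Φ-Adjoin-⊆ K₀ K⊆K z) M⊆E finite-N
        (proj₂ finite-M) (proj₂ finite-N) (basis-≤ {v = Φf} (proj₂ finite-N) spans) (∈-Adjoin K₀ K⊆K z)
      where
      M N : Subfield
      M = Adjoin K₀ K⊆K z
      N = Adjoin K₀ K⊆K (Φ z)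
      finite-E : Finite E K₀
      finite-E = _ , Adjoin-basis K₀ K⊆K y (minimalPolynomial K₀ K⊆K y)
      M⊆E : M ⊆ E
      M⊆E = Adjoin-⊆ K₀ K⊆K z {E} (⊆-Adjoin K₀ K⊆K y) z∈E
      finite-M : Finite E M
      finite-M = finite-over {K₀} {M} {E} (⊆-Adjoin K₀ K⊆K z) finite-E
      finite-N : Finite E N
      finite-N = finite-over {K₀} {N} {E} (⊆-Adjoin K₀ K⊆K (Φ z)) finite-E
      f : Fin (proj₁ finite-M) → Carrier
      f = Basis.vectors (proj₂ finite-M)
      Φf : Fin (proj₁ finite-M) → Carrier
      Φf i = Φ (f i)
      span-Φ : ∀ {u} → u ∈ elements E → Span N Φf (Φ u)
      span-Φ {u} u∈E = let k , e = Basis.spanning (proj₂ finite-M) u∈E in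
        (λ i → Φ (proj₁ (k i)) , Φ-Adjoin K₀ K⊆K (proj₂ (k i))) ,
        trans (Φ-cong e) (trans (Φ-sum (λ i → proj₁ (k i) * f i)) (sum-cong-≋ {proj₁ finite-M} (λ i → Φ-* _ _)))
      -- `Φ u` absorbs the powers of Φ y, as Φ y times Φ u is Φ (y u). Every element of E is a
      -- polynomial in Φ y by hypothesis, so u = 1 reaches them all.
      span-at : ∀ g {u} → u ∈ elements E → Span N Φf (at K₀ (Φ y) g * Φ u)
      span-at []      {u} u∈E = span-≈ N (sym (zeroˡ _)) (span-0 N)
      span-at (a ∷ g) {u} u∈E = span-≈ N (begin
          proj₁ a * Φ u + G * Φ (y * u)            ≈⟨ +-congˡ (*-congˡ (Φ-* y u)) ⟩
          proj₁ a * Φ u + G * (Φ y * Φ u)          ≈⟨ solve 4 (λ a u G y → a :* u :+ G :* (y :* u) := (a :+ y :* G) :* u) refl _ _ _ _ ⟩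
          (proj₁ a + Φ y * G) * Φ u                ∎)
          (span-+ N (span-* N (⊆-Adjoin K₀ K⊆K (Φ z) (proj₂ a)) (span-Φ u∈E))
            (span-at g (*-closed E (∈-Adjoin K₀ K⊆K y) u∈E)))
        where G = at K₀ (Φ y) g
      spans : ∀ {w} → w ∈ elements E → Span N Φf w
      spans w∈E = let g , e = Adjoin⇒value K₀ K⊆K (Φ y) (Adjoin-⊆ K₀ K⊆K y {Adjoin K₀ K⊆K (Φ y)} (⊆-Adjoin K₀ K⊆K (Φ y)) y∈ w∈E) in
        span-≈ N (trans (*-congˡ Φ-1) (trans (*-identityʳ _) (sym e))) (span-at g (1-closed E))

  iterate : ℕ → Carrier → Carrier
  iterate zero    x = x
  iterate (suc n) x = Φ (iterate n x)

  -- In [M : K] = [N : K] [M : N] a second factor above 1 would make [M : K] exceed [N : K].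
  degree-over-base-≤⇒⊆ : ∀ {M N m n} → K₀ ⊆ N → N ⊆ M → Basis M K₀ m → Basis N K₀ n → m ℕ.≤ n → M ⊆ N
  degree-over-base-≤⇒⊆ {M} {N} {m} {n} K⊆N N⊆M B C m≤n = go (finite-over {K₀} {N} {M} K⊆N (m , B)) (ℕ.n≢0⇒n>0 λ { ≡.refl → basis-positive C })
    where
    go : Finite M N → 0 ℕ.< n → M ⊆ N
    go (zero , D) _ = ⊥-elim (basis-positive D)
    go (suc zero , D) _ = degree-1⇒⊆ D
    go (suc (suc k) , D) 0<n = ⊥-elim (ℕ.<-irrefl ≡.refl (ℕ.<-≤-trans (ℕ.m<m*n n (suc (suc k)) {{ℕ.>-nonZero 0<n}} (s≤s (s≤s z≤n)))
      (ℕ.≤-trans (ℕ.≤-reflexive (basis-unique {N = K₀} {M} (tower {N = K₀} {N} {M} N⊆M K⊆N C D) B)) m≤n)))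

  -- The degree of Φⁿ x over K, being minimal for some n, stabilises there.
  eventually-separable : ∀ (K⊆K : K₀ ⊆ K₀) x → ∃ λ n → ∀ {z} → z ∈ elements (Adjoin K₀ K⊆K (iterate n x)) → SeparableOver K₀ z
  eventually-separable K⊆K x = n , λ {z} z∈ → Minimal.separable {K₀} K⊆K (mp z) (Adjoin-Φ-closed K⊆K y y∈ z∈)
    where
    mp : ∀ z → MinimalPolynomial K₀ z
    mp z = minimalPolynomial K₀ K⊆K z
    deg : Carrier → ℕ
    deg z = MinimalPolynomial.degree (mp z)
    smallest : ∃ λ d → (∃ λ n → deg (iterate n x) ≡ d) × (∀ k → k ℕ.< d → ¬ ∃ λ n → deg (iterate n x) ≡ k)
    smallest = least em (λ d → ∃ λ n → deg (iterate n x) ≡ d) (_ , 0 , ≡.refl)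
    n = proj₁ (proj₁ (proj₂ smallest))
    y = iterate n x
    y∈ : y ∈ elements (Adjoin K₀ K⊆K (Φ y))
    y∈ = degree-over-base-≤⇒⊆ {Adjoin K₀ K⊆K y} {Adjoin K₀ K⊆K (Φ y)} (⊆-Adjoin K₀ K⊆K (Φ y)) (Φ-Adjoin-⊆ K₀ K⊆K y)
      (Adjoin-basis K₀ K⊆K y (mp y)) (Adjoin-basis K₀ K⊆K (Φ y) (mp (Φ y)))
      (ℕ.≮⇒≥ λ lt → proj₂ (proj₂ smallest) _ (≡.subst (deg (Φ y) ℕ.<_) (proj₂ (proj₁ (proj₂ smallest))) lt) (suc n , ≡.refl))
      (∈-Adjoin K₀ K⊆K y)

  iterate-closed : ∀ F n {x} → x ∈ elements F → iterate n x ∈ elements F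
  iterate-closed F zero    x∈F = x∈F
  iterate-closed F (suc n) x∈F = Φ-closed F (iterate-closed F n x∈F)

  -- Embeddings commute with Φ, so injectivity of Φ removes one application at a time. This is the
  -- uniqueness of embeddings in the purely inseparable direction.
  agree-iterate : ∀ {L} (τ υ : Hom L) n {x} (x∈L : x ∈ elements L) →
    fun τ (iterate n x , iterate-closed L n x∈L) ≈ fun υ (iterate n x , iterate-closed L n x∈L) → fun τ (x , x∈L) ≈ fun υ (x , x∈L)
  agree-iterate τ υ zero    x∈L e = e
  agree-iterate {L} τ υ (suc n) x∈L e = agree-iterate τ υ n x∈L (Φ-injective
    (trans (sym (Φ-hom τ (iterate-closed L n x∈L) (iterate-closed L (suc n) x∈L)))
      (trans e (Φ-hom υ (iterate-closed L n x∈L) (iterate-closed L (suc n) x∈L)))))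

-- Finite sets and finite setoids.

module FiniteSets (em : ∀ {a} → ExcludedMiddle a) where

  bijection-unique : ∀ {a b m n} {S : Setoid a b} → Bijection (≡-setoid (Fin m)) S → Bijection (≡-setoid (Fin n)) S → m ≡ n
  bijection-unique {S = S} B C = ℕ.≤-antisym (≤-from B C) (≤-from C B)
    where
    open Setoid S
    ≤-from : ∀ {m n} → Bijection (≡-setoid (Fin m)) S → Bijection (≡-setoid (Fin n)) S → m ℕ.≤ n
    ≤-from B C = Fin.injective⇒≤ {f = λ i → proj₁ (C.surjective (B.to i))} λ {i} {j} e →
        B.injective (trans (sym (proj₂ (C.surjective (B.to i)) ≡.refl)) (trans (C.cong e) (proj₂ (C.surjective (B.to j)) ≡.refl)))
      where
      module B = Bijection B
      module C = Bijection C

  -- A missed value could be punched out, giving an injection into a smaller `Fin`.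
  injective⇒surjective : ∀ {n} (f : Fin n → Fin n) → (∀ i j → f i ≡ f j → i ≡ j) → ∀ j → ∃ λ i → f i ≡ j
  injective⇒surjective {suc n} f inj j = dne em λ none →
    let avoids : ∀ i → j ≢ f i
        avoids i j≡fi = none (i , ≡.sym j≡fi)
    in ℕ.<-irrefl ≡.refl (Fin.injective⇒≤ {f = λ i → punchOut (avoids i)} λ {i} {i′} e →
         inj i i′ (Fin.punchOut-injective (avoids i) (avoids i′) e))

  injective⇒permutation : ∀ {n} (f : Fin n → Fin n) → (∀ i j → f i ≡ f j → i ≡ j) → Permutation n n
  injective⇒permutation f inj = permutation f (λ j → proj₁ (onto j)) (λ j → proj₂ (onto j)) (λ i → inj _ _ (proj₂ (onto (f i))))
    where onto = injective⇒surjective f inj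

  module _ {a b} (S : Setoid a b) where
    open Setoid S

    private
      Represents : ∀ {r m} → (Fin m → Carrier → Set r) → Set _
      Represents R = ∃ λ k → ∃ λ (g : Fin k → Carrier) → (∀ i j → g i ≈ g j → i ≡ j) × (∀ {i s} → R i s → ∃ λ j → g j ≈ s)

      represent : ∀ {r} m (R : Fin m → Carrier → Set r) → (∀ {i s t} → R i s → R i t → s ≈ t) → Represents R
      represent zero    R single = 0 , (λ ()) , (λ ()) , λ { {()} }
      represent (suc m) R single with represent m (R ∘ suc) single
      ... | k , g , inj , hits with em {P = ∃ λ s → R zero s × ¬ ∃ λ j → g j ≈ s}
      ...   | no none = k , g , inj , λ
                { {zero}  r → dne em λ missed → none (_ , r , missed)
                ; {suc i} r → hits r }
      ...   | yes (s , r , missed) = suc k , g′ , inj′ , hits′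
        where
        g′ : Fin (suc k) → Carrier
        g′ zero    = s
        g′ (suc j) = g j
        inj′ : ∀ i j → g′ i ≈ g′ j → i ≡ j
        inj′ zero    zero    e = ≡.refl
        inj′ zero    (suc j) e = ⊥-elim (missed (j , sym e))
        inj′ (suc i) zero    e = ⊥-elim (missed (i , e))
        inj′ (suc i) (suc j) e = ≡.cong suc (inj i j e)
        hits′ : ∀ {i t} → R i t → ∃ λ j → g′ j ≈ t
        hits′ {zero}  r′ = zero , single r r′
        hits′ {suc i} r′ = let j , e = hits r′ in suc j , e

    -- `R` is a partial function from indices onto `S`, given as a relation because it is undecided
    -- which indices have a value; `represent` keeps those whose value is new.
    finite : ∀ {r m} (R : Fin m → Carrier → Set r) → (∀ {i s t} → R i s → R i t → s ≈ t) → (∀ s → ∃ λ i → R i s) →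
             ∃ λ k → Bijection (≡-setoid (Fin k)) S
    finite {m = m} R single total = let k , g , inj , hits = represent m R single in
      k , record
        { to        = g
        ; cong      = λ { ≡.refl → refl }
        ; bijective = (λ {i} {j} → inj i j) , λ s → let j , e = hits (proj₂ (total s)) in j , λ { ≡.refl → e }
        }

-- Normality as stability under embeddings, and automorphisms.

module Normality (em : ∀ {a} → ExcludedMiddle a) {c ℓ} {K : Field c ℓ} (K̄ : AlgebraicClosure K)
  (frob : FrobeniusMap.Frobenius em (AlgebraicClosure.Ω K̄) (AlgebraicClosure.algebraicallyClosed K̄)) where
  open AlgebraicClosure K̄ using (Ω; algebraicallyClosed) renaming (base to K₀)
  open Subfields Ω hiding (zero)
  open Over K₀
  open LinearAlgebra em Ω
  open Polynomials em Ω algebraicallyClosed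
  open Extensions em K̄
  open Counting em K̄
  open Separability em K̄ frob
  open Relation.Binary.Reasoning.Setoid setoid
  open PolynomialsOver
  open Spans

  Stable : (L N : Subfield) → Set (c ⊔ ℓ)
  Stable L N = ∀ (σ : Hom L) → Extends σ (incl N) → ∀ z → fun σ z ∈ elements L

  stable-mono : ∀ {L N M} → N ⊆ M → Stable L N → Stable L M
  stable-mono N⊆M s σ ext = s σ (λ p q → ext (N⊆M p) q)

  any-∈ : ∀ L {as y} → All (elements L) as → Any (y ≈_) as → y ∈ elements L
  any-∈ L (a∈L ∷ _)  (here y≈a) = ≈-closed L (sym y≈a) a∈L
  any-∈ L (_ ∷ as∈L) (there i)  = any-∈ L as∈L i

  -- The image of x is again a root of the minimal polynomial of x over N, which splits in L.
  normal⇒stable : ∀ {L N} → K₀ ⊆ N → N ⊆ L → Normal L N → Stable L N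
  normal⇒stable {L} {N} K⊆N N⊆L (_ , split) σ ext (x , x∈L) =
      any-∈ L as∈L (prod-root (integral (trans (sym (f≈prod _)) σx-root) k≉0))
    where
    m = minimalPolynomial N K⊆N x
    open MinimalPolynomial m
    open Minimal {N} K⊆N m
    splits : SplitsIn L (toΩ N polynomial)
    splits = split polynomial irreducible x x∈L (proj₂ (proj₂ isMinimalPolynomial))
    k = proj₁ splits
    as = proj₁ (proj₂ splits)
    as∈L = proj₁ (proj₂ (proj₂ (proj₂ splits)))
    f≈prod : ∀ y → monicAt N (incl N) coeffs y ≈ k * prod as y
    f≈prod y = trans (sym (polynomial-at (incl N) y)) (trans (reflexive (at≡ N y polynomial))
      (trans (≈ₚ⇒≗ₚ (toΩ N polynomial) ((k ∷ []) *ₚ linearProduct as) (proj₂ (proj₂ (proj₂ (proj₂ splits)))) y) (eval-scaledProduct k as y)))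
    k≉0 : k ≉ 0#
    k≉0 k≈0 = monic≉0 N coeffs λ y → trans (f≈prod y) (trans (*-congʳ k≈0) (zeroˡ _))
    σx-root : monicAt N (incl N) coeffs (fun σ (x , x∈L)) ≈ 0#
    σx-root = hom-monicRoot {L} {N} σ (incl N) N⊆L ext x∈L coeffs root

  -- Sending x to the root embeds N(x) over N, and this embedding extends to L because L/N is
  -- finite.
  stable⇒root∈ : ∀ {L N} (K⊆N : K₀ ⊆ N) → N ⊆ L → Finite L N → Stable L N → ∀ {x} → x ∈ elements L →
                 ∀ {y} → monicAt N (incl N) (MinimalPolynomial.coeffs (minimalPolynomial N K⊆N x)) y ≈ 0# →
                 ∃ λ (τ : Hom L) → Extends τ (incl N) × (∀ q → fun τ (x , q) ≈ y)
  stable⇒root∈ {L} {N} K⊆N N⊆L fin stable {x} x∈L {y} e =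
      τ , extends-trans τ υ (incl N) (⊆-Adjoin N K⊆N x) τ-extends (extendRoot-extends N K⊆N x m (incl N) e) ,
      λ q → trans (τ-extends (∈-Adjoin N K⊆N x) q) (extendRoot-root N K⊆N x m (incl N) e (∈-Adjoin N K⊆N x))
    where
    m = minimalPolynomial N K⊆N x
    A : Subfield
    A = Adjoin N K⊆N x
    υ : Hom A
    υ = extendRoot N K⊆N x m (incl N) e
    extension : ∃ λ (τ : Hom L) → Extends τ υ
    extension = extend A L (⊆-Adjoin N K⊆N x ∘ K⊆N) (Adjoin-⊆ N K⊆N x {L} N⊆L x∈L) (finite-over {N} {A} {L} (⊆-Adjoin N K⊆N x) fin) υ
    τ = proj₁ extension
    τ-extends = proj₂ extension

  -- An irreducible p with a root x in L is a unit times the minimal polynomial of x, whose roots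
  -- are images of x under embeddings of L over N and so lie in L.
  stable⇒normal : ∀ {L N} → K₀ ⊆ N → N ⊆ L → Finite L N → Stable L N → Normal L N
  stable⇒normal {L} {N} K⊆N N⊆L fin stable = algebraic-over , splitting
    where
    algebraic-over : ∀ {x} → x ∈ elements L → AlgebraicOver N x
    algebraic-over {x} x∈L = polynomial ,
        (λ z → monic≉0 N coeffs λ y → trans (sym (polynomial-at (incl N) y)) (≈⇒at N polynomial [] z y)) ,
        proj₂ (proj₂ isMinimalPolynomial)
      where
      open MinimalPolynomial (minimalPolynomial N K⊆N x)
      open Minimal {N} K⊆N (minimalPolynomial N K⊆N x)
    splitting : ∀ p → PolyOver.Irreducible N p → ∀ x → x ∈ elements L → Root N p x → SplitsIn L (toΩ N p)
    splitting p irr x x∈L px≈0 = split (trim N p)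
      where
      m = minimalPolynomial N K⊆N x
      open MinimalPolynomial m
      open Minimal {N} K⊆N m using (polynomial; polynomial-at; constant-at; 1ᶠ)
      module P = PolyOver N
      quotient = divides p (trans (reflexive (at≡ N x p)) px≈0)
      q = proj₁ quotient
      p≈fq : ∀ y → at N y p ≈ monicAt N (incl N) coeffs y * at N y q
      p≈fq = proj₂ quotient (incl N)
      q-unit : ∃ λ w → ∀ y → at N y w * at N y q ≈ 1#
      -- The minimal polynomial has the root x and so is no unit; irreducibility leaves q.
      q-unit = [ (λ d → ⊥-elim (no-unit (RawMagmaDefinitions._∣ʳ_.quotient d) (RawMagmaDefinitions._∣ʳ_.equality d)))
               , (λ d → unit-at (RawMagmaDefinitions._∣ʳ_.quotient d) (RawMagmaDefinitions._∣ʳ_.equality d)) ]′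
               (RawSemiringDefinitions.Irreducible.split-∣1 irr {polynomial} {q} (at⇒≈ N p (polynomial P.*ₚ q) λ y → trans (p≈fq y)
                 (trans (*-congʳ (sym (polynomial-at (incl N) y))) (sym (Ev.ev-* N (incl N) y polynomial q)))))
        where
        unit-at : ∀ w → P._≈ₚ_ (w P.*ₚ q) (1ᶠ ∷ []) → ∃ λ w → ∀ y → at N y w * at N y q ≈ 1#
        unit-at w e = w , λ y → trans (sym (Ev.ev-* N (incl N) y w q)) (trans (≈⇒at N (w P.*ₚ q) (1ᶠ ∷ []) e y) (constant-at y))
        no-unit : ∀ w → ¬ P._≈ₚ_ (w P.*ₚ polynomial) (1ᶠ ∷ [])
        no-unit w e = 1≉0 (trans (sym (trans (≈⇒at N (w P.*ₚ polynomial) (1ᶠ ∷ []) e x) (constant-at x)))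
          (trans (Ev.ev-* N (incl N) x w polynomial) (trans (*-congˡ (trans (polynomial-at (incl N) x) root)) (zeroʳ _))))
      root∈L : ∀ {y} → at N y p ≈ 0# → y ∈ elements L
      root∈L {y} py≈0 = let τ , ext , τx≈y = stable⇒root∈ {L} {N} K⊆N N⊆L fin stable x∈L f-root in
          ≈-closed L (τx≈y x∈L) (stable τ ext (x , x∈L))
        where
        f-root : monicAt N (incl N) coeffs y ≈ 0#
        f-root = integral (trans (*-comm _ _) (trans (sym (p≈fq y)) py≈0)) λ qy≈0 →
          1≉0 (trans (sym (proj₂ q-unit y)) (trans (*-congˡ qy≈0) (zeroʳ _)))
      split : AllZero N p ⊎ (∃ λ (k : Elt N) → proj₁ k ≉ 0# × ∃ λ r → length r ℕ.< length p ×
              (∀ σ y → ev σ y p ≈ fun σ k * monicAt N σ r y)) → SplitsIn L (toΩ N p)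
      -- As q is invertible, p = 0 would make the minimal polynomial vanish.
      split (inj₁ z) = ⊥-elim (monic≉0 N coeffs λ y → begin
        monicAt N (incl N) coeffs y                                              ≈⟨ *-identityʳ _ ⟨
        monicAt N (incl N) coeffs y * 1#                                         ≈⟨ *-congˡ (proj₂ q-unit y) ⟨
        monicAt N (incl N) coeffs y * (at N y (proj₁ q-unit) * at N y q)         ≈⟨ solve 3 (λ f w q → f :* (w :* q) := w :* (f :* q)) refl _ _ _ ⟩
        at N y (proj₁ q-unit) * (monicAt N (incl N) coeffs y * at N y q)         ≈⟨ *-congˡ (trans (sym (p≈fq y)) (allZero⇒ev N z (incl N) y)) ⟩
        at N y (proj₁ q-unit) * 0#                                               ≈⟨ zeroʳ _ ⟩
        0#                                                                       ∎)
      split (inj₂ ((k , k∈N) , k≉0 , r , _ , e)) = k , bs , N⊆L k∈N , All.tabulate (λ b∈bs → root∈L (trans (p≈prod _)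
            (trans (*-congˡ (root-prod (Any.map reflexive b∈bs))) (zeroʳ _)))) ,
          ≗ₚ⇒≈ₚ (toΩ N p) ((k ∷ []) *ₚ linearProduct bs)
            (λ y → trans (reflexive (≡.sym (at≡ N y p))) (trans (p≈prod y) (sym (eval-scaledProduct k bs y))))
        where
        bs = proj₁ (monic-factor N r)
        p≈prod : ∀ y → at N y p ≈ k * prod bs y
        p≈prod y = trans (e (incl N) y) (*-congˡ (proj₂ (monic-factor N r) y))

  hom-of : ∀ {L E} → KIso L E → Hom L
  hom-of κ = mkHom (λ z → proj₁ (KIso.to κ z)) (λ _ _ → KIso.⟦⟧-cong κ) (KIso.+-homo κ) (KIso.*-homo κ) (KIso.1#-homo κ)

  hom-of-extends : ∀ {L E} (κ : KIso L E) → Extends (hom-of κ) (incl K₀)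
  hom-of-extends κ p q = KIso.fixesK κ (_ , q) p

  isoOnto : ∀ {L} E (τ : Hom L) → Extends τ (incl K₀) → (∀ z → fun τ z ∈ elements E) →
            (∀ {w} → w ∈ elements E → ∃ λ z → fun τ z ≈ w) → KIso L E
  isoOnto {L} E τ ext into onto = record
    { to = λ z → fun τ z , into z
    ; isRingIsomorphism = record
      { isRingMonomorphism = record
        { isRingHomomorphism = record
          { isSemiringHomomorphism = record
            { isNearSemiringHomomorphism = record
              { +-isMonoidHomomorphism = record
                { isMagmaHomomorphism = record
                  { isRelHomomorphism = record { cong = Hom.⟦⟧-cong τ }
                  ; homo              = Hom.+-homo τ
                  }
                ; ε-homo = Hom.0#-homo τ
                }
              ; *-homo = Hom.*-homo τ
              }
            ; 1#-homo = Hom.1#-homo τ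
            }
          ; -‿homo = Hom.-‿homo τ
          }
        ; injective = λ {x} {y} → hom-injective τ x y
        }
      ; surjective = λ (w , w∈E) → let z , e = onto w∈E in z , λ z′≈z → trans (Hom.⟦⟧-cong τ z′≈z) e
      }
    ; fixesK = λ (x , q) p → ext p q
    }

  onto : ∀ {L E} (κ : KIso L E) {w} → w ∈ elements E → ∃ λ z → fun (hom-of κ) z ≈ w
  onto κ w∈E = let z , e = KIso.surjective κ (_ , w∈E) in z , e refl

  hom-combination : ∀ {L} (K⊆L : K₀ ⊆ L) (τ : Hom L) → Extends τ (incl K₀) → ∀ {n} (k : Fin n → Elt K₀) (v : Fin n → Elt L)
    (q : combination K₀ k (proj₁ ∘ v) ∈ elements L) → fun τ (combination K₀ k (proj₁ ∘ v) , q) ≈ combination K₀ k (fun τ ∘ v)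
  hom-combination K⊆L τ ext {zero} k v q = trans (Hom.⟦⟧-cong τ refl) (Hom.0#-homo τ)
  hom-combination {L} K⊆L τ ext {suc n} k v q = trans (Hom.⟦⟧-cong τ refl)
      (trans (Hom.+-homo τ (_ , *-closed L (K⊆L (proj₂ (k zero))) (proj₂ (v zero))) (_ , rest))
        (+-cong (trans (Hom.*-homo τ (_ , K⊆L (proj₂ (k zero))) (v zero)) (*-congʳ (ext (proj₂ (k zero)) (K⊆L (proj₂ (k zero))))))
          (hom-combination {L} K⊆L τ ext (k ∘ suc) (v ∘ suc) rest)))
    where
    rest : combination K₀ (k ∘ suc) (λ i → proj₁ (v (suc i))) ∈ elements L
    rest = combination∈ L (λ i → lift {K₀} {L} K⊆L (k (suc i))) (λ i → proj₂ (v (suc i)))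

  -- τ is K-linear and injective, so it carries a basis to independent vectors of L; an element
  -- outside their span would give one independent vector too many.
  endomorphism-onto : ∀ {L} (K⊆L : K₀ ⊆ L) → Finite L K₀ → (τ : Hom L) → Extends τ (incl K₀) → (∀ z → fun τ z ∈ elements L) →
                      ∀ {w} → w ∈ elements L → ∃ λ z → fun τ z ≈ w
  endomorphism-onto {L} K⊆L (n , B) τ ext into {w} w∈L =
      let k , e = spans in (_ , inside k) , trans (hom-combination {L} K⊆L τ ext k v (inside k)) (sym e)
    where
    v : Fin n → Elt L
    v i = Basis.vectors B i , Basis.inL B i
    inside : ∀ k → combination K₀ k (λ i → proj₁ (v i)) ∈ elements L
    inside k = combination∈ L (λ i → lift {K₀} {L} K⊆L (k i)) (λ i → proj₂ (v i))
    independent : Independent K₀ (λ i → fun τ (v i))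
    independent k e = Basis.independent B k (dne em λ c≉0 →
      hom-≉0 τ (combination K₀ k (λ i → proj₁ (v i)) , inside k) c≉0 (trans (hom-combination {L} K⊆L τ ext k v (inside k)) e))
    spans : Span K₀ (λ i → fun τ (v i)) w
    spans = dne em λ w∉ → ℕ.<-irrefl ≡.refl (independent-≤ K₀ {u = w ∷ᵛ (λ i → fun τ (v i))} (independent-cons K₀ independent w∉)
      λ { zero → Basis.spanning B w∈L ; (suc i) → Basis.spanning B (into (v i)) })

  automorphism : ∀ {L} → K₀ ⊆ L → Finite L K₀ → (τ : Hom L) → Extends τ (incl K₀) → (∀ z → fun τ z ∈ elements L) → KIso L L
  automorphism {L} K⊆L fin τ ext into = isoOnto {L} L τ ext into (endomorphism-onto {L} K⊆L fin τ ext into)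

-- The field `N′`, the automorphisms and conjugates of L, and the degree formulas.

module Main (em : ∀ {a} → ExcludedMiddle a) {c ℓ} {K : Field c ℓ} (K̄ : AlgebraicClosure K)
  (frob : FrobeniusMap.Frobenius em (AlgebraicClosure.Ω K̄) (AlgebraicClosure.algebraicallyClosed K̄)) where
  open AlgebraicClosure K̄ using (Ω; algebraicallyClosed) renaming (base to K₀)
  open Subfields Ω hiding (zero)
  open Over K₀
  open Invariants em
  open LinearAlgebra em Ω
  open Polynomials em Ω algebraicallyClosed
  open Extensions em K̄
  open Counting em K̄
  open Separability em K̄ frob
  open Normality em K̄ frob
  open FiniteSets em
  open Relation.Binary.Reasoning.Setoid setoid
  open PolynomialsOver
  open Algebra.Properties.Ring ring using (+-cancelʳ)
  private
    module Π = Algebra.Properties.CommutativeMonoid.Sum *-commutativeMonoid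

  compose : ∀ {L E} → Hom E → KIso L E → Hom L
  compose τ κ = mkHom (λ z → fun τ (KIso.to κ z)) (λ _ _ e → Hom.⟦⟧-cong τ (KIso.⟦⟧-cong κ e))
    (λ x y → trans (Hom.⟦⟧-cong τ (KIso.+-homo κ x y)) (Hom.+-homo τ (KIso.to κ x) (KIso.to κ y)))
    (λ x y → trans (Hom.⟦⟧-cong τ (KIso.*-homo κ x y)) (Hom.*-homo τ (KIso.to κ x) (KIso.to κ y)))
    (trans (Hom.⟦⟧-cong τ (KIso.1#-homo κ)) (Hom.1#-homo τ))

  compose-extends : ∀ {L E} → K₀ ⊆ E → (τ : Hom E) (κ : KIso L E) → Extends τ (incl K₀) → Extends (compose τ κ) (incl K₀)
  compose-extends K⊆E τ κ ext p q = trans (fun-cong τ (KIso.fixesK κ (_ , q) p) (proj₂ (KIso.to κ (_ , q))) (K⊆E p)) (ext p (K⊆E p))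

  rangeField : ∀ {L} → Hom L → Subfield
  rangeField {L} τ = record
    { elements  = λ w → ∃ λ z → fun τ z ≈ w
    ; ≈-closed  = λ { x≈y (z , e) → z , trans e x≈y }
    ; 0-closed  = _ , Hom.0#-homo τ
    ; 1-closed  = _ , Hom.1#-homo τ
    ; +-closed  = λ { (u , e) (v , f) → _ , trans (Hom.+-homo τ u v) (+-cong e f) }
    ; *-closed  = λ { (u , e) (v , f) → _ , trans (Hom.*-homo τ u v) (*-cong e f) }
    ; -‿closed  = λ { (u , e) → _ , trans (Hom.-‿homo τ u) (-‿cong e) }
    ; ⁻¹-closed = λ { {x} {y} ((u , u∈L) , e) xy≈1 →
        let u≉0 : u ≉ 0#
            u≉0 u≈0 = 1≉0 (trans (sym xy≈1) (trans (*-congʳ (trans (sym e) (trans (Hom.⟦⟧-cong τ u≈0) (Hom.0#-homo τ)))) (zeroˡ y)))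
            v , v∈L , uv≈1 = inverseIn L u∈L u≉0
        in (v , v∈L) , (begin
          fun τ (v , v∈L)                                   ≈⟨ *-identityʳ _ ⟨
          fun τ (v , v∈L) * 1#                              ≈⟨ *-congˡ xy≈1 ⟨
          fun τ (v , v∈L) * (x * y)                         ≈⟨ *-congˡ (*-congʳ e) ⟨
          fun τ (v , v∈L) * (fun τ (u , u∈L) * y)           ≈⟨ solve 3 (λ v u y → v :* (u :* y) := (u :* v) :* y) refl _ _ _ ⟩
          (fun τ (u , u∈L) * fun τ (v , v∈L)) * y           ≈⟨ *-congʳ (Hom.*-homo τ (u , u∈L) (v , v∈L)) ⟨
          fun τ (u * v , *-closed L u∈L v∈L) * y            ≈⟨ *-congʳ (trans (Hom.⟦⟧-cong τ uv≈1) (Hom.1#-homo τ)) ⟩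
          1# * y                                            ≈⟨ *-identityˡ y ⟩
          y                                                 ∎) }
    }

  prod-tabulate : ∀ {a} {A : Set a} (φ : A → Carrier) {n} (f : Fin n → A) y →
                  prod (List.map φ (List.tabulate f)) y ≈ Π.sum (λ i → y + - φ (f i))
  prod-tabulate φ {zero}  f y = refl
  prod-tabulate φ {suc n} f y = *-congˡ (prod-tabulate φ (f ∘ suc) y)

  coefficients-agree : ∀ {F} (τ υ : Hom F) r → (∀ y → ev τ y r ≈ ev υ y r) → All (λ a → fun τ a ≈ fun υ a) r
  coefficients-agree {F} τ υ r e = go r (≗ₚ⇒≈ₚ (List.map (fun τ) r) (List.map (fun υ) r) λ y →
      trans (reflexive (≡.sym (evalBy-map (fun τ) y r))) (trans (e y) (reflexive (evalBy-map (fun υ) y r))))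
    where
    go : ∀ r → List.map (fun τ) r ≈ₚ List.map (fun υ) r → All (λ a → fun τ a ≈ fun υ a) r
    go []      e = []
    go (a ∷ r) e = e 0 ∷ go r (e ∘ suc)

  the-≡ : ∀ {a} {P : ℕ → Set a} {n} → P n → (∀ {m} → P m → m ≡ n) → the P ≡ n
  the-≡ {P = P} p unique with em {P = ∃ P}
  ... | yes (_ , q) = unique q
  ... | no none     = ⊥-elim (none (_ , p))

  index-≡ : ∀ {L N n} → Basis L N n → [ L ∶ N ] ≡ n
  index-≡ {L} {N} B = the-≡ {P = Basis L N} B (λ C → basis-unique {N = N} {L} C B)

  cardinality-≡ : ∀ {a b n} {S : Setoid a b} → Bijection (≡-setoid (Fin n)) S → ∣ S ∣ ≡ n
  cardinality-≡ {S = S} B = the-≡ {P = λ n → Bijection (≡-setoid (Fin n)) S} B (λ C → bijection-unique {S = S} C B)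

  descendingNormalIndex-≡ : ∀ {L d} → IsDescendingNormalIndex L d → descendingNormalIndex L ≡ d
  descendingNormalIndex-≡ {L} {d} D@((N , sub , normal , e) , bound) = the-≡ {P = IsDescendingNormalIndex L} D
    λ { ((M , sub′ , normal′ , ≡.refl) , bound′) →
      ℕ.≤-antisym (bound M sub′ normal′) (ℕ.≤-trans (ℕ.≤-reflexive (≡.sym e)) (bound′ N sub normal)) }

  module _ (L L_S : Subfield) (K⊆L : K₀ ⊆ L) (fin : Finite L K₀) (maximal : IsMaximalSeparableSubextension L_S L) where

    private
      K⊆S : K₀ ⊆ L_S
      K⊆S = proj₁ (proj₁ maximal)

      S⊆L : L_S ⊆ L
      S⊆L = proj₂ (proj₁ maximal)

      Lᴬ : Subfield
      Lᴬ = fixedField L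

      fixed⊆L : Lᴬ ⊆ L
      fixed⊆L = proj₁

      K⊆K : K₀ ⊆ K₀
      K⊆K p = p

      K⊆fixed : K₀ ⊆ Lᴬ
      K⊆fixed p = K⊆L p , λ σ → KIso.fixesK σ (_ , K⊆L p) p

    N′ : Subfield
    N′ = record
      { elements  = λ z → z ∈ elements L_S × z ∈ elements Lᴬ
      ; ≈-closed  = λ { e (p , q) → ≈-closed L_S e p , ≈-closed Lᴬ e q }
      ; 0-closed  = 0-closed L_S , 0-closed Lᴬ
      ; 1-closed  = 1-closed L_S , 1-closed Lᴬ
      ; +-closed  = λ { (p , q) (p′ , q′) → +-closed L_S p p′ , +-closed Lᴬ q q′ }
      ; *-closed  = λ { (p , q) (p′ , q′) → *-closed L_S p p′ , *-closed Lᴬ q q′ }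
      ; -‿closed  = λ { (p , q) → -‿closed L_S p , -‿closed Lᴬ q }
      ; ⁻¹-closed = λ { (p , q) e → ⁻¹-closed L_S p e , ⁻¹-closed Lᴬ q e }
      }

    private
      K⊆N′ : K₀ ⊆ N′
      K⊆N′ p = K⊆S p , K⊆fixed p

      N′⊆L : N′ ⊆ L
      N′⊆L p = S⊆L (proj₁ p)

      N′⊆S : N′ ⊆ L_S
      N′⊆S = proj₁

      finite-above : ∀ N → K₀ ⊆ N → Finite L N
      finite-above N K⊆N = finite-over {K₀} {N} {L} K⊆N fin

      finite-S : Finite L_S K₀
      finite-S = finite-sub {K₀} {L_S} {L} S⊆L fin

      simple : ∀ {x} → x ∈ elements L_S → SimpleAlgebraic x
      simple x∈S = separable⇒simple (proj₁ (proj₂ maximal) x∈S)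

    -- For a suitable n the field K(Φⁿ x) is a separable subextension of L, so the maximality of
    -- `L_S` applies to it.
    purely-inseparable : ∀ {x} → x ∈ elements L → ∃ λ n → iterate n x ∈ elements L_S
    purely-inseparable {x} x∈L = let n , separable = eventually-separable K⊆K x in
      n , proj₂ (proj₂ maximal) (Adjoin K₀ K⊆K (iterate n x))
        (⊆-Adjoin K₀ K⊆K (iterate n x) , Adjoin-⊆ K₀ K⊆K (iterate n x) {L} K⊆L (iterate-closed L n x∈L)) separable
        (∈-Adjoin K₀ K⊆K (iterate n x))

    agree-on-L : (τ υ : Hom L) → (∀ {z} → z ∈ elements L_S → (q : z ∈ elements L) → fun τ (z , q) ≈ fun υ (z , q)) → τ ≈ₕ υ
    agree-on-L τ υ e (x , x∈L) = let n , x^∈S = purely-inseparable x∈L in agree-iterate τ υ n x∈L (e x^∈S (iterate-closed L n x∈L))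

    -- An embedding of L_S extends to L by `extend`, and in only one way by `agree-on-L`; hence the
    -- count is [L_S : F].
    embeddings : ∀ F → K₀ ⊆ F → F ⊆ L_S → ∀ {n} → Basis L_S F n → ExtensionsTo L (incl F) n
    embeddings F K⊆F F⊆S {n} B = record
      { hom       = λ i → proj₁ (extended i)
      ; extends   = λ i → extends-trans (proj₁ (extended i)) (S.hom i) (incl F) F⊆S (proj₂ (extended i)) (S.extends i)
      ; injective = λ i j e → S.injective i j λ { (z , p) →
          trans (sym (proj₂ (extended i) p (S⊆L p))) (trans (e (z , S⊆L p)) (proj₂ (extended j) p (S⊆L p))) }
      ; complete  = λ τ ext →
          let i , e = S.complete (restrict {L} {L_S} S⊆L τ) (λ p q → ext p (S⊆L q))
          in i , agree-on-L (proj₁ (extended i)) τ λ {z} p q →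
               trans (proj₂ (extended i) p q) (trans (e (z , p)) (fun-cong τ refl (S⊆L p) q))
      }
      where
      module S = ExtensionsTo (extensions {L_S} simple F K⊆F F⊆S (n , B) n B (incl F) (λ _ _ → refl))
      extended : ∀ i → ∃ λ (τ : Hom L) → Extends τ (S.hom i)
      extended i = extend L_S L K⊆S S⊆L (finite-above L_S K⊆S) (S.hom i)

    private
      nS : ℕ
      nS = proj₁ finite-S

    module H = ExtensionsTo (embeddings K₀ K⊆K K⊆S (proj₂ finite-S))

    automorphisms : ∃ λ r → Bijection (≡-setoid (Fin r)) (Aut L)
    automorphisms = finite (Aut L) (λ i α → H.hom i ≈ₕ hom-of α) (λ e f z → trans (sym (e z)) (f z))
      (λ α → H.complete (hom-of α) (hom-of-extends α))

    -- An isomorphism of L onto a conjugate is an embedding of L over K, and equal embeddings have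
    -- equal ranges.
    conjugates : ∃ λ s → Bijection (≡-setoid (Fin s)) (Conjugates L)
    conjugates = finite (Conjugates L) (λ i (_ , _ , κ) → H.hom i ≈ₕ hom-of κ)
      (λ { {_} {E , _ , κ} {E′ , _ , κ′} e f →
        (λ w∈E → let z , κz≈w = onto κ w∈E in ≈-closed E′ (trans (sym (f z)) (trans (e z) κz≈w)) (proj₂ (KIso.to κ′ z))) ,
        (λ w∈E′ → let z , κ′z≈w = onto κ′ w∈E′ in ≈-closed E (trans (sym (e z)) (trans (f z) κ′z≈w)) (proj₂ (KIso.to κ z))) })
      (λ (_ , _ , κ) → H.complete (hom-of κ) (hom-of-extends κ))

    private
      r s : ℕ
      r = proj₁ automorphisms
      s = proj₁ conjugates
      module A = Bijection (proj₂ automorphisms)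
      module C = Bijection (proj₂ conjugates)

      index : (α : KIso L L) → ∃ λ i → ∀ z → fun (hom-of (A.to i)) z ≈ fun (hom-of α) z
      index α = let i , e = A.surjective α in i , e ≡.refl

      compose-automorphism : KIso L L → KIso L L → KIso L L
      compose-automorphism α β = automorphism {L} K⊆L fin (compose (hom-of α) β)
        (compose-extends {L} {L} K⊆L (hom-of α) β (hom-of-extends α)) (λ z → proj₂ (KIso.to α (KIso.to β z)))

    -- σ fixes L^A since Φⁿ carries L^A into N′, and σ x is a root of the orbit
    -- polynomial of x, whose coefficients lie in L^A.
    module _ (σ : Hom L) (σ-extends : Extends σ (incl N′)) where

      fixes-fixed : Extends σ (incl Lᴬ)
      fixes-fixed {z} z∈A q = let n , z^∈S = purely-inseparable q in
        agree-iterate σ (incl L) n q (σ-extends (z^∈S , iterate-closed Lᴬ n z∈A) (iterate-closed L n q))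

      module _ (x : Elt L) where
        private
          -- The list runs over all of A and repeats values when x has a nontrivial stabiliser; what
          -- counts is that its product is invariant and that its roots lie in L.
          orbit : List (Elt L)
          orbit = List.tabulate (λ i → KIso.to (A.to i) x)

          expanded : ∃ λ q → length q ≡ length orbit × (∀ (τ : Hom L) y → ev τ y q + y ^ length orbit ≈ prod (List.map (fun τ) orbit) y)
          expanded = expand L orbit

          q : List (Elt L)
          q = proj₁ expanded

          -- Left multiplication by α on the indices of A; being injective, it is a permutation, so
          -- it leaves the orbit product unchanged.
          shifted : KIso L L → Fin r → Fin r
          shifted α i = proj₁ (index (compose-automorphism α (A.to i)))

          shifted-≈ : ∀ α i z → fun (hom-of (A.to (shifted α i))) z ≈ fun (hom-of α) (KIso.to (A.to i) z)
          shifted-≈ α i = proj₂ (index (compose-automorphism α (A.to i)))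

          shifted-injective : ∀ α i j → shifted α i ≡ shifted α j → i ≡ j
          shifted-injective α i j e = A.injective λ z → hom-injective (hom-of α) (KIso.to (A.to i) z) (KIso.to (A.to j) z)
            (trans (sym (shifted-≈ α i z)) (trans (reflexive (≡.cong (λ k → fun (hom-of (A.to k)) z) e)) (shifted-≈ α j z)))

          orbit-invariant : ∀ (α : KIso L L) y → prod (List.map (fun (hom-of α)) orbit) y ≈ prod (List.map proj₁ orbit) y
          orbit-invariant α y = begin
            prod (List.map (fun (hom-of α)) orbit) y
              ≈⟨ prod-tabulate (fun (hom-of α)) (λ i → KIso.to (A.to i) x) y ⟩
            Π.sum (λ i → y + - fun (hom-of α) (KIso.to (A.to i) x))
              ≈⟨ Π.sum-cong-≋ {r} (λ i → +-congˡ (-‿cong (shifted-≈ α i x))) ⟨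
            Π.sum (λ i → y + - fun (hom-of (A.to (shifted α i))) x)
              ≈⟨ Π.sum-permute (λ i → y + - fun (hom-of (A.to i)) x) (injective⇒permutation (shifted α) (shifted-injective α)) ⟨
            Π.sum (λ i → y + - fun (hom-of (A.to i)) x)
              ≈⟨ prod-tabulate proj₁ (λ i → KIso.to (A.to i) x) y ⟨
            prod (List.map proj₁ orbit) y ∎

          -- Applying α to the coefficients gives the product over α A = A, the same function of y,
          -- and the values of a polynomial determine its coefficients.
          q-fixed : ∀ (α : KIso L L) → All (λ a → fun (hom-of α) a ≈ proj₁ a) q
          q-fixed α = coefficients-agree (hom-of α) (incl L) q λ y → +-cancelʳ (y ^ length orbit) _ _
            (trans (proj₂ (proj₂ expanded) (hom-of α) y) (trans (orbit-invariant α y) (sym (proj₂ (proj₂ expanded) (incl L) y))))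

          descend : ∀ q → (∀ (α : KIso L L) → All (λ a → fun (hom-of α) a ≈ proj₁ a) q) → ∃ λ (q′ : Lᴬ [X]) → List.map proj₁ q′ ≡ List.map proj₁ q
          descend []            _ = [] , ≡.refl
          descend ((a , p) ∷ q) h = let q′ , e = descend q (λ α → All.tail (h α)) in
            (a , p , λ α → All.head (h α)) ∷ q′ , ≡.cong (a ∷_) e

          q′ : Lᴬ [X]
          q′ = proj₁ (descend q q-fixed)

          q′-length : length q′ ≡ length orbit
          q′-length = ≡.trans (≡.sym (List.length-map proj₁ q′)) (≡.trans (≡.cong length (proj₂ (descend q q-fixed)))
            (≡.trans (List.length-map proj₁ q) (proj₁ (proj₂ expanded))))

          q′-at : ∀ y → monicAt Lᴬ (incl Lᴬ) q′ y ≈ prod (List.map proj₁ orbit) y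
          q′-at y = trans (+-cong (reflexive (≡.trans (at≡ Lᴬ y q′) (≡.trans (≡.cong (λ q → eval q y) (proj₂ (descend q q-fixed)))
            (≡.sym (at≡ L y q))))) (reflexive (≡.cong (y ^_) q′-length))) (proj₂ (proj₂ expanded) (incl L) y)

          -- The identity automorphism puts x into its own orbit.
          identity : KIso L L
          identity = automorphism {L} K⊆L fin (incl L) (λ _ _ → refl) proj₂

          x-root : monicAt Lᴬ (incl Lᴬ) q′ (proj₁ x) ≈ 0#
          x-root = let i , e = index identity in trans (q′-at (proj₁ x)) (root-prod (any-orbit i (sym (e x))))
            where
            any-orbit : ∀ i {y} → y ≈ fun (hom-of (A.to i)) x → Any (y ≈_) (List.map proj₁ orbit)
            any-orbit i e = map⁺ (tabulate⁺ i e)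

        image∈L : fun σ x ∈ elements L
        image∈L = any-∈ L {List.map proj₁ orbit} (AllP.map⁺ (AllP.tabulate⁺ (λ i → proj₂ (KIso.to (A.to i) x))))
          (prod-root (trans (sym (q′-at (fun σ x))) (hom-monicRoot {L} {Lᴬ} σ (incl Lᴬ) fixed⊆L fixes-fixed (proj₂ x) q′ x-root)))

    N′-stable : Stable L N′
    N′-stable σ ext x = image∈L σ ext x

    stable⇒N′⊆ : ∀ M → K₀ ⊆ M → M ⊆ L → Stable L M → N′ ⊆ M
    stable⇒N′⊆ M K⊆M M⊆L stable {y} (y∈S , y∈L , fixed) = degree-1⇒⊆ (≡.subst (Basis A M) degree≡1 (Adjoin-basis M K⊆M y m)) (∈-Adjoin M K⊆M y)
      where
      A = Adjoin M K⊆M y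
      m : MinimalPolynomial M y
      m = minimalPolynomial M K⊆M y
      open MinimalPolynomial m
      module R = Roots (roots M K⊆M (incl M) (λ _ _ → refl) (simple y∈S) m)
      root≈y : ∀ i → R.value i ≈ y
      root≈y i =
        let τ , ext , τy≈ = stable⇒root∈ {L} {M} K⊆M M⊆L (finite-above M K⊆M) stable y∈L (R.isRoot i)
            α = automorphism {L} K⊆L fin τ (λ p q → ext (K⊆M p) q) (stable τ ext)
        in trans (sym (τy≈ y∈L)) (fixed α)
      degree≤1 : ∀ n → (∀ (i j : Fin n) → i ≡ j) → n ℕ.≤ 1
      degree≤1 zero          _ = z≤n
      degree≤1 (suc zero)    _ = s≤s z≤n
      degree≤1 (suc (suc n)) h with () ← h zero (suc zero)
      -- `roots` lists degree many distinct roots, and all of them equal y; so any two indices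
      -- agree.
      degree≡1 : degree ≡ 1
      degree≡1 = ℕ.≤-antisym (degree≤1 degree (λ i j → R.injective i j (trans (root≈y i) (sym (root≈y j))))) (Minimal.positive {M} K⊆M m)

    private
      finite-L/S : Finite L L_S
      finite-L/S = finite-above L_S K⊆S

      finite-S/N′ : Finite L_S N′
      finite-S/N′ = finite-over {K₀} {N′} {L_S} K⊆N′ finite-S

      e rN : ℕ
      e = proj₁ finite-L/S
      rN = proj₁ finite-S/N′

      basis-L/N′ : Basis L N′ (rN ℕ.* e)
      basis-L/N′ = tower {N = N′} {L_S} {L} S⊆L N′⊆S (proj₂ finite-S/N′) (proj₂ finite-L/S)

      basis-L/K : Basis L K₀ (nS ℕ.* e)
      basis-L/K = tower {N = K₀} {L_S} {L} S⊆L K⊆S (proj₂ finite-S) (proj₂ finite-L/S)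

      module HN = ExtensionsTo (embeddings N′ K⊆N′ N′⊆S (proj₂ finite-S/N′))

    -- By normality of L/N′ its embeddings over N′ are exactly the automorphisms of L/K.
    automorphisms-N′ : Bijection (≡-setoid (Fin rN)) (Aut L)
    automorphisms-N′ = record
      { to        = auto
      ; cong      = λ { ≡.refl _ → refl }
      ; bijective = (λ {i} {j} → HN.injective i j) , λ α → let i , h = HN.complete (hom-of α) (fixed α) in i , λ { ≡.refl → h }
      }
      where
      fixed : ∀ (α : KIso L L) → Extends (hom-of α) (incl N′)
      fixed α (_ , _ , fix) q = trans (KIso.⟦⟧-cong α refl) (fix α)
      auto : Fin rN → KIso L L
      auto i = automorphism {L} K⊆L fin (HN.hom i) (λ p q → HN.extends i (K⊆N′ p) q) (N′-stable (HN.hom i) (HN.extends i))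

    private
      conjugate-hom : Fin s × Fin r → Hom L
      conjugate-hom (j , i) = compose (hom-of (proj₂ (proj₂ (C.to j)))) (A.to i)

      conjugate-hom-extends : ∀ p → Extends (conjugate-hom p) (incl K₀)
      conjugate-hom-extends (j , i) = let E , K⊆E , κ = C.to j in
        compose-extends {L} {L} K⊆L (hom-of κ) (A.to i) (hom-of-extends κ)

      range-⊆ : ∀ {j i j′ i′} → conjugate-hom (j , i) ≈ₕ conjugate-hom (j′ , i′) → proj₁ (C.to j) ⊆ proj₁ (C.to j′)
      range-⊆ {j} {i} {j′} {i′} h w∈E =
        let z , κz≈w  = onto (proj₂ (proj₂ (C.to j))) w∈E
            y , αy≈z  = onto (A.to i) (proj₂ z)
            κ′ = proj₂ (proj₂ (C.to j′))
        in ≈-closed (proj₁ (C.to j′)) (trans (sym (h y)) (trans (KIso.⟦⟧-cong (proj₂ (proj₂ (C.to j))) αy≈z) κz≈w))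
             (proj₂ (KIso.to κ′ (KIso.to (A.to i′) y)))

      same-conjugate : ∀ {j i j′ i′} → j ≡ j′ → conjugate-hom (j , i) ≈ₕ conjugate-hom (j′ , i′) → (j , i) ≡ (j′ , i′)
      same-conjugate {j} {i} {_} {i′} ≡.refl h = ≡.cong (j ,_) (A.injective λ z →
        hom-injective (hom-of (proj₂ (proj₂ (C.to j)))) (KIso.to (A.to i) z) (KIso.to (A.to i′) z) (h z))

      -- Equal embeddings have equal ranges, which fixes the conjugate; the isomorphism chosen onto
      -- it is injective and then fixes the automorphism.
      conjugate-hom-injective : ∀ p q → conjugate-hom p ≈ₕ conjugate-hom q → p ≡ q
      conjugate-hom-injective (j , i) (j′ , i′) h =
        same-conjugate (C.injective (range-⊆ {j} {i} {j′} {i′} h , range-⊆ {j′} {i′} {j} {i} (λ z → sym (h z)))) h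

      -- The range of τ is a conjugate, represented by some j with a chosen isomorphism κ; then τ =
      -- κ α for the automorphism α = κ⁻¹ τ.
      conjugate-hom-complete : ∀ τ → Extends τ (incl K₀) → ∃ λ p → conjugate-hom p ≈ₕ τ
      conjugate-hom-complete τ ext = (j , proj₁ (index α)) , λ z → trans (KIso.⟦⟧-cong κ (proj₂ (index α) z)) (κ⁻¹-≈ z)
        where
        E : Subfield
        E = rangeField τ
        τ-iso : KIso L E
        τ-iso = isoOnto {L} E τ ext (λ z → z , refl) (λ w∈E → w∈E)
        found = C.surjective (E , (λ p → (_ , K⊆L p) , ext p (K⊆L p)) , τ-iso)
        j = proj₁ found
        κ : KIso L (proj₁ (C.to j))
        κ = proj₂ (proj₂ (C.to j))
        preimage : ∀ z → ∃ λ z′ → fun (hom-of κ) z′ ≈ fun τ z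
        preimage z = onto κ (proj₂ (proj₂ found ≡.refl) (z , refl))
        κ⁻¹ : Elt L → Elt L
        κ⁻¹ z = proj₁ (preimage z)
        κ⁻¹-≈ : ∀ z → fun (hom-of κ) (κ⁻¹ z) ≈ fun τ z
        κ⁻¹-≈ z = proj₂ (preimage z)
        injective : ∀ y z → fun (hom-of κ) y ≈ fun (hom-of κ) z → proj₁ y ≈ proj₁ z
        injective = hom-injective (hom-of κ)
        module E = RawRing (eltRing L)
        υ : Hom L
        υ = mkHom (λ z → proj₁ (κ⁻¹ z))
          (λ y z y≈z → injective (κ⁻¹ y) (κ⁻¹ z) (trans (κ⁻¹-≈ y) (trans (Hom.⟦⟧-cong τ y≈z) (sym (κ⁻¹-≈ z)))))
          (λ y z → injective (κ⁻¹ (y E.+ z)) (κ⁻¹ y E.+ κ⁻¹ z) (trans (κ⁻¹-≈ (y E.+ z)) (trans (Hom.+-homo τ y z)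
            (trans (+-cong (sym (κ⁻¹-≈ y)) (sym (κ⁻¹-≈ z))) (sym (KIso.+-homo κ (κ⁻¹ y) (κ⁻¹ z)))))))
          (λ y z → injective (κ⁻¹ (y E.* z)) (κ⁻¹ y E.* κ⁻¹ z) (trans (κ⁻¹-≈ (y E.* z)) (trans (Hom.*-homo τ y z)
            (trans (*-cong (sym (κ⁻¹-≈ y)) (sym (κ⁻¹-≈ z))) (sym (KIso.*-homo κ (κ⁻¹ y) (κ⁻¹ z)))))))
          (injective (κ⁻¹ E.1#) E.1# (trans (κ⁻¹-≈ E.1#) (trans (Hom.1#-homo τ) (sym (KIso.1#-homo κ)))))
        α : KIso L L
        α = automorphism {L} K⊆L fin υ (λ p q → injective (κ⁻¹ (_ , q)) (_ , K⊆L p) (trans (κ⁻¹-≈ (_ , q))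
              (trans (ext p q) (sym (KIso.fixesK κ (_ , K⊆L p) p))))) (λ z → proj₂ (κ⁻¹ z))

    -- The pairs of a conjugate and an automorphism and the [L_S : K] embeddings over K inject into
    -- each other.
    conjugates*automorphisms : s ℕ.* r ≡ nS
    conjugates*automorphisms = ℕ.≤-antisym
        (Fin.injective⇒≤ {f = λ t → proj₁ (number (remQuot {s} r t))} λ {t} {t′} h →
          ≡.trans (≡.sym (Fin.combine-remQuot {s} r t)) (≡.trans (≡.cong (uncurry (combine {s} {r}))
            (conjugate-hom-injective (remQuot {s} r t) (remQuot {s} r t′) λ z →
              trans (sym (proj₂ (number (remQuot {s} r t)) z)) (trans (reflexive (≡.cong (λ i → fun (H.hom i) z) h)) (proj₂ (number (remQuot {s} r t′)) z))))
            (Fin.combine-remQuot {s} r t′)))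
        (Fin.injective⇒≤ {f = λ i → uncurry (combine {s} {r}) (proj₁ (pair i))} λ {i} {i′} h →
          H.injective i i′ λ z → trans (sym (proj₂ (pair i) z)) (trans (reflexive (≡.cong (λ p → fun (conjugate-hom p) z)
            (≡.trans (≡.sym (Fin.remQuot-combine {s} {r} (proj₁ (proj₁ (pair i))) (proj₂ (proj₁ (pair i)))))
              (≡.trans (≡.cong (remQuot {s} r) h) (Fin.remQuot-combine {s} {r} (proj₁ (proj₁ (pair i′))) (proj₂ (proj₁ (pair i′)))))))) (proj₂ (pair i′) z)))
      where
      number : ∀ p → ∃ λ i → H.hom i ≈ₕ conjugate-hom p
      number p = H.complete (conjugate-hom p) (conjugate-hom-extends p)
      pair : ∀ i → ∃ λ p → conjugate-hom p ≈ₕ H.hom i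
      pair i = conjugate-hom-complete (H.hom i) (H.extends i)

    private
      N′-normal : Normal L N′
      N′-normal = stable⇒normal {L} {N′} K⊆N′ N′⊆L (finite-above N′ K⊆N′) N′-stable

      d : ℕ
      d = descendingNormalIndex L

      [L∶N′]≡ : [ L ∶ N′ ] ≡ rN ℕ.* e
      [L∶N′]≡ = index-≡ basis-L/N′

      -- [L : N′] = [M : N′] [L : M], where the first factor is positive.
      index-≤ : ∀ M → K₀ ⊆ M → M ⊆ L → N′ ⊆ M → [ L ∶ M ] ℕ.≤ [ L ∶ N′ ]
      index-≤ M K⊆M M⊆L N′⊆M =
        let m , B = finite-above M K⊆M
            n , D = finite-sub {N′} {M} {L} M⊆L (_ , basis-L/N′)
        in ≡.subst₂ ℕ._≤_ (≡.sym (index-≡ B)) (≡.sym (index-≡ (tower {N = N′} {M} {L} M⊆L N′⊆M D B)))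
             (ℕ.m≤n*m m n {{ℕ.≢-nonZero λ n≡0 → basis-positive (≡.subst (Basis M N′) n≡0 D)}})

      normal⇒N′⊆ : ∀ M → IsSubextension M L → Normal L M → N′ ⊆ M
      normal⇒N′⊆ M (K⊆M , M⊆L) normal = stable⇒N′⊆ M K⊆M M⊆L (normal⇒stable {L} {M} K⊆M M⊆L normal)

      d≡[L∶N′] : d ≡ [ L ∶ N′ ]
      d≡[L∶N′] = descendingNormalIndex-≡
        ( (N′ , (K⊆N′ , N′⊆L) , N′-normal , ≡.refl)
        , λ M (K⊆M , M⊆L) normal → index-≤ M K⊆M M⊆L (normal⇒N′⊆ M (K⊆M , M⊆L) normal))

      HasIndex : Subfield → Set _
      HasIndex N = IsSubextension N L × Normal L N × [ L ∶ N ] ≡ d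

      same-index⇒⊆ : ∀ M → K₀ ⊆ M → M ⊆ L → N′ ⊆ M → [ L ∶ M ] ≡ [ L ∶ N′ ] → M ⊆ N′
      same-index⇒⊆ M K⊆M M⊆L N′⊆M same =
        let m , B = finite-above M K⊆M in
        degree-≤⇒⊆ {M = M} {N′} {L} N′⊆M M⊆L (_ , basis-L/N′) B basis-L/N′
          (ℕ.≤-reflexive (≡.trans (≡.sym [L∶N′]≡) (≡.trans (≡.sym same) (index-≡ B))))

      unique : ∀ M → HasIndex M → M ≐ N′
      unique M ((K⊆M , M⊆L) , normal , same) =
        same-index⇒⊆ M K⊆M M⊆L (normal⇒N′⊆ M (K⊆M , M⊆L) normal) (≡.trans same d≡[L∶N′]) ,
        normal⇒N′⊆ M (K⊆M , M⊆L) normal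

      -- A separable E inside `Lᴬ` is a separable subextension of L as well, so it lies in `L_S` by
      -- maximality.
      N′-maximal : IsMaximalSeparableSubextension N′ Lᴬ
      N′-maximal = (K⊆N′ , proj₂) , (λ z∈ → proj₁ (proj₂ maximal) (proj₁ z∈)) ,
        λ E (K⊆E , E⊆A) separable z∈E → proj₂ (proj₂ maximal) E (K⊆E , fixed⊆L ∘ E⊆A) separable z∈E , E⊆A z∈E

      clusterSize≡ : clusterSize L ≡ rN
      clusterSize≡ = cardinality-≡ {S = Aut L} automorphisms-N′

      d≡re : d ≡ clusterSize L ℕ.* [ L ∶ L_S ]
      d≡re = ≡.trans d≡[L∶N′] (≡.trans [L∶N′]≡ (≡.sym (≡.cong₂ ℕ._*_ clusterSize≡ (index-≡ (proj₂ finite-L/S)))))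

      s*r≡ : conjugateCount L ℕ.* clusterSize L ≡ nS
      s*r≡ = ≡.trans (≡.cong₂ ℕ._*_ (cardinality-≡ {S = Conjugates L} (proj₂ conjugates)) (cardinality-≡ {S = Aut L} (proj₂ automorphisms)))
        conjugates*automorphisms

      -- d s = (r [L : L_S]) s = (s r) [L : L_S] = [L_S : K] [L : L_S].
      ds≡ : d ℕ.* conjugateCount L ≡ [ L ∶ K₀ ]
      ds≡ = ≡.trans (≡.cong (ℕ._* conjugateCount L) d≡re) (≡.trans (rearrange (clusterSize L) [ L ∶ L_S ] (conjugateCount L))
          (≡.trans (≡.cong₂ ℕ._*_ s*r≡ (index-≡ (proj₂ finite-L/S))) (≡.sym (index-≡ basis-L/K))))
        where
        rearrange : ∀ a b c → (a ℕ.* b) ℕ.* c ≡ (c ℕ.* a) ℕ.* b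
        rearrange = solve-∀

      -- If L/K is normal, N′ lies in K and the two indices bound each other. Conversely, equal
      -- degrees force N′ into K, and stability over N′ gives stability over K.
      normal⇔ : Normal L K₀ ⇔ d ≡ [ L ∶ K₀ ]
      normal⇔ = mk⇔
        (λ normal → ≡.trans d≡[L∶N′] (ℕ.≤-antisym
          (≡.subst₂ ℕ._≤_ (≡.sym [L∶N′]≡) (≡.sym (index-≡ basis-L/K)) (basis-≤ {V = L} basis-L/N′ λ x∈L →
            let k , x≈ = Basis.spanning basis-L/K x∈L in lift {K₀} {N′} K⊆N′ ∘ k , x≈))
          (index-≤ K₀ K⊆K K⊆L (normal⇒N′⊆ K₀ (K⊆K , K⊆L) normal))))
        (λ d≡ → stable⇒normal {L} {K₀} K⊆K K⊆L fin (stable-mono {L} {N′} {K₀}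
          (degree-≤⇒⊆ {M = N′} {K₀} {L} K⊆N′ N′⊆L fin basis-L/N′ basis-L/K
            (ℕ.≤-reflexive (≡.trans (≡.sym (index-≡ basis-L/K)) (≡.trans (≡.sym d≡) (≡.trans d≡[L∶N′] [L∶N′]≡)))))
          N′-stable))

    characterisation :
      ∃ λ N′ →
        (HasIndex N′ × (∀ M → HasIndex M → M ≐ N′)) ×
        (∀ N″ → IsSubextension N″ L → Normal L N″ → N′ ⊆ N″) ×
        (IsMaximalSeparableSubextension N′ (fixedField L) ×
         d ≡ clusterSize L ℕ.* [ L ∶ L_S ] ×
         d ≡ multiclusterSize L L_S ×
         d ℕ.* conjugateCount L ≡ [ L ∶ K₀ ]) ×
        (Normal L K₀ ⇔ d ≡ [ L ∶ K₀ ])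
    characterisation = N′ , (((K⊆N′ , N′⊆L) , N′-normal , ≡.sym d≡[L∶N′]) , unique) , normal⇒N′⊆ ,
      (N′-maximal , d≡re , ≡.trans d≡re (ℕ.*-comm (clusterSize L) [ L ∶ L_S ]) , ds≡) , normal⇔

open import Data.Nat.Base using (_*_)

proposition2p16 :
  (em : ∀ {a} → ExcludedMiddle a) →
  ∀ {c ℓ} (K : Field c ℓ) (K̄ : AlgebraicClosure K) →
  let open Subfields (AlgebraicClosure.Ω K̄) hiding (_*_)
      K₀ = AlgebraicClosure.base K̄
      open Over K₀
      open Invariants em
  in
  (L L_S : Subfield) → K₀ ⊆ L → Finite L K₀ →
  IsMaximalSeparableSubextension L_S L →
  let d = descendingNormalIndex L
      r = clusterSize L
      s = conjugateCount L
      HasIndex = λ N → IsSubextension N L × Normal L N × [ L ∶ N ] ≡ d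
  in
  ∃ λ N′ →
    (HasIndex N′ × (∀ M → HasIndex M → M ≐ N′)) ×
    (∀ N″ → IsSubextension N″ L → Normal L N″ → N′ ⊆ N″) ×
    (IsMaximalSeparableSubextension N′ (fixedField L) ×
     d ≡ r * [ L ∶ L_S ] ×
     d ≡ multiclusterSize L L_S ×
     d * s ≡ [ L ∶ K₀ ]) ×
    (Normal L K₀ ⇔ d ≡ [ L ∶ K₀ ])
proposition2p16 em K K̄ = Main.characterisation em K̄
  (FrobeniusMap.frobenius em (AlgebraicClosure.Ω K̄) (AlgebraicClosure.algebraicallyClosed K̄))
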